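{- Let $D$ and $b$ be positive integers. If $\Gamma$ is a distance-regular graph with classical parameters $(D,b,\alpha,\beta)$ such that $D\geq 9$ and $b\geq 2$, then $\alpha<b^2(b+1)+1$.
   Context: All graphs are finite, undirected and simple. A connected graph $\Gamma$ of diameter $D$ is distance-regular if for each $0\le i\le D$ there are integers $b_i,c_i$ such that for any two vertices $x,y$ at distance $i$, exactly $c_i$ neighbours of $y$ are at distance $i-1$ from $x$ and exactly $b_i$ neighbours of $y$ are at distance $i+1$ from $x$. Write $\left[\begin{smallmatrix} i\\ 1\end{smallmatrix}\right]_b=1+b+\dots+b^{i-1}$. A distance-regular graph of diameter $D$ has classical parameters $(D,b,\alpha,\beta)$ if for all $0\le i\le D$: $c_i=\left[\begin{smallmatrix} i\\ 1\end{smallmatrix}\right]_b\bigl(1+\alpha\left[\begin{smallmatrix} i-1\\ 1\end{smallmatrix}\right]_b\bigr)$ and $b_i=\bigl(\left[\begin{smallmatrix} D\\ 1\end{smallmatrix}\right]_b-\left[\begin{smallmatrix} i\\ 1\end{smallmatrix}\right]_b\bigr)\bigl(\beta-\alpha\left[\begin{smallmatrix} i\\ 1\end{smallmatrix}\right]_b\bigr)$. -}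

module Defs where

open import Level using (Level; 0ℓ) renaming (suc to lsuc)
open import Data.Nat as ℕ using (ℕ; zero; suc; _∸_; _^_)
open import Data.Fin using (Fin)
open import Data.List using (List; length)
open import Data.List.Membership.Propositional using (_∈_)
open import Data.List.Relation.Unary.Unique.Propositional using (Unique)
open import Data.Product using (Σ; ∃-syntax; _×_)
open import Relation.Binary.PropositionalEquality using (_≡_)
open import Relation.Nullary using (¬_)
open import Function.Bundles using (_⇔_)
open import Data.Integer using (+_)
open import Data.Rational as ℚ using (ℚ)

record Graph : Set₁ where
  field
    n     : ℕ
    Adj   : Fin n → Fin n → Set
    sym   : ∀ {x y} → Adj x y → Adj y x
    irrefl : ∀ {x} → ¬ Adj x x

module _ (G : Graph) where
  open Graph G

  data Walk : Fin n → Fin n → ℕ → Set where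
    here  : ∀ {x} → Walk x x 0
    step  : ∀ {x y z m} → Adj x y → Walk y z m → Walk x z (suc m)

  Dist : Fin n → Fin n → ℕ → Set
  Dist x y i = Walk x y i × (∀ j → j ℕ.< i → ¬ Walk x y j)

  Connected : Set
  Connected = ∀ x y → ∃[ i ] Walk x y i

  HasDiameter : ℕ → Set
  HasDiameter D = (∀ x y → ∃[ i ] (i ℕ.≤ D × Dist x y i))
                × ∃[ x ] ∃[ y ] Dist x y D

  HasSize : (Fin n → Set) → ℕ → Set
  HasSize P k = Σ (List (Fin n)) λ l → Unique l × length l ≡ k × (∀ z → (z ∈ l) ⇔ P z)

  IsDistanceRegular : ℕ → (ℕ → ℕ) → (ℕ → ℕ) → Set
  IsDistanceRegular D c b =
    Connected × HasDiameter D ×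
    (∀ i x y → i ℕ.≤ D → Dist x y i →
        HasSize (λ z → Adj y z × ∃[ j ] (suc j ≡ i × Dist x z j)) (c i)
      × HasSize (λ z → Adj y z × Dist x z (suc i)) (b i))

ℕ→ℚ : ℕ → ℚ
ℕ→ℚ m = + m ℚ./ 1

-- Gaussian [i 1]_b = 1 + b + ... + b^(i-1)
gauss : ℕ → ℕ → ℕ
gauss b zero = 0
gauss b (suc i) = gauss b i ℕ.+ b ^ i

HasClassicalParameters : ℕ → ℕ → ℚ → ℚ → (ℕ → ℕ) → (ℕ → ℕ) → Set
HasClassicalParameters D b α β c bb =
  ∀ i → i ℕ.≤ D →
    (ℕ→ℚ (c i) ≡ ℕ→ℚ (gauss b i) ℚ.* (ℚ.1ℚ ℚ.+ α ℚ.* ℕ→ℚ (gauss b (i ∸ 1))))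
  × (ℕ→ℚ (bb i) ≡ (ℕ→ℚ (gauss b D) ℚ.- ℕ→ℚ (gauss b i)) ℚ.* (β ℚ.- α ℚ.* ℕ→ℚ (gauss b i)))

DRGClassical : Graph → ℕ → ℕ → ℚ → ℚ → Set
DRGClassical G D b α β =
  Σ (ℕ → ℕ) λ c → Σ (ℕ → ℕ) λ bb →
    IsDistanceRegular G D c bb × HasClassicalParameters D b α β c bb

{-# OPTIONS --safe #-}
-- Let q = b, m = q + 1, s = [D - 1], B = qs = [D] - 1, μ = c₂ - 1, and suppose that
-- α ≥ q²(q + 1) + 1.  The cosine sequence of the second largest eigenvalue b₁/q - 1 gives a
-- positive semidefinite matrix; restricted to the neighbours of a vertex x it says that
-- the adjacency matrix of the local graph at x satisfies A + mI ≥ 0.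
--
-- This has two consequences.  First, in the common neighbourhood Λ of an edge there are no
-- m + 1 pairwise non-adjacent vertices of large degree, while non-adjacent vertices of Λ
-- have at most c₂ - 2 common neighbours in Λ.  Hence all but few vertices of Λ are covered
-- by m cliques, and a largest clique C of the graph, with n + 1 vertices, satisfies
-- a₁ + 1 ≤ mn + O(μm³).  Secondly, a vertex outside C with t ≥ 1 neighbours in C satisfies
-- (t - 1)(n - μ) ≤ mqn.  Counting pairs of vertices of C together with their common
-- neighbours outside C then gives (a₁ + 1 - n)(n - μ) ≤ mq(k - n).
--
-- The cosine sequence of the smallest eigenvalue -[D] gives the Delsarte bound n ≤ β.
-- As a₁ + 1 = β + αB, k = (B + 1)β and β > αs, where s ≥ [8], these three bounds on n are
-- incompatible.
module Submission where

open import Algebra.Bundles using (CommutativeRing)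
open import Data.Nat as ℕ using (ℕ; zero; suc; _≡ᵇ_)
import Data.Nat.Properties as ℕP
open import Data.Bool as Bool using (Bool; true; false; _∧_; _∨_; not)
import Data.Bool.Properties as BoolP
open import Data.Fin using (Fin; zero; suc; toℕ)
import Data.Fin.Properties as FinP
open import Data.Integer as ℤ using (+_)
open import Data.Product using (∃; _×_; _,_; proj₁; proj₂)
open import Data.Sum using (_⊎_; inj₁; inj₂; map₂)
open import Data.Empty using (⊥; ⊥-elim)
open import Data.List using (List; []; _∷_; length)
open import Data.List.Membership.Propositional using (_∈_)
import Data.List.Relation.Unary.All as All
open import Data.List.Relation.Unary.AllPairs using ([]; _∷_)
open import Data.List.Relation.Unary.Any using (here; there)
open import Data.List.Relation.Unary.Unique.Propositional using (Unique)
open import Data.Maybe using (Maybe; just; nothing)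
open import Data.Rational hiding (truncate)
open import Data.Rational.Properties
import Data.Rational.Unnormalised as ℚᵘ
import Data.Rational.Unnormalised.Properties as ℚᵘP
import Data.Integer.Properties as ℤP
open import Relation.Binary.PropositionalEquality hiding ([_])
open import Relation.Nullary using (¬_; Dec; yes; no; does; contradiction)
open import Relation.Nullary.Decidable using (dec-true; dec-false)
import Algebra.Properties.Semiring.Sum (CommutativeRing.semiring +-*-commutativeRing) as Sum
open import Tactic.RingSolver using (solve-∀)
open import Tactic.RingSolver.Core.AlmostCommutativeRing using (AlmostCommutativeRing; fromCommutativeRing)
open import Function using (_∘_)
open import Function.Bundles using (Equivalence)
open import Relation.Binary.Definitions using (Tri; tri<; tri≈; tri>)
open import Defs

-- Rational arithmetic

-- The constant comes from the leading terms. With Q = q(q + 1), put n = xQB and α = aQ. The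
-- counting bound is linear in β, with a coefficient that changes sign near n = QB. Above that point
-- it is incompatible with n ≤ β. Below it, β may be replaced by the upper bound 2qn - αB, and a ≤
-- 2qx - (2q - 1)x² ≤ q²/(2q - 1) < q remains, whereas q²(q + 1) = qQ says that a > q. The bound on
-- a₁ + 1 enters as 2qn instead of mn: the surplus (q - 1)n pays for the error term of order μm³,
-- and s ≥ [8] makes it large enough. No spectral theorem is invoked and no irrational number
-- occurs. Both eigenvalues and their cosines are rational, and the matrix of cosines is positive
-- semidefinite because its square is a positive multiple of it, which follows from the three-term
-- recurrence of the distance matrices. All later inequalities evaluate this form, or the local form
-- derived from it, at an explicit vector.

0≟ : ∀ p → Maybe (0ℚ ≡ p)
0≟ p with 0ℚ ≟ p
... | yes e = just e
... | no _  = nothing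

ℚ-ring : AlmostCommutativeRing _ _
ℚ-ring = fromCommutativeRing +-*-commutativeRing 0≟

2ℚ : ℚ
2ℚ = 1ℚ + 1ℚ

0≤1 : 0ℚ ≤ 1ℚ
0≤1 = nonNegative⁻¹ 1ℚ

0<1 : 0ℚ < 1ℚ
0<1 = positive⁻¹ 1ℚ

module _ {p q : ℚ} where

  0≤q-p : p ≤ q → 0ℚ ≤ q - p
  0≤q-p p≤q = subst (_≤ q - p) (+-inverseʳ p) (+-monoˡ-≤ (- p) p≤q)

  0≤q-p⇒p≤q : 0ℚ ≤ q - p → p ≤ q
  0≤q-p⇒p≤q h = subst₂ _≤_ (+-identityʳ p) (cancel p q) (+-monoʳ-≤ p h)
    where
    cancel : ∀ p q → p + (q - p) ≡ q
    cancel = solve-∀ ℚ-ring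

  0<q-p : p < q → 0ℚ < q - p
  0<q-p p<q = subst (_< q - p) (+-inverseʳ p) (+-monoˡ-< (- p) p<q)

  0<q-p⇒p<q : 0ℚ < q - p → p < q
  0<q-p⇒p<q h = subst₂ _<_ (+-identityʳ p) (cancel p q) (+-monoʳ-< p h)
    where
    cancel : ∀ p q → p + (q - p) ≡ q
    cancel = solve-∀ ℚ-ring

  ≤-by : ∀ {e} → q - p ≡ e → 0ℚ ≤ e → p ≤ q
  ≤-by eq h = 0≤q-p⇒p≤q (subst (0ℚ ≤_) (sym eq) h)

  <-by : ∀ {e} → q - p ≡ e → 0ℚ < e → p < q
  <-by eq h = 0<q-p⇒p<q (subst (0ℚ <_) (sym eq) h)

  0≤+ : 0ℚ ≤ p → 0ℚ ≤ q → 0ℚ ≤ p + q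
  0≤+ h₁ h₂ = subst (_≤ p + q) (+-identityʳ 0ℚ) (+-mono-≤ h₁ h₂)

  0<+ : 0ℚ < p → 0ℚ ≤ q → 0ℚ < p + q
  0<+ h₁ h₂ = subst (_< p + q) (+-identityʳ 0ℚ) (+-mono-<-≤ h₁ h₂)

  0≤* : 0ℚ ≤ p → 0ℚ ≤ q → 0ℚ ≤ p * q
  0≤* h₁ h₂ = nonNegative⁻¹ (p * q)
    {{nonNeg*nonNeg⇒nonNeg p {{nonNegative h₁}} q {{nonNegative h₂}}}}

  0<* : 0ℚ < p → 0ℚ < q → 0ℚ < p * q
  0<* h₁ h₂ = positive⁻¹ (p * q) {{pos*pos⇒pos p {{positive h₁}} q {{positive h₂}}}}

  0≤*-cancel : 0ℚ < p → 0ℚ ≤ p * q → 0ℚ ≤ q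
  0≤*-cancel h₁ h₂ = *-cancelˡ-≤-pos p {{positive h₁}} (subst (_≤ p * q) (sym (*-zeroʳ p)) h₂)

  0<*-cancel : 0ℚ < p → 0ℚ < p * q → 0ℚ < q
  0<*-cancel h₁ h₂ =
    *-cancelˡ-<-nonNeg p {{nonNegative (<⇒≤ h₁)}} (subst (_< p * q) (sym (*-zeroʳ p)) h₂)

0≤p² : ∀ p → 0ℚ ≤ p * p
0≤p² p with ≤-total 0ℚ p
... | inj₁ h = 0≤* h h
... | inj₂ h = subst (0ℚ ≤_) (neg² p) (0≤* (neg-antimono-≤ h) (neg-antimono-≤ h))
  where
  neg² : ∀ p → (- p) * (- p) ≡ p * p
  neg² = solve-∀ ℚ-ring

reciprocal : ∀ {p} → 0ℚ < p → ∃ λ r → p * r ≡ 1ℚ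
reciprocal {p} h = 1/ p , *-inverseʳ p
  where instance _ = pos⇒nonZero p {{positive h}}

infix 9 _⁻¹

-- Total, with default value 0, so that a cosine sequence can be defined by recursion at every
-- index, including those beyond the diameter.
_⁻¹ : ℚ → ℚ
p ⁻¹ with 0ℚ <? p
... | yes h = proj₁ (reciprocal h)
... | no _  = 0ℚ

⁻¹-inverse : ∀ {p} → 0ℚ < p → p * p ⁻¹ ≡ 1ℚ
⁻¹-inverse {p} h with 0ℚ <? p
... | yes h′ = proj₂ (reciprocal h′)
... | no ≮   = contradiction h ≮

toℚᵘ-ι : ∀ n → toℚᵘ (ℕ→ℚ n) ℚᵘ.≃ ℚᵘ.mkℚᵘ (+ n) 0
toℚᵘ-ι n = toℚᵘ-fromℚᵘ (ℚᵘ.mkℚᵘ (+ n) 0)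

ι-+ : ∀ m n → ℕ→ℚ (m ℕ.+ n) ≡ ℕ→ℚ m + ℕ→ℚ n
ι-+ m n = toℚᵘ-injective (ℚᵘP.≃-trans (toℚᵘ-ι (m ℕ.+ n)) (ℚᵘP.≃-sym
  (ℚᵘP.≃-trans (toℚᵘ-homo-+ (ℕ→ℚ m) (ℕ→ℚ n)) (ℚᵘP.≃-trans (ℚᵘP.+-cong (toℚᵘ-ι m) (toℚᵘ-ι n))
    (ℚᵘ.*≡* (cong (ℤ._* (+ 1)) (cong₂ ℤ._+_ (ℤP.*-identityʳ (+ m)) (ℤP.*-identityʳ (+ n)))))))))

ι-* : ∀ m n → ℕ→ℚ (m ℕ.* n) ≡ ℕ→ℚ m * ℕ→ℚ n
ι-* m n = toℚᵘ-injective (ℚᵘP.≃-trans (toℚᵘ-ι (m ℕ.* n)) (ℚᵘP.≃-sym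
  (ℚᵘP.≃-trans (toℚᵘ-homo-* (ℕ→ℚ m) (ℕ→ℚ n)) (ℚᵘP.≃-trans (ℚᵘP.*-cong (toℚᵘ-ι m) (toℚᵘ-ι n))
    (ℚᵘ.*≡* (cong (ℤ._* (+ 1)) (sym (ℤP.pos-* m n))))))))

ι-suc : ∀ n → ℕ→ℚ (suc n) ≡ 1ℚ + ℕ→ℚ n
ι-suc n = ι-+ 1 n

0≤ι : ∀ n → 0ℚ ≤ ℕ→ℚ n
0≤ι zero    = ≤-refl
0≤ι (suc n) = subst (0ℚ ≤_) (sym (ι-suc n)) (0≤+ 0≤1 (0≤ι n))

ι-mono : ∀ {m n} → m ℕ.≤ n → ℕ→ℚ m ≤ ℕ→ℚ n
ι-mono {m} {n} m≤n = subst₂ _≤_ (+-identityʳ _) (trans (sym (ι-+ m (n ℕ.∸ m))) (cong ℕ→ℚ (ℕP.m+[n∸m]≡n m≤n)))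
  (+-monoʳ-≤ (ℕ→ℚ m) (0≤ι (n ℕ.∸ m)))

ι-cancel-≤ : ∀ {m n} → ℕ→ℚ m ≤ ℕ→ℚ n → m ℕ.≤ n
ι-cancel-≤ {m} {n} h with m ℕ.≤? n
... | yes m≤n = m≤n
... | no m≰n  = contradiction (<-≤-trans n<1+n (≤-trans 1+n≤m h)) (<-irrefl refl)
  where
  1+n≤m : 1ℚ + ℕ→ℚ n ≤ ℕ→ℚ m
  1+n≤m = subst (_≤ ℕ→ℚ m) (ι-suc n) (ι-mono (ℕP.≰⇒> m≰n))
  n<1+n : ℕ→ℚ n < 1ℚ + ℕ→ℚ n
  n<1+n = subst (_< 1ℚ + ℕ→ℚ n) (+-identityˡ _) (+-monoˡ-< (ℕ→ℚ n) 0<1)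

-- Indicators and finite sums

[_] : Bool → ℚ
[ true ]  = 1ℚ
[ false ] = 0ℚ

0≤[] : ∀ a → 0ℚ ≤ [ a ]
0≤[] true  = 0≤1
0≤[] false = ≤-refl

[]≤1 : ∀ a → [ a ] ≤ 1ℚ
[]≤1 true  = ≤-refl
[]≤1 false = 0≤1

[∧] : ∀ a b → [ a ∧ b ] ≡ [ a ] * [ b ]
[∧] true b  = sym (*-identityˡ [ b ])
[∧] false b = sym (*-zeroˡ [ b ])

[]² : ∀ a → [ a ] * [ a ] ≡ [ a ]
[]² true  = refl
[]² false = refl

guard-mono : ∀ a {p q} → (a ≡ true → p ≤ q) → [ a ] * p ≤ [ a ] * q
guard-mono true  {p} {q} h = subst₂ _≤_ (sym (*-identityˡ p)) (sym (*-identityˡ q)) (h refl)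
guard-mono false {p} {q} h = ≤-reflexive (trans (*-zeroˡ p) (sym (*-zeroˡ q)))

guard-cong : ∀ a {p q} → (a ≡ true → p ≡ q) → [ a ] * p ≡ [ a ] * q
guard-cong true  h = cong (1ℚ *_) (h refl)
guard-cong false {p} {q} h = trans (*-zeroˡ p) (sym (*-zeroˡ q))

indicator-≤ : ∀ a {p} → 0ℚ ≤ p → (a ≡ true → 1ℚ ≤ p) → [ a ] ≤ p
indicator-≤ true  _   h = h refl
indicator-≤ false 0≤p _ = 0≤p

-- Opaque, so that unification never unfolds a sum.
opaque
  ∑ : ∀ {n} → (Fin n → ℚ) → ℚ
  ∑ = Sum.sum

  ∑-suc : ∀ {n} (f : Fin (suc n) → ℚ) → ∑ f ≡ f zero + ∑ (f ∘ suc)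
  ∑-suc f = refl

  ∑-cong : ∀ {n} {f g : Fin n → ℚ} → (∀ i → f i ≡ g i) → ∑ f ≡ ∑ g
  ∑-cong = Sum.sum-cong-≗

  ∑-mono : ∀ {n} {f g : Fin n → ℚ} → (∀ i → f i ≤ g i) → ∑ f ≤ ∑ g
  ∑-mono {zero}  h = ≤-refl
  ∑-mono {suc n} h = +-mono-≤ (h zero) (∑-mono (h ∘ suc))

  ∑-0 : ∀ {n} → ∑ {n} (λ _ → 0ℚ) ≡ 0ℚ
  ∑-0 {n} = Sum.sum-replicate-zero n

  ∑-+ : ∀ {n} (f g : Fin n → ℚ) → ∑ (λ i → f i + g i) ≡ ∑ f + ∑ g
  ∑-+ = Sum.∑-distrib-+

  ∑-*ˡ : ∀ {n} c (f : Fin n → ℚ) → ∑ (λ i → c * f i) ≡ c * ∑ f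
  ∑-*ˡ c f = sym (Sum.*-distribˡ-sum c f)

  ∑-*ʳ : ∀ {n} c (f : Fin n → ℚ) → ∑ (λ i → f i * c) ≡ ∑ f * c
  ∑-*ʳ c f = sym (Sum.*-distribʳ-sum c f)

  ∑-comm : ∀ {m n} (f : Fin m → Fin n → ℚ) → ∑ (λ i → ∑ (f i)) ≡ ∑ (λ j → ∑ (λ i → f i j))
  ∑-comm = Sum.∑-comm

0≤∑ : ∀ {n} {f : Fin n → ℚ} → (∀ i → 0ℚ ≤ f i) → 0ℚ ≤ ∑ f
0≤∑ {n} {f} h = subst (_≤ ∑ f) ∑-0 (∑-mono h)

∑-zero : ∀ {n} {f : Fin n → ℚ} → (∀ i → f i ≡ 0ℚ) → ∑ f ≡ 0ℚ
∑-zero h = trans (∑-cong h) ∑-0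

infix 5 _==_

_==_ : ∀ {n} → Fin n → Fin n → Bool
i == j = does (i FinP.≟ j)

==-refl : ∀ {n} (i : Fin n) → (i == i) ≡ true
==-refl i = dec-true (i FinP.≟ i) refl

≢⇒== : ∀ {n} {i j : Fin n} → i ≢ j → (i == j) ≡ false
≢⇒== {i = i} {j} = dec-false (i FinP.≟ j)

∑-δ : ∀ {n} (i : Fin n) (f : Fin n → ℚ) → ∑ (λ j → [ i == j ] * f j) ≡ f i
∑-δ {suc n} zero f = trans (∑-suc _) (
  trans (cong₂ _+_ (*-identityˡ (f zero)) (∑-zero (λ j → *-zeroˡ (f (suc j))))) (+-identityʳ _))
∑-δ {suc n} (suc i) f = trans (∑-suc _) (
  trans (cong₂ _+_ (*-zeroˡ (f zero)) (∑-δ i (f ∘ suc))) (+-identityˡ _))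

∑-term : ∀ {n} (i : Fin n) {f : Fin n → ℚ} → (∀ j → 0ℚ ≤ f j) → f i ≤ ∑ f
∑-term i {f} h = subst (_≤ ∑ f) (∑-δ i f) (∑-mono λ j →
  subst ([ i == j ] * f j ≤_) (*-identityˡ (f j))
    (*-monoʳ-≤-nonNeg (f j) {{nonNegative (h j)}} ([]≤1 (i == j))))

≡ᵇ-refl : ∀ i → (i ≡ᵇ i) ≡ true
≡ᵇ-refl zero    = refl
≡ᵇ-refl (suc i) = ≡ᵇ-refl i

suc≢ᵇ : ∀ i → (suc i ≡ᵇ i) ≡ false
suc≢ᵇ zero    = refl
suc≢ᵇ (suc i) = suc≢ᵇ i

≢ᵇsuc : ∀ i → (i ≡ᵇ suc i) ≡ false
≢ᵇsuc zero    = refl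
≢ᵇsuc (suc i) = ≢ᵇsuc i

suc²≢ᵇ : ∀ i → (suc (suc i) ≡ᵇ i) ≡ false
suc²≢ᵇ zero    = refl
suc²≢ᵇ (suc i) = suc²≢ᵇ i

≢ᵇsuc² : ∀ i → (i ≡ᵇ suc (suc i)) ≡ false
≢ᵇsuc² zero    = refl
≢ᵇsuc² (suc i) = ≢ᵇsuc² i

<⇒≢ᵇ : ∀ {i j} → i ℕ.< j → (i ≡ᵇ j) ≡ false
<⇒≢ᵇ {zero}  {suc j} _         = refl
<⇒≢ᵇ {suc i} {suc j} (ℕ.s≤s h) = <⇒≢ᵇ h

≡ᵇ-true : ∀ i j → (i ≡ᵇ j) ≡ true → i ≡ j
≡ᵇ-true i j h = ℕP.≡ᵇ⇒≡ i j (subst Bool.T (sym h) _)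

∑-δℕ : ∀ {n i} → i ℕ.< n → (u : ℕ → ℚ) → ∑ (λ (j : Fin n) → [ i ≡ᵇ toℕ j ] * u (toℕ j)) ≡ u i
∑-δℕ {suc n} {zero} _ u = trans (∑-suc _) (
  trans (cong₂ _+_ (*-identityˡ (u 0)) (∑-zero {n} (λ j → *-zeroˡ (u (suc (toℕ j)))))) (+-identityʳ _))
∑-δℕ {suc n} {suc i} (ℕ.s≤s h) u = trans (∑-suc _) (
  trans (cong₂ _+_ (*-zeroˡ (u 0)) (∑-δℕ h (u ∘ suc))) (+-identityˡ _))

-- Distance-regular graphs and their positive semidefinite matrices of cosines

record DistanceRegular (D : ℕ) (c b : ℕ → ℚ) : Set where
  field
    N       : ℕ
    d       : Fin N → Fin N → ℕ
    d-refl  : ∀ x → d x x ≡ 0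
    d-zero  : ∀ {x y} → d x y ≡ 0 → x ≡ y
    d-sym   : ∀ x y → d x y ≡ d y x
    d≤D     : ∀ x y → d x y ℕ.≤ D
    d-step  : ∀ x y z → d y z ≡ 1 →
              d x z ≡ d x y ⊎ d x z ≡ suc (d x y) ⊎ suc (d x z) ≡ d x y
    count-c : ∀ x y → ∑ (λ z → [ d y z ≡ᵇ 1 ] * [ suc (d x z) ≡ᵇ d x y ]) ≡ c (d x y)
    count-b : ∀ x y → ∑ (λ z → [ d y z ≡ᵇ 1 ] * [ d x z ≡ᵇ suc (d x y) ]) ≡ b (d x y)

module Spectral {D c b} (Γ : DistanceRegular D c b) where
  open DistanceRegular Γ

  V : Set
  V = Fin N

  infix 5 _~_

  _~_ : V → V → Bool
  y ~ z = d y z ≡ᵇ 1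

  ~-sym : ∀ y z → (y ~ z) ≡ (z ~ y)
  ~-sym y z = cong (_≡ᵇ 1) (d-sym y z)

  a : ℕ → ℚ
  a i = b 0 - c i - b i

  -- Row `i` of the tridiagonal intersection matrix, applied to `u`. The truncated predecessor is
  -- harmless at `i = 0`: since `a 0` is `b 0 - c 0 - b 0`, the two multiples of `c 0 * u 0` cancel.
  recur : (ℕ → ℚ) → ℕ → ℚ
  recur u i = c i * u (ℕ.pred i) + a i * u i + b i * u (suc i)

  valency : ∀ y → ∑ (λ z → [ y ~ z ]) ≡ b 0
  valency y = begin
    ∑ (λ z → [ y ~ z ])                          ≡⟨ ∑-cong pointwise ⟨
    ∑ (λ z → [ y ~ z ] * [ d y z ≡ᵇ suc (d y y) ]) ≡⟨ count-b y y ⟩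
    b (d y y)                                    ≡⟨ cong b (d-refl y) ⟩
    b 0 ∎
    where
    open ≡-Reasoning
    pointwise : ∀ z → [ y ~ z ] * [ d y z ≡ᵇ suc (d y y) ] ≡ [ y ~ z ]
    pointwise z rewrite d-refl y = []² (y ~ z)

  -- Interpolation by indicators turns the three cases of `d-step` into one linear formula, which
  -- can be summed with `count-c` and `count-b`.
  neighbour-value : ∀ (u : ℕ → ℚ) i j → j ≡ i ⊎ j ≡ suc i ⊎ suc j ≡ i →
    u j ≡ u i + [ suc j ≡ᵇ i ] * (u (ℕ.pred i) - u i) + [ j ≡ᵇ suc i ] * (u (suc i) - u i)
  neighbour-value u i .i (inj₁ refl) rewrite suc≢ᵇ i | ≢ᵇsuc i =
    lemma (u i) (u (ℕ.pred i)) (u (suc i))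
    where
    lemma : ∀ p q r → p ≡ p + 0ℚ * (q - p) + 0ℚ * (r - p)
    lemma = solve-∀ ℚ-ring
  neighbour-value u i .(suc i) (inj₂ (inj₁ refl)) rewrite suc²≢ᵇ i | ≡ᵇ-refl i =
    lemma (u i) (u (ℕ.pred i)) (u (suc i))
    where
    lemma : ∀ p q r → r ≡ p + 0ℚ * (q - p) + 1ℚ * (r - p)
    lemma = solve-∀ ℚ-ring
  neighbour-value u .(suc j) j (inj₂ (inj₂ refl)) rewrite ≡ᵇ-refl j | ≢ᵇsuc² j =
    lemma (u (suc j)) (u j) (u (suc (suc j)))
    where
    lemma : ∀ p q r → q ≡ p + 1ℚ * (q - p) + 0ℚ * (r - p)
    lemma = solve-∀ ℚ-ring

  neighbour-sum : ∀ u x y → ∑ (λ z → [ y ~ z ] * u (d x z)) ≡ recur u (d x y)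
  neighbour-sum u x y = begin
    ∑ (λ z → [ y ~ z ] * u (d x z))
      ≡⟨ ∑-cong pointwise ⟩
    ∑ (λ z → [ y ~ z ] * u i + [ y ~ z ] * [ suc (d x z) ≡ᵇ i ] * u⁻ + [ y ~ z ] * [ d x z ≡ᵇ suc i ] * u⁺)
      ≡⟨ trans (∑-+ _ (λ z → [ y ~ z ] * [ d x z ≡ᵇ suc i ] * u⁺)) (cong₂ _+_ (∑-+ _ _) (∑-*ʳ u⁺ _)) ⟩
    ∑ (λ z → [ y ~ z ] * u i) + ∑ (λ z → [ y ~ z ] * [ suc (d x z) ≡ᵇ i ] * u⁻)
      + ∑ (λ z → [ y ~ z ] * [ d x z ≡ᵇ suc i ]) * u⁺
      ≡⟨ cong₂ _+_ (cong₂ _+_ (trans (∑-*ʳ (u i) _) (cong (_* u i) (valency y)))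
                              (trans (∑-*ʳ u⁻ _) (cong (_* u⁻) (count-c x y))))
                   (cong (_* u⁺) (count-b x y)) ⟩
    b 0 * u i + c i * u⁻ + b i * u⁺
      ≡⟨ collect (b 0) (c i) (b i) (u i) (u (ℕ.pred i)) (u (suc i)) ⟩
    recur u i ∎
    where
    open ≡-Reasoning
    i = d x y
    u⁻ = u (ℕ.pred i) - u i
    u⁺ = u (suc i) - u i
    collect : ∀ k c b p q r → k * p + c * (q - p) + b * (r - p) ≡ c * q + (k - c - b) * p + b * r
    collect = solve-∀ ℚ-ring
    off : ∀ p q r s t v → 0ℚ * p ≡ 0ℚ * q + 0ℚ * r * s + 0ℚ * t * v
    off = solve-∀ ℚ-ring
    on : ∀ p q r s t → 1ℚ * (p + q * r + s * t) ≡ 1ℚ * p + 1ℚ * q * r + 1ℚ * s * t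
    on = solve-∀ ℚ-ring
    pointwise : ∀ z → [ y ~ z ] * u (d x z) ≡
      [ y ~ z ] * u i + [ y ~ z ] * [ suc (d x z) ≡ᵇ i ] * u⁻ + [ y ~ z ] * [ d x z ≡ᵇ suc i ] * u⁺
    pointwise z with y ~ z in eq
    ... | false = off (u (d x z)) (u i) [ suc (d x z) ≡ᵇ i ] u⁻ [ d x z ≡ᵇ suc i ] u⁺
    ... | true  = trans (cong (1ℚ *_) (neighbour-value u i (d x z) (d-step x y z (≡ᵇ-true (d y z) 1 eq))))
                        (on (u i) [ suc (d x z) ≡ᵇ i ] u⁻ [ d x z ≡ᵇ suc i ] u⁺)

  module Cosines (u : ℕ → ℚ) (θ : ℚ) (0<u₀ : 0ℚ < u 0) (c₀ : c 0 ≡ 0ℚ)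
                 (0<c : ∀ i → suc i ℕ.≤ D → 0ℚ < c (suc i))
                 (eigen : ∀ i → i ℕ.≤ D → recur u i ≡ θ * u i) where

    -- An entry of the product of the distance-`i` matrix with the matrix (u (d x y)).
    shell : ℕ → V → V → ℚ
    shell i x y = ∑ (λ z → [ d x z ≡ᵇ i ] * u (d z y))

    eigenvector : ∀ x y → ∑ (λ z → [ x ~ z ] * u (d z y)) ≡ θ * u (d x y)
    eigenvector x y = begin
      ∑ (λ z → [ x ~ z ] * u (d z y)) ≡⟨ ∑-cong (λ z → cong (λ t → [ x ~ z ] * u t) (d-sym z y)) ⟩
      ∑ (λ z → [ x ~ z ] * u (d y z)) ≡⟨ neighbour-sum u y x ⟩
      recur u (d y x)                 ≡⟨ eigen (d y x) (d≤D y x) ⟩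
      θ * u (d y x)                   ≡⟨ cong (λ t → θ * u t) (d-sym y x) ⟩
      θ * u (d x y) ∎
      where open ≡-Reasoning

    b[i-1] : ℕ → ℚ
    b[i-1] zero    = 0ℚ
    b[i-1] (suc i) = b i

    -- These are the coefficients in A A_i = c_(i+1) A_(i+1) + a_i A_i + b_(i-1) A_(i-1), where A_i
    -- is the distance-`i` matrix: an entry of the product is the sum of the indicator of distance
    -- `i` over the neighbours of a vertex.
    intersection : ∀ i h → recur (λ j → [ j ≡ᵇ i ]) h ≡
      c (suc i) * [ h ≡ᵇ suc i ] + a i * [ h ≡ᵇ i ] + b[i-1] i * [ suc h ≡ᵇ i ]
    intersection i h = cong₂ _+_ (cong₂ _+_ (c-part h) (a-part h)) (b-part i)
      where
      scale : ∀ {i j} (f : ℕ → ℚ) → f i * [ i ≡ᵇ j ] ≡ f j * [ i ≡ᵇ j ]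
      scale {i} {j} f with i ≡ᵇ j in eq
      ... | true  = cong (λ t → f t * 1ℚ) (≡ᵇ-true i j eq)
      ... | false = trans (*-zeroʳ (f i)) (sym (*-zeroʳ (f j)))
      c-part : ∀ h → c h * [ ℕ.pred h ≡ᵇ i ] ≡ c (suc i) * [ h ≡ᵇ suc i ]
      c-part zero    = trans (cong (_* [ 0 ≡ᵇ i ]) c₀) (trans (*-zeroˡ [ 0 ≡ᵇ i ]) (sym (*-zeroʳ (c (suc i)))))
      c-part (suc h) = scale {h} {i} (c ∘ suc)
      a-part : ∀ h → a h * [ h ≡ᵇ i ] ≡ a i * [ h ≡ᵇ i ]
      a-part h = scale {h} {i} a
      b-part : ∀ i → b h * [ suc h ≡ᵇ i ] ≡ b[i-1] i * [ suc h ≡ᵇ i ]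
      b-part zero    = trans (*-zeroʳ (b h)) (sym (*-zeroʳ 0ℚ))
      b-part (suc i) = scale {h} {i} b

    shell[i-1] : ℕ → V → V → ℚ
    shell[i-1] zero    x y = 0ℚ
    shell[i-1] (suc i) x y = shell i x y

    shell-sum : ∀ i x y → ∑ (λ w → [ x ~ w ] * shell i w y) ≡
      c (suc i) * shell (suc i) x y + a i * shell i x y + b[i-1] i * shell[i-1] i x y
    shell-sum i x y = begin
      ∑ (λ w → [ x ~ w ] * shell i w y)
        ≡⟨ ∑-cong (λ w → sym (∑-*ˡ [ x ~ w ] _)) ⟩
      ∑ (λ w → ∑ (λ z → [ x ~ w ] * ([ d w z ≡ᵇ i ] * u (d z y))))
        ≡⟨ ∑-comm _ ⟩
      ∑ (λ z → ∑ (λ w → [ x ~ w ] * ([ d w z ≡ᵇ i ] * u (d z y))))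
        ≡⟨ ∑-cong inner ⟩
      ∑ (λ z → C * ([ d x z ≡ᵇ suc i ] * u (d z y)) + A * ([ d x z ≡ᵇ i ] * u (d z y))
             + B * ([ suc (d x z) ≡ᵇ i ] * u (d z y)))
        ≡⟨ trans (∑-+ _ (λ z → B * ([ suc (d x z) ≡ᵇ i ] * u (d z y)))) (cong₂ _+_ (∑-+ _ _) refl) ⟩
      ∑ (λ z → C * ([ d x z ≡ᵇ suc i ] * u (d z y))) + ∑ (λ z → A * ([ d x z ≡ᵇ i ] * u (d z y)))
        + ∑ (λ z → B * ([ suc (d x z) ≡ᵇ i ] * u (d z y)))
        ≡⟨ cong₂ _+_ (cong₂ _+_ (∑-*ˡ C _) (∑-*ˡ A _)) (trans (∑-*ˡ B _) (last i)) ⟩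
      C * shell (suc i) x y + A * shell i x y + B * shell[i-1] i x y ∎
      where
      open ≡-Reasoning
      C = c (suc i)
      A = a i
      B = b[i-1] i
      last : ∀ i → b[i-1] i * ∑ (λ z → [ suc (d x z) ≡ᵇ i ] * u (d z y)) ≡ b[i-1] i * shell[i-1] i x y
      last zero    = *-zeroˡ (∑ (λ z → [ suc (d x z) ≡ᵇ 0 ] * u (d z y)))
      last (suc i) = refl
      spread : ∀ p q r s t v w → (p * q + r * s + t * v) * w ≡ p * (q * w) + r * (s * w) + t * (v * w)
      spread = solve-∀ ℚ-ring
      inner : ∀ z → ∑ (λ w → [ x ~ w ] * ([ d w z ≡ᵇ i ] * u (d z y))) ≡
        C * ([ d x z ≡ᵇ suc i ] * u (d z y)) + A * ([ d x z ≡ᵇ i ] * u (d z y))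
          + B * ([ suc (d x z) ≡ᵇ i ] * u (d z y))
      inner z = begin
        ∑ (λ w → [ x ~ w ] * ([ d w z ≡ᵇ i ] * u (d z y)))
          ≡⟨ ∑-cong (λ w → trans (sym (*-assoc [ x ~ w ] [ d w z ≡ᵇ i ] (u (d z y))))
               (cong (λ t → [ x ~ w ] * [ t ≡ᵇ i ] * u (d z y)) (d-sym w z))) ⟩
        ∑ (λ w → [ x ~ w ] * [ d z w ≡ᵇ i ] * u (d z y))
          ≡⟨ ∑-*ʳ (u (d z y)) _ ⟩
        ∑ (λ w → [ x ~ w ] * [ d z w ≡ᵇ i ]) * u (d z y)
          ≡⟨ cong (_* u (d z y)) (trans (neighbour-sum (λ j → [ j ≡ᵇ i ]) z x)
               (trans (cong (recur (λ j → [ j ≡ᵇ i ])) (d-sym z x)) (intersection i (d x z)))) ⟩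
        (C * [ d x z ≡ᵇ suc i ] + A * [ d x z ≡ᵇ i ] + B * [ suc (d x z) ≡ᵇ i ]) * u (d z y)
          ≡⟨ spread C [ d x z ≡ᵇ suc i ] A [ d x z ≡ᵇ i ] B [ suc (d x z) ≡ᵇ i ] (u (d z y)) ⟩
        C * ([ d x z ≡ᵇ suc i ] * u (d z y)) + A * ([ d x z ≡ᵇ i ] * u (d z y))
          + B * ([ suc (d x z) ≡ᵇ i ] * u (d z y)) ∎

    ShellEigen : ℕ → Set
    ShellEigen i = ∃ λ κ → ∀ x y → shell i x y ≡ κ * u (d x y)

    -- The product rule is solved for the distance matrix of index `suc i` by dividing by
    -- `c (suc i)`. Beyond the diameter this matrix is zero, and the scalar 0 serves.
    shell-suc : ∀ i → ShellEigen i → (∃ λ κ → ∀ x y → shell[i-1] i x y ≡ κ * u (d x y)) →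
                ShellEigen (suc i)
    shell-suc i (κ , hκ) (λ' , hλ) with suc i ℕ.≤? D
    ... | no i≥D = 0ℚ , λ x y → trans (∑-zero (λ z → trans
          (cong (λ t → [ t ] * u (d z y)) (<⇒≢ᵇ (ℕP.≤-<-trans (d≤D x z) (ℕP.≰⇒> i≥D))))
          (*-zeroˡ (u (d z y))))) (sym (*-zeroˡ (u (d x y))))
    ... | yes i<D = r * (κ * θ - a i * κ - b[i-1] i * λ') , λ x y → divide x y
      where
      r = proj₁ (reciprocal (0<c i i<D))
      rc : c (suc i) * r ≡ 1ℚ
      rc = proj₂ (reciprocal (0<c i i<D))
      module _ (x y : V) where
        open ≡-Reasoning
        U = u (d x y)
        S = shell (suc i) x y
        total : κ * (θ * U) ≡ c (suc i) * S + a i * (κ * U) + b[i-1] i * (λ' * U)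
        total = begin
          κ * (θ * U) ≡⟨ cong (κ *_) (eigenvector x y) ⟨
          κ * ∑ (λ w → [ x ~ w ] * u (d w y)) ≡⟨ ∑-*ˡ κ _ ⟨
          ∑ (λ w → κ * ([ x ~ w ] * u (d w y)))
            ≡⟨ ∑-cong (λ w → trans (swap κ [ x ~ w ] (u (d w y))) (cong ([ x ~ w ] *_) (sym (hκ w y)))) ⟩
          ∑ (λ w → [ x ~ w ] * shell i w y) ≡⟨ shell-sum i x y ⟩
          c (suc i) * S + a i * shell i x y + b[i-1] i * shell[i-1] i x y
            ≡⟨ cong₂ (λ p q → c (suc i) * S + a i * p + b[i-1] i * q) (hκ x y) (hλ x y) ⟩
          c (suc i) * S + a i * (κ * U) + b[i-1] i * (λ' * U) ∎
          where
          swap : ∀ p q r → p * (q * r) ≡ q * (p * r)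
          swap = solve-∀ ℚ-ring
        divide : S ≡ r * (κ * θ - a i * κ - b[i-1] i * λ') * U
        divide = begin
          S ≡⟨ *-identityˡ S ⟨
          1ℚ * S ≡⟨ cong (_* S) rc ⟨
          c (suc i) * r * S ≡⟨ isolate (c (suc i)) r S (a i * (κ * U)) (b[i-1] i * (λ' * U)) ⟩
          r * ((c (suc i) * S + a i * (κ * U) + b[i-1] i * (λ' * U)) - a i * (κ * U) - b[i-1] i * (λ' * U))
            ≡⟨ cong (λ t → r * (t - a i * (κ * U) - b[i-1] i * (λ' * U))) total ⟨
          r * (κ * (θ * U) - a i * (κ * U) - b[i-1] i * (λ' * U))
            ≡⟨ factor r κ θ U (a i) (b[i-1] i) λ' ⟩
          r * (κ * θ - a i * κ - b[i-1] i * λ') * U ∎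
          where
          isolate : ∀ c r S p q → c * r * S ≡ r * ((c * S + p + q) - p - q)
          isolate = solve-∀ ℚ-ring
          factor : ∀ r κ θ U a b l → r * (κ * (θ * U) - a * (κ * U) - b * (l * U)) ≡ r * (κ * θ - a * κ - b * l) * U
          factor = solve-∀ ℚ-ring

    shell-eigen : ∀ i → ShellEigen i × (∃ λ κ → ∀ x y → shell[i-1] i x y ≡ κ * u (d x y))
    shell-eigen zero =
      (1ℚ , λ x y → trans (∑-cong (λ z → cong (λ t → [ t ] * u (d z y)) (diag x z)))
                          (trans (∑-δ x (λ z → u (d z y))) (sym (*-identityˡ _)))) ,
      (0ℚ , λ x y → sym (*-zeroˡ (u (d x y))))
      where
      diag : ∀ x z → (d x z ≡ᵇ 0) ≡ (x == z)
      diag x z with x FinP.≟ z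
      ... | yes refl = cong (_≡ᵇ 0) (d-refl x)
      ... | no x≢z with d x z in eq
      ...   | zero  = contradiction (d-zero eq) x≢z
      ...   | suc _ = refl
    shell-eigen (suc i) with shell-eigen i
    ... | s , s⁻ = shell-suc i s s⁻ , s

    gram : V → V → ℚ
    gram x y = ∑ (λ z → u (d x z) * u (d z y))

    -- The matrix (u (d x y)) is the combination of the distance matrices with coefficients `u i`,
    -- and each distance matrix multiplies it by a scalar.
    gram-eigen : ∃ λ κ → ∀ x y → gram x y ≡ κ * u (d x y)
    gram-eigen = ∑ (λ (i : Fin (suc D)) → u (toℕ i) * κ (toℕ i)) , λ x y → begin
      ∑ (λ z → u (d x z) * u (d z y))
        ≡⟨ ∑-cong (λ z → trans (cong (_* u (d z y)) (sym (∑-δℕ (ℕ.s≤s (d≤D x z)) u)))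
             (sym (∑-*ʳ (u (d z y)) _))) ⟩
      ∑ (λ z → ∑ (λ (i : Fin (suc D)) → [ d x z ≡ᵇ toℕ i ] * u (toℕ i) * u (d z y)))
        ≡⟨ ∑-comm _ ⟩
      ∑ (λ (i : Fin (suc D)) → ∑ (λ z → [ d x z ≡ᵇ toℕ i ] * u (toℕ i) * u (d z y)))
        ≡⟨ ∑-cong (λ i → trans (∑-cong (λ z → swap [ d x z ≡ᵇ toℕ i ] (u (toℕ i)) (u (d z y))))
             (trans (∑-*ˡ (u (toℕ i)) _) (trans (cong (u (toℕ i) *_) (proj₂ (proj₁ (shell-eigen (toℕ i))) x y))
               (sym (*-assoc (u (toℕ i)) (κ (toℕ i)) (u (d x y))))))) ⟩
      ∑ (λ (i : Fin (suc D)) → u (toℕ i) * κ (toℕ i) * u (d x y))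
        ≡⟨ ∑-*ʳ (u (d x y)) _ ⟩
      ∑ (λ (i : Fin (suc D)) → u (toℕ i) * κ (toℕ i)) * u (d x y) ∎
      where
      open ≡-Reasoning
      κ : ℕ → ℚ
      κ i = proj₁ (proj₁ (shell-eigen i))
      swap : ∀ p q r → p * q * r ≡ q * (p * r)
      swap = solve-∀ ℚ-ring

    -- The matrix (u (d x y)) squares to a positive multiple of itself, so its
    -- quadratic form is a positive multiple of a sum of squares.
    positive-semidefinite : V → ∀ (v : V → ℚ) → 0ℚ ≤ ∑ (λ y → ∑ (λ z → v y * v z * u (d y z)))
    positive-semidefinite x v = 0≤*-cancel 0<κ (subst (0ℚ ≤_) (sym squares) (0≤∑ (λ w → 0≤p² (image w))))
      where
      open ≡-Reasoning
      κ = proj₁ gram-eigen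
      -- On the diagonal, at the given vertex `x`, the product `κ * u 0` is a sum of squares, one of
      -- which is the square of `u 0`.
      0<κ : 0ℚ < κ
      0<κ = 0<*-cancel 0<u₀ (<-≤-trans (0<* 0<u₀ 0<u₀) (subst₂ _≤_ diagonal
              (trans (proj₂ gram-eigen x x) (trans (cong (λ t → κ * u t) (d-refl x)) (*-comm κ (u 0))))
              (∑-term x (λ z → subst (λ t → 0ℚ ≤ u (d x z) * u t) (d-sym x z) (0≤p² (u (d x z)))))))
        where
        diagonal : u (d x x) * u (d x x) ≡ u 0 * u 0
        diagonal = cong (λ t → u t * u t) (d-refl x)
      image : V → ℚ
      image w = ∑ (λ y → v y * u (d y w))
      squares : κ * ∑ (λ y → ∑ (λ z → v y * v z * u (d y z))) ≡ ∑ (λ w → image w * image w)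
      squares = begin
        κ * ∑ (λ y → ∑ (λ z → v y * v z * u (d y z)))
          ≡⟨ trans (sym (∑-*ˡ κ _)) (∑-cong (λ y → sym (∑-*ˡ κ _))) ⟩
        ∑ (λ y → ∑ (λ z → κ * (v y * v z * u (d y z))))
          ≡⟨ ∑-cong (λ y → ∑-cong (λ z → trans (swap κ (v y) (v z) (u (d y z)))
               (trans (cong (v y * v z *_) (sym (proj₂ gram-eigen y z))) (sym (∑-*ˡ (v y * v z) _))))) ⟩
        ∑ (λ y → ∑ (λ z → ∑ (λ w → v y * v z * (u (d y w) * u (d w z)))))
          ≡⟨ trans (∑-cong (λ y → ∑-comm _)) (∑-comm _) ⟩
        ∑ (λ w → ∑ (λ y → ∑ (λ z → v y * v z * (u (d y w) * u (d w z)))))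
          ≡⟨ ∑-cong (λ w → trans (∑-cong (λ y → trans (∑-cong (λ z →
               trans (cong (λ t → v y * v z * (u (d y w) * u t)) (d-sym w z))
                     (regroup (v y) (v z) (u (d y w)) (u (d z w)))))
               (∑-*ˡ (v y * u (d y w)) _))) (∑-*ʳ (image w) _)) ⟩
        ∑ (λ w → image w * image w) ∎
        where
        swap : ∀ k p q r → k * (p * q * r) ≡ p * q * (k * r)
        swap = solve-∀ ℚ-ring
        regroup : ∀ p q r s → p * q * (r * s) ≡ (p * r) * (q * s)
        regroup = solve-∀ ℚ-ring

-- Bilinear forms

module _ {n : ℕ} where

  opaque
    bil : (Fin n → Fin n → ℚ) → (Fin n → ℚ) → (Fin n → ℚ) → ℚ
    bil K f g = ∑ (λ y → ∑ (λ z → f y * g z * K y z))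

    bil-def : ∀ K f g → bil K f g ≡ ∑ (λ y → ∑ (λ z → f y * g z * K y z))
    bil-def K f g = refl

    bil-cong : ∀ {K K′ f f′ g g′} → (∀ y z → f y * g z * K y z ≡ f′ y * g′ z * K′ y z) →
               bil K f g ≡ bil K′ f′ g′
    bil-cong h = ∑-cong (λ y → ∑-cong (h y))

    bil-sym : ∀ {K} → (∀ y z → K y z ≡ K z y) → ∀ f g → bil K f g ≡ bil K g f
    bil-sym {K} K-sym f g = trans (∑-comm _) (∑-cong λ z → ∑-cong λ y →
      cong₂ _*_ (*-comm (f y) (g z)) (K-sym y z))

    bil-+ᵏ : ∀ {K L : Fin n → Fin n → ℚ} p q f g →
             bil (λ y z → p * K y z + q * L y z) f g ≡ p * bil K f g + q * bil L f g
    bil-+ᵏ {K} {L} p q f g = begin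
      ∑ (λ y → ∑ (λ z → f y * g z * (p * K y z + q * L y z)))
        ≡⟨ ∑-cong (λ y → trans (∑-cong (λ z → spread (f y) (g z) p (K y z) q (L y z)))
             (trans (∑-+ _ _) (cong₂ _+_ (∑-*ˡ p _) (∑-*ˡ q _)))) ⟩
      ∑ (λ y → p * ∑ (λ z → f y * g z * K y z) + q * ∑ (λ z → f y * g z * L y z))
        ≡⟨ trans (∑-+ _ _) (cong₂ _+_ (∑-*ˡ p _) (∑-*ˡ q _)) ⟩
      p * bil K f g + q * bil L f g ∎
      where
      open ≡-Reasoning
      spread : ∀ a b p k q l → a * b * (p * k + q * l) ≡ p * (a * b * k) + q * (a * b * l)
      spread = solve-∀ ℚ-ring

    bil-1 : ∀ f g → bil (λ _ _ → 1ℚ) f g ≡ ∑ f * ∑ g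
    bil-1 f g = trans (∑-cong (λ y → trans (∑-cong (λ z → *-identityʳ (f y * g z))) (∑-*ˡ (f y) g)))
                      (∑-*ʳ (∑ g) f)

    bil-δˡ : ∀ {K} x g → bil K (λ y → [ x == y ]) g ≡ ∑ (λ z → g z * K x z)
    bil-δˡ {K} x g = trans (∑-cong (λ y → trans (∑-cong (λ z → *-assoc [ x == y ] (g z) (K y z)))
                                                (∑-*ˡ [ x == y ] _)))
                           (∑-δ x (λ y → ∑ (λ z → g z * K y z)))

    bil-diagonal : ∀ f g → bil (λ y z → [ y == z ]) f g ≡ ∑ (λ y → f y * g y)
    bil-diagonal f g = ∑-cong (λ y → trans (∑-cong (λ z → *-comm (f y * g z) [ y == z ]))
                                           (∑-δ y (λ z → f y * g z)))

    bil-expand : ∀ {K} → (∀ y z → K y z ≡ K z y) → ∀ p q f g →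
      bil K (λ y → p * f y + q * g y) (λ y → p * f y + q * g y) ≡
      p * p * bil K f f + 2ℚ * (p * q) * bil K f g + q * q * bil K g g
    bil-expand {K} K-sym p q f g = begin
      ∑ (λ y → ∑ (λ z → (p * f y + q * g y) * (p * f z + q * g z) * K y z))
        ≡⟨ ∑-cong (λ y → trans (∑-cong (λ z → spread p q (f y) (g y) (f z) (g z) (K y z)))
             (trans (∑-+ _ _) (cong₂ _+_ (trans (∑-+ _ _) (cong₂ _+_ (∑-*ˡ (p * p) _) (∑-*ˡ (p * q) _)))
               (trans (∑-+ _ _) (cong₂ _+_ (∑-*ˡ (p * q) _) (∑-*ˡ (q * q) _)))))) ⟩
      ∑ (λ y → (p * p * ∑ (λ z → f y * f z * K y z) + p * q * ∑ (λ z → f y * g z * K y z))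
             + (p * q * ∑ (λ z → g y * f z * K y z) + q * q * ∑ (λ z → g y * g z * K y z)))
        ≡⟨ trans (∑-+ _ _) (cong₂ _+_ (trans (∑-+ _ _) (cong₂ _+_ (∑-*ˡ (p * p) _) (∑-*ˡ (p * q) _)))
               (trans (∑-+ _ _) (cong₂ _+_ (∑-*ˡ (p * q) _) (∑-*ˡ (q * q) _)))) ⟩
      (p * p * bil K f f + p * q * bil K f g) + (p * q * bil K g f + q * q * bil K g g)
        ≡⟨ cong (λ t → (p * p * bil K f f + p * q * bil K f g) + (p * q * t + q * q * bil K g g))
             (bil-sym K-sym g f) ⟩
      (p * p * bil K f f + p * q * bil K f g) + (p * q * bil K f g + q * q * bil K g g)
        ≡⟨ gather (p * p * bil K f f) (p * q) (bil K f g) (q * q * bil K g g) ⟩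
      p * p * bil K f f + 2ℚ * (p * q) * bil K f g + q * q * bil K g g ∎
      where
      open ≡-Reasoning
      spread : ∀ p q a b a' b' k → (p * a + q * b) * (p * a' + q * b') * k ≡
        (p * p * (a * a' * k) + p * q * (a * b' * k)) + (p * q * (b * a' * k) + q * q * (b * b' * k))
      spread = solve-∀ ℚ-ring
      gather : ∀ x r y z → (x + r * y) + (r * y + z) ≡ x + (1ℚ + 1ℚ) * r * y + z
      gather = solve-∀ ℚ-ring

  Supported : (Fin n → Bool) → (Fin n → ℚ) → Set
  Supported P f = ∀ y → f y ≡ 0ℚ ⊎ P y ≡ true

  supported-cong : ∀ {K L P f} → Supported P f →
    (∀ y z → P y ≡ true → P z ≡ true → K y z ≡ L y z) → bil K f f ≡ bil L f f
  supported-cong {K} {L} {f = f} supp h = bil-cong {K} {L} {f} {f} {f} {f} pointwise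
    where
    zeroˡ : ∀ p r s → 0ℚ * p * r ≡ 0ℚ * p * s
    zeroˡ = solve-∀ ℚ-ring
    zeroʳ : ∀ p r s → p * 0ℚ * r ≡ p * 0ℚ * s
    zeroʳ = solve-∀ ℚ-ring
    pointwise : ∀ y z → f y * f z * K y z ≡ f y * f z * L y z
    pointwise y z with supp y | supp z
    ... | inj₁ fy | _       rewrite fy = zeroˡ (f z) (K y z) (L y z)
    ... | inj₂ _  | inj₁ fz rewrite fz = zeroʳ (f y) (K y z) (L y z)
    ... | inj₂ Py | inj₂ Pz = cong (f y * f z *_) (h y z Py Pz)

bil-two-valued : ∀ {n} p r (f : Fin n → ℚ) → bil (λ y z → p * 1ℚ + (r - p) * [ y == z ]) f f ≡
                 p * (∑ f * ∑ f) + (r - p) * ∑ (λ y → f y * f y)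
bil-two-valued p r f = trans (bil-+ᵏ p (r - p) f f)
  (cong₂ (λ i j → p * i + (r - p) * j) (bil-1 f f) (bil-diagonal f f))

module _ {n : ℕ} {K : Fin n → Fin n → ℚ} {p r : ℚ} where

  two-valued : ∀ y z → (y ≡ z → K y z ≡ r) → (y ≢ z → K y z ≡ p) → K y z ≡ p * 1ℚ + (r - p) * [ y == z ]
  two-valued y z diagonal off with y FinP.≟ z
  ... | yes y≡z = trans (diagonal y≡z) (same p r)
    where
    same : ∀ p r → r ≡ p * 1ℚ + (r - p) * 1ℚ
    same = solve-∀ ℚ-ring
  ... | no y≢z = trans (off y≢z) (different p r)
    where
    different : ∀ p r → p ≡ p * 1ℚ + (r - p) * 0ℚ
    different = solve-∀ ℚ-ring

  two-valued-≤ : ∀ y z → (y ≡ z → K y z ≤ r) → (y ≢ z → K y z ≤ p) → K y z ≤ p * 1ℚ + (r - p) * [ y == z ]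
  two-valued-≤ y z diagonal off with y FinP.≟ z
  ... | yes y≡z = ≤-trans (diagonal y≡z) (≤-reflexive (same p r))
    where
    same : ∀ p r → r ≡ p * 1ℚ + (r - p) * 1ℚ
    same = solve-∀ ℚ-ring
  ... | no y≢z = ≤-trans (off y≢z) (≤-reflexive (different p r))
    where
    different : ∀ p r → p ≡ p * 1ℚ + (r - p) * 0ℚ
    different = solve-∀ ℚ-ring

  bil-clique : ∀ {P : Fin n → Bool} {f} → Supported P f → (∀ y z → P y ≡ true → P z ≡ true → y ≡ z → K y z ≡ r) →
    (∀ y z → P y ≡ true → P z ≡ true → y ≢ z → K y z ≡ p) →
    bil K f f ≡ p * (∑ f * ∑ f) + (r - p) * ∑ (λ y → f y * f y)
  bil-clique {P} {f} supp diagonal off = trans (supported-cong supp (λ y z Py Pz →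
    two-valued y z (diagonal y z Py Pz) (off y z Py Pz))) (bil-two-valued p r f)

indicator-supported : ∀ {n} (P : Fin n → Bool) → Supported P (λ y → [ P y ])
indicator-supported P y with P y
... | true  = inj₂ refl
... | false = inj₁ refl

-- The local graph at a vertex

module LocalForm {D c b} (Γ : DistanceRegular D c b) (m : ℚ) where
  open DistanceRegular Γ
  open Spectral Γ

  e : V → V → ℚ
  e y z = m * [ y == z ] + [ y ~ z ]

  e-sym : ∀ y z → e y z ≡ e z y
  e-sym y z = cong₂ (λ i j → m * i + [ j ]) (==-sym y z) (~-sym y z)
    where
    ==-sym : ∀ y z → [ y == z ] ≡ [ z == y ]
    ==-sym y z with y FinP.≟ z
    ... | yes refl = cong [_] (sym (==-refl y))
    ... | no y≢z   = cong [_] (sym (≢⇒== (y≢z ∘ sym)))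

  e-value : ∀ {y z i j} → (y == z) ≡ i → (y ~ z) ≡ j → e y z ≡ m * [ i ] + [ j ]
  e-value = cong₂ (λ i j → m * [ i ] + [ j ])

  ~-irrefl : ∀ y → (y ~ y) ≡ false
  ~-irrefl y = cong (_≡ᵇ 1) (d-refl y)

  -- Interlacing: u is the cosine sequence of the second largest eigenvalue, and
  -- the form of (u (d y z)) is evaluated on a vector on Γ(x) together with the
  -- multiple of x that makes it orthogonal to x for this form.
  module Interlacing (u : ℕ → ℚ) (0<u₀ : 0ℚ < u 0) (0<u₁-u₂ : 0ℚ < u 1 - u 2)
    (log-convex : 0ℚ ≤ u 1 * u 1 - u 0 * u 2) (u₀-u₂ : u 0 ≡ u 2 + (u 1 - u 2) * m)
    (psd : ∀ (v : V → ℚ) → 0ℚ ≤ ∑ (λ y → ∑ (λ z → v y * v z * u (d y z)))) where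

    U : V → V → ℚ
    U y z = u (d y z)

    U-sym : ∀ y z → U y z ≡ U z y
    U-sym y z = cong u (d-sym y z)

    -- Two neighbours of `x` are at distance 0, 1 or 2, so on Γ(x) the matrix is an affine function
    -- of the adjacency matrix and the identity. The hypothesis `u₀-u₂` fixes `m` so that distance 0
    -- fits as well.
    value : ∀ x y z → (x ~ y) ≡ true → (x ~ z) ≡ true → U y z ≡ u 2 * 1ℚ + (u 1 - u 2) * e y z
    value x y z xy xz = by (d-step y x z (≡ᵇ-true (d x z) 1 xz))
      where
      by : d y z ≡ d y x ⊎ d y z ≡ suc (d y x) ⊎ suc (d y z) ≡ d y x → U y z ≡ u 2 * 1ℚ + (u 1 - u 2) * e y z
      by (inj₁ h) = trans (cong u yz) (trans (one (u 1) (u 2) m)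
              (cong (λ t → u 2 * 1ℚ + (u 1 - u 2) * t) (sym (e-value (≢⇒== y≢z) (cong (_≡ᵇ 1) yz)))))
        where
        yz : d y z ≡ 1
        yz = trans h (trans (d-sym y x) (≡ᵇ-true (d x y) 1 xy))
        y≢z : y ≢ z
        y≢z refl = contradiction (trans (sym (d-refl y)) yz) λ ()
        one : ∀ p r m → p ≡ r * 1ℚ + (p - r) * (m * 0ℚ + 1ℚ)
        one = solve-∀ ℚ-ring
      by (inj₂ (inj₁ h)) = trans (cong u yz) (trans (two (u 1) (u 2) m)
              (cong (λ t → u 2 * 1ℚ + (u 1 - u 2) * t) (sym (e-value (≢⇒== y≢z) (cong (_≡ᵇ 1) yz)))))
        where
        yz : d y z ≡ 2
        yz = trans h (cong suc (trans (d-sym y x) (≡ᵇ-true (d x y) 1 xy)))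
        y≢z : y ≢ z
        y≢z refl = contradiction (trans (sym (d-refl y)) yz) λ ()
        two : ∀ p r m → r ≡ r * 1ℚ + (p - r) * (m * 0ℚ + 0ℚ)
        two = solve-∀ ℚ-ring
      by (inj₂ (inj₂ h)) = trans (cong u yz) (trans u₀-u₂ (trans (zero′ (u 1) (u 2) m)
              (cong (λ t → u 2 * 1ℚ + (u 1 - u 2) * t)
                (sym (e-value (subst (λ i → (y == i) ≡ true) y≡z (==-refl y)) (cong (_≡ᵇ 1) yz))))))
        where
        yz : d y z ≡ 0
        yz = ℕP.suc-injective (trans h (trans (d-sym y x) (≡ᵇ-true (d x y) 1 xy)))
        y≡z : y ≡ z
        y≡z = d-zero yz
        zero′ : ∀ p r m → r + (p - r) * m ≡ r * 1ℚ + (p - r) * (m * 1ℚ + 0ℚ)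
        zero′ = solve-∀ ℚ-ring

    -- At the vector `t` the form of `U` equals u₀²(u₁ - u₂)F - u₀(u₁² - u₀u₂)W². By log-convexity
    -- the second term only lowers it, so F inherits the sign.
    local-psd : ∀ x v → Supported (x ~_) v → 0ℚ ≤ bil e v v
    local-psd x v supp = 0≤*-cancel (0<* (0<* 0<u₀ 0<u₀) 0<u₁-u₂)
      (subst (0ℚ ≤_) rearrange (0≤+ (subst (0ℚ ≤_) (sym (bil-def U t t)) (psd t))
                                    (0≤* (0≤* (<⇒≤ 0<u₀) log-convex) (0≤p² W))))
      where
      W = ∑ v
      F = bil e v v
      t : V → ℚ
      t z = - (u 1 * W) * [ x == z ] + u 0 * v z
      δδ : bil U (λ z → [ x == z ]) (λ z → [ x == z ]) ≡ u 0
      δδ = trans (bil-δˡ x _) (trans (∑-δ x (U x)) (cong u (d-refl x)))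
      δv : bil U (λ z → [ x == z ]) v ≡ u 1 * W
      δv = trans (bil-δˡ x v) (trans (∑-cong pointwise) (∑-*ˡ (u 1) v))
        where
        pointwise : ∀ z → v z * U x z ≡ u 1 * v z
        pointwise z = by (supp z)
          where
          by : v z ≡ 0ℚ ⊎ (x ~ z) ≡ true → v z * U x z ≡ u 1 * v z
          by (inj₁ vz) = trans (cong (_* U x z) vz)
            (trans (*-zeroˡ (U x z)) (sym (trans (cong (u 1 *_) vz) (*-zeroʳ (u 1)))))
          by (inj₂ xz) = trans (cong (λ i → v z * u i) (≡ᵇ-true (d x z) 1 xz)) (*-comm (v z) (u 1))
      vv : bil U v v ≡ u 2 * (W * W) + (u 1 - u 2) * F
      vv = trans (supported-cong supp (value x))
        (trans (bil-+ᵏ (u 2) (u 1 - u 2) v v) (cong (λ i → u 2 * i + (u 1 - u 2) * F) (bil-1 v v)))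
      rearrange : bil U t t + u 0 * (u 1 * u 1 - u 0 * u 2) * (W * W) ≡ u 0 * u 0 * (u 1 - u 2) * F
      rearrange = trans (cong (_+ u 0 * (u 1 * u 1 - u 0 * u 2) * (W * W))
        (trans (bil-expand U-sym (- (u 1 * W)) (u 0) (λ z → [ x == z ]) v)
          (cong₂ _+_ (cong₂ (λ i j → - (u 1 * W) * - (u 1 * W) * i + 2ℚ * (- (u 1 * W) * u 0) * j) δδ δv)
            (cong (u 0 * u 0 *_) vv)))) (cancel (u 0) (u 1) (u 2) W F)
        where
        cancel : ∀ u₀ u₁ u₂ W F →
          - (u₁ * W) * - (u₁ * W) * u₀ + (1ℚ + 1ℚ) * (- (u₁ * W) * u₀) * (u₁ * W)
            + u₀ * u₀ * (u₂ * (W * W) + (u₁ - u₂) * F) + u₀ * (u₁ * u₁ - u₀ * u₂) * (W * W) ≡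
          u₀ * u₀ * (u₁ - u₂) * F
        cancel = solve-∀ ℚ-ring

-- Classical parameters

gauss-suc : ∀ b i → gauss b (suc i) ≡ suc (b ℕ.* gauss b i)
gauss-suc b zero    = cong suc (sym (ℕP.*-zeroʳ b))
gauss-suc b (suc i) = trans (cong (ℕ._+ b ℕ.* b ℕ.^ i) (gauss-suc b i))
  (cong suc (sym (ℕP.*-distribˡ-+ b (gauss b i) (b ℕ.^ i))))

gauss-mono : ∀ b {i j} → i ℕ.≤ j → gauss b i ℕ.≤ gauss b j
gauss-mono b {i} {j} i≤j with ℕP.m≤n⇒m<n∨m≡n i≤j
... | inj₂ refl = ℕP.≤-refl
gauss-mono b {i} {suc j} _ | inj₁ (ℕ.s≤s i≤j) = ℕP.≤-trans (gauss-mono b i≤j) (ℕP.m≤m+n (gauss b j) _)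

-- The field `0≤α` is available because the lower bound on α that is to be refuted implies it; `0<b`
-- will come from two vertices at distance `D`.
record Classical (D b : ℕ) (α β : ℚ) (c bb : ℕ → ℚ) : Set where
  g : ℕ → ℚ
  g i = ℕ→ℚ (gauss b i)
  field
    2≤b  : 2 ℕ.≤ b
    2≤D  : 2 ℕ.≤ D
    0≤α  : 0ℚ ≤ α
    0<b  : 0ℚ < bb (ℕ.pred D)
    c-eq : ∀ i → i ℕ.≤ D → c i ≡ g i * (1ℚ + α * g (ℕ.pred i))
    b-eq : ∀ i → i ℕ.≤ D → bb i ≡ (g D - g i) * (β - α * g i)

module ClassicalProperties {D b α β c bb} (cl : Classical D b α β c bb) where
  open Classical cl public

  q : ℚ
  q = ℕ→ℚ b

  g-suc : ∀ i → g (suc i) ≡ 1ℚ + q * g i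
  g-suc i = trans (cong ℕ→ℚ (gauss-suc b i)) (trans (ι-suc (b ℕ.* gauss b i)) (cong (λ t → 1ℚ + t) (ι-* b (gauss b i))))

  2≤q : 2ℚ ≤ q
  2≤q = ι-mono 2≤b

  0<q-1 : 0ℚ < q - 1ℚ
  0<q-1 = <-≤-trans 0<1 (≤-by (shift q) (0≤q-p 2≤q))
    where
    shift : ∀ q → q - 1ℚ - 1ℚ ≡ q - (1ℚ + 1ℚ)
    shift = solve-∀ ℚ-ring

  0<q : 0ℚ < q
  0<q = <-trans 0<q-1 (<-by (shift q) 0<1)
    where
    shift : ∀ q → q - (q - 1ℚ) ≡ 1ℚ
    shift = solve-∀ ℚ-ring

  0≤g : ∀ i → 0ℚ ≤ g i
  0≤g i = 0≤ι (gauss b i)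

  g-mono : ∀ {i j} → i ℕ.≤ j → g i ≤ g j
  g-mono i≤j = ι-mono (gauss-mono b i≤j)

  0<g : ∀ i → 0ℚ < g (suc i)
  0<g i = subst (0ℚ <_) (sym (g-suc i)) (0<+ 0<1 (0≤* (<⇒≤ 0<q) (0≤g i)))

  c₀ : c 0 ≡ 0ℚ
  c₀ = trans (c-eq 0 ℕ.z≤n) (*-zeroˡ (1ℚ + α * 0ℚ))

  0<c : ∀ i → suc i ℕ.≤ D → 0ℚ < c (suc i)
  0<c i h = subst (0ℚ <_) (sym (c-eq (suc i) h)) (0<* (0<g i) (0<+ 0<1 (0≤* 0≤α (0≤g i))))

  s B m : ℚ
  s = g (ℕ.pred D)
  B = q * s
  m = q + 1ℚ

  D≡ : suc (ℕ.pred D) ≡ D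
  D≡ = ℕP.suc-pred D {{ℕ.>-nonZero (ℕP.≤-trans (ℕ.s≤s ℕ.z≤n) 2≤D)}}

  gD : g D ≡ 1ℚ + B
  gD = trans (cong g (sym D≡)) (g-suc (ℕ.pred D))

  0≤B : 0ℚ ≤ B
  0≤B = 0≤* (<⇒≤ 0<q) (0≤g (ℕ.pred D))

  -- The positive number b_(D-1) is the product of `g D - s` and `β - α * s`, and the first factor
  -- is 1 + (q - 1)s.
  αs<β : α * s < β
  αs<β = 0<q-p⇒p<q (0<*-cancel {p = g D - s} 0<gap (subst (0ℚ <_) (b-eq (ℕ.pred D) (ℕP.pred[n]≤n {D})) 0<b))
    where
    gap : ∀ q s → 1ℚ + q * s - s ≡ 1ℚ + (q - 1ℚ) * s
    gap = solve-∀ ℚ-ring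
    0<gap : 0ℚ < g D - s
    0<gap = subst (0ℚ <_) (sym (trans (cong (_- s) gD) (gap q s))) (0<+ 0<1 (0≤* (<⇒≤ 0<q-1) (0≤g (ℕ.pred D))))

  0<β-αg : ∀ i → i ℕ.< D → 0ℚ < β - α * g i
  0<β-αg i i<D = 0<q-p (≤-<-trans (*-monoˡ-≤-nonNeg α {{nonNegative 0≤α}}
    (g-mono (ℕP.≤-pred (subst (suc i ℕ.≤_) (sym D≡) i<D)))) αs<β)

  0<β : 0ℚ < β
  0<β = ≤-<-trans (0≤* 0≤α (0≤g (ℕ.pred D))) αs<β

  k-eq : bb 0 ≡ (1ℚ + B) * β
  k-eq = trans (b-eq 0 ℕ.z≤n) (trans (simplify (g D) α β) (cong (_* β) gD))
    where
    simplify : ∀ g α β → (g - 0ℚ) * (β - α * 0ℚ) ≡ g * β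
    simplify = solve-∀ ℚ-ring

  b₁-eq : bb 1 ≡ B * (β - α)
  b₁-eq = trans (b-eq 1 (ℕP.≤-trans (ℕ.s≤s ℕ.z≤n) 2≤D))
    (trans (cong (λ t → (t - 1ℚ) * (β - α * 1ℚ)) gD) (simplify B α β))
    where
    simplify : ∀ B α β → (1ℚ + B - 1ℚ) * (β - α * 1ℚ) ≡ B * (β - α)
    simplify = solve-∀ ℚ-ring

  c₁-eq : c 1 ≡ 1ℚ
  c₁-eq = trans (c-eq 1 (ℕP.≤-trans (ℕ.s≤s ℕ.z≤n) 2≤D)) (simplify α)
    where
    simplify : ∀ α → 1ℚ * (1ℚ + α * 0ℚ) ≡ 1ℚ
    simplify = solve-∀ ℚ-ring

  c₂-eq : c 2 ≡ m * (1ℚ + α)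
  c₂-eq = trans (c-eq 2 2≤D) (trans (cong (_* (1ℚ + α * 1ℚ)) (g-suc 1)) (simplify q α))
    where
    simplify : ∀ q α → (1ℚ + q * 1ℚ) * (1ℚ + α * 1ℚ) ≡ (q + 1ℚ) * (1ℚ + α)
    simplify = solve-∀ ℚ-ring

  0<k : 0ℚ < bb 0
  0<k = subst (0ℚ <_) (sym k-eq) (0<* (0<+ 0<1 0≤B) 0<β)

-- The second largest eigenvalue

module Local {D b α β c bb} (Γ : DistanceRegular D c bb) (cl : Classical D b α β c bb) where
  open DistanceRegular Γ
  open Spectral Γ
  open ClassicalProperties cl

  ρ : ℚ
  ρ = proj₁ (reciprocal 0<q)

  qρ≡1 : q * ρ ≡ 1ℚ
  qρ≡1 = proj₂ (reciprocal 0<q)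

  0<ρ : 0ℚ < ρ
  0<ρ = 0<*-cancel 0<q (subst (0ℚ <_) (sym qρ≡1) 0<1)

  0<1-ρ : 0ℚ < 1ℚ - ρ
  0<1-ρ = 0<*-cancel 0<q (subst (0ℚ <_) (sym (trans (*-distribˡ-+ q 1ℚ (- ρ))
    (cong₂ _+_ (*-identityʳ q) (trans (sym (neg-distribʳ-* q ρ)) (cong -_ qρ≡1))))) 0<q-1)

  ρ^ : ℕ → ℚ
  ρ^ zero    = 1ℚ
  ρ^ (suc i) = ρ * ρ^ i

  -- 1 + (q - 1) [i] = q^i
  ρ^-inverse : ∀ i → (1ℚ + (q - 1ℚ) * g i) * ρ^ i ≡ 1ℚ
  ρ^-inverse zero = simplify q
    where
    simplify : ∀ q → (1ℚ + (q - 1ℚ) * 0ℚ) * 1ℚ ≡ 1ℚ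
    simplify = solve-∀ ℚ-ring
  ρ^-inverse (suc i) = begin
    (1ℚ + (q - 1ℚ) * g (suc i)) * (ρ * ρ^ i)      ≡⟨ cong (λ t → (1ℚ + (q - 1ℚ) * t) * (ρ * ρ^ i)) (g-suc i) ⟩
    (1ℚ + (q - 1ℚ) * (1ℚ + q * g i)) * (ρ * ρ^ i) ≡⟨ regroup q (g i) ρ (ρ^ i) ⟩
    (q * ρ) * ((1ℚ + (q - 1ℚ) * g i) * ρ^ i)      ≡⟨ cong₂ _*_ qρ≡1 (ρ^-inverse i) ⟩
    1ℚ ∎
    where
    open ≡-Reasoning
    regroup : ∀ q g ρ r → (1ℚ + (q - 1ℚ) * (1ℚ + q * g)) * (ρ * r) ≡ (q * ρ) * ((1ℚ + (q - 1ℚ) * g) * r)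
    regroup = solve-∀ ℚ-ring

  -- The cosines of the second largest eigenvalue b₁/q - 1, up to a scalar.
  ξ ζ θ : ℚ
  ξ = - (bb 0 - bb 1 + q)
  ζ = q * bb 0 - bb 1 + q
  θ = ρ * bb 1 - 1ℚ

  u : ℕ → ℚ
  u i = ξ + ζ * ρ^ i

  k-b₁ : bb 0 - bb 1 ≡ β + α * B
  k-b₁ = trans (cong₂ _-_ k-eq b₁-eq) (simplify B α β)
    where
    simplify : ∀ B α β → (1ℚ + B) * β - B * (β - α) ≡ β + α * B
    simplify = solve-∀ ℚ-ring

  0<A : 0ℚ < β + α * B
  0<A = 0<+ 0<β (0≤* 0≤α 0≤B)

  -- Both q c_i and b_i are quadratic polynomials in [i] with leading coefficient α, so their
  -- difference is linear in [i].
  key : ∀ i → i ℕ.≤ D → q * c i - bb i + ξ * g i + bb 0 ≡ 0ℚ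
  key zero _ = trans (cong₂ (λ p r → q * p - bb 0 + ξ * r + bb 0) c₀ refl) (simplify q (bb 0) ξ)
    where
    simplify : ∀ q k ξ → q * 0ℚ - k + ξ * 0ℚ + k ≡ 0ℚ
    simplify = solve-∀ ℚ-ring
  key (suc i) i<D = begin
    q * c (suc i) - bb (suc i) + ξ * g (suc i) + bb 0
      ≡⟨ cong₂ (λ p r → q * p - r + ξ * g (suc i) + bb 0) (c-eq (suc i) i<D) (b-eq (suc i) i<D) ⟩
    q * (g (suc i) * (1ℚ + α * g i)) - (g D - g (suc i)) * (β - α * g (suc i)) + ξ * g (suc i) + bb 0
      ≡⟨ cong₂ (λ p r → q * (g (suc i) * (1ℚ + α * g i)) - (g D - g (suc i)) * (β - α * g (suc i))
           + - (p + q) * g (suc i) + r) k-b₁ k-eq ⟩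
    q * (g (suc i) * (1ℚ + α * g i)) - (g D - g (suc i)) * (β - α * g (suc i))
           + - (β + α * B + q) * g (suc i) + (1ℚ + B) * β
      ≡⟨ cong₂ (λ p r → q * (p * (1ℚ + α * g i)) - (r - p) * (β - α * p)
           + - (β + α * B + q) * p + (1ℚ + B) * β) (g-suc i) gD ⟩
    q * ((1ℚ + q * g i) * (1ℚ + α * g i)) - (1ℚ + B - (1ℚ + q * g i)) * (β - α * (1ℚ + q * g i))
           + - (β + α * B + q) * (1ℚ + q * g i) + (1ℚ + B) * β
      ≡⟨ vanish q α β B (g i) ⟩
    0ℚ ∎
    where
    open ≡-Reasoning
    vanish : ∀ q α β B g →
      q * ((1ℚ + q * g) * (1ℚ + α * g)) - (1ℚ + B - (1ℚ + q * g)) * (β - α * (1ℚ + q * g))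
        + - (β + α * B + q) * (1ℚ + q * g) + (1ℚ + B) * β ≡ 0ℚ
    vanish = solve-∀ ℚ-ring

  c-pred : ∀ i → c i * u (ℕ.pred i) ≡ c i * (ξ + ζ * (q * ρ^ i))
  c-pred zero    = trans (cong (_* u 0) c₀) (trans (*-zeroˡ (u 0))
    (sym (trans (cong (_* (ξ + ζ * (q * 1ℚ))) c₀) (*-zeroˡ (ξ + ζ * (q * 1ℚ))))))
  c-pred (suc i) = cong (λ t → c (suc i) * (ξ + ζ * t))
    (sym (trans (sym (*-assoc q ρ (ρ^ i))) (trans (cong (_* ρ^ i) qρ≡1) (*-identityˡ (ρ^ i)))))

  -- The defect of the eigenvalue equation is a combination of three vanishing quantities: the left
  -- side of `key`, qρ - 1, and (1 + (q - 1)[i])ρ^i - 1. The coefficient of the second is `r`.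
  eigen : ∀ i → i ℕ.≤ D → recur u i ≡ θ * u i
  eigen i i≤D = begin
    c i * u (ℕ.pred i) + a i * u i + bb i * u (suc i)
      ≡⟨ cong (λ t → t + a i * u i + bb i * u (suc i)) (c-pred i) ⟩
    c i * (ξ + ζ * (q * y)) + (k - c i - bb i) * (ξ + ζ * y) + bb i * (ξ + ζ * (ρ * y))
      ≡⟨ reduce (c i) (bb i) k (bb 1) q ρ y (g i) ⟩
    θ * u i + ρ * ζ * (q - 1ℚ) * y * (q * c i - bb i + ξ * g i + k)
      + (q * ρ - 1ℚ) * r - ρ * ζ * ξ * ((1ℚ + (q - 1ℚ) * g i) * y - 1ℚ)
      ≡⟨ cong₂ (λ p v → θ * u i + p + v - ρ * ζ * ξ * ((1ℚ + (q - 1ℚ) * g i) * y - 1ℚ))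
           (trans (cong (ρ * ζ * (q - 1ℚ) * y *_) (key i i≤D)) (*-zeroʳ (ρ * ζ * (q - 1ℚ) * y)))
           (trans (cong (λ t → (t - 1ℚ) * r) qρ≡1) (*-zeroˡ r)) ⟩
    θ * u i + 0ℚ + 0ℚ - ρ * ζ * ξ * ((1ℚ + (q - 1ℚ) * g i) * y - 1ℚ)
      ≡⟨ cong (λ t → θ * u i + 0ℚ + 0ℚ - ρ * ζ * ξ * (t - 1ℚ)) (ρ^-inverse i) ⟩
    θ * u i + 0ℚ + 0ℚ - ρ * ζ * ξ * 0ℚ
      ≡⟨ tidy (θ * u i) (ρ * ζ * ξ) ⟩
    θ * u i ∎
    where
    open ≡-Reasoning
    k = bb 0
    y = ρ^ i
    r = - (c i * ζ * (q - 1ℚ) * y) + bb i * ζ * y - (k + 1ℚ) * (ξ + ζ * y)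
    tidy : ∀ p t → p + 0ℚ + 0ℚ - t * 0ℚ ≡ p
    tidy = solve-∀ ℚ-ring
    reduce : ∀ c b k b₁ q ρ y g →
      c * (- (k - b₁ + q) + (q * k - b₁ + q) * (q * y)) + (k - c - b) * (- (k - b₁ + q) + (q * k - b₁ + q) * y)
        + b * (- (k - b₁ + q) + (q * k - b₁ + q) * (ρ * y)) ≡
      (ρ * b₁ - 1ℚ) * (- (k - b₁ + q) + (q * k - b₁ + q) * y)
        + ρ * (q * k - b₁ + q) * (q - 1ℚ) * y * (q * c - b + - (k - b₁ + q) * g + k)
        + (q * ρ - 1ℚ) * (- (c * (q * k - b₁ + q) * (q - 1ℚ) * y) + b * (q * k - b₁ + q) * y
            - (k + 1ℚ) * (- (k - b₁ + q) + (q * k - b₁ + q) * y))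
        - ρ * (q * k - b₁ + q) * - (k - b₁ + q) * ((1ℚ + (q - 1ℚ) * g) * y - 1ℚ)
    reduce = solve-∀ ℚ-ring

  u₀-eq : u 0 ≡ (q - 1ℚ) * bb 0
  u₀-eq = simplify q (bb 0) (bb 1)
    where
    simplify : ∀ q k l → - (k - l + q) + (q * k - l + q) * 1ℚ ≡ (q - 1ℚ) * k
    simplify = solve-∀ ℚ-ring

  0<u₀ : 0ℚ < u 0
  0<u₀ = subst (0ℚ <_) (sym u₀-eq) (0<* 0<q-1 0<k)

  0<-ξ : 0ℚ < - ξ
  0<-ξ = subst (0ℚ <_) (trans (cong (_+ q) (sym k-b₁)) (sym (neg-involutive (bb 0 - bb 1 + q))))
    (0<+ 0<A (<⇒≤ 0<q))
    where
    neg-involutive : ∀ p → - - p ≡ p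
    neg-involutive = solve-∀ ℚ-ring

  0<ζ : 0ℚ < ζ
  0<ζ = subst (0ℚ <_) (split q (bb 0) (bb 1)) (0<+ (0<+ 0<-ξ ≤-refl) (0≤* (<⇒≤ 0<q-1) (<⇒≤ 0<k)))
    where
    split : ∀ q k l → - - (k - l + q) + 0ℚ + (q - 1ℚ) * k ≡ q * k - l + q
    split = solve-∀ ℚ-ring

  0<u₁-u₂ : 0ℚ < u 1 - u 2
  0<u₁-u₂ = subst (0ℚ <_) (sym (gap ξ ζ ρ)) (0<* (0<* 0<ζ 0<ρ) 0<1-ρ)
    where
    gap : ∀ ξ ζ ρ → (ξ + ζ * (ρ * 1ℚ)) - (ξ + ζ * (ρ * (ρ * 1ℚ))) ≡ ζ * ρ * (1ℚ - ρ)
    gap = solve-∀ ℚ-ring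

  log-convex : 0ℚ ≤ u 1 * u 1 - u 0 * u 2
  log-convex = subst (0ℚ ≤_) (discriminant ξ ζ ρ)
    (0≤* (0≤* (<⇒≤ 0<-ξ) (<⇒≤ 0<ζ)) (0≤p² (1ℚ - ρ)))
    where
    discriminant : ∀ ξ ζ ρ → - ξ * ζ * ((1ℚ - ρ) * (1ℚ - ρ)) ≡
      (ξ + ζ * (ρ * 1ℚ)) * (ξ + ζ * (ρ * 1ℚ)) - (ξ + ζ * 1ℚ) * (ξ + ζ * (ρ * (ρ * 1ℚ)))
    discriminant = solve-∀ ℚ-ring

  -- This is where m = q + 1 comes from: (1 - ρ²)/(ρ - ρ²) = 1/ρ + 1.
  u₀-u₂ : u 0 ≡ u 2 + (u 1 - u 2) * m
  u₀-u₂ = trans (factor q ρ ξ ζ)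
    (trans (cong (λ i → u 2 + (u 1 - u 2) * m + ζ * (1ℚ - ρ) * (1ℚ - i)) qρ≡1)
           (drop (u 2 + (u 1 - u 2) * m) (ζ * (1ℚ - ρ))))
    where
    factor : ∀ q ρ ξ ζ → ξ + ζ * 1ℚ ≡ (ξ + ζ * (ρ * (ρ * 1ℚ)))
      + ((ξ + ζ * (ρ * 1ℚ)) - (ξ + ζ * (ρ * (ρ * 1ℚ)))) * (q + 1ℚ)
      + ζ * (1ℚ - ρ) * (1ℚ - q * ρ)
    factor = solve-∀ ℚ-ring
    drop : ∀ p r → p + r * (1ℚ - 1ℚ) ≡ p
    drop = solve-∀ ℚ-ring

  open LocalForm Γ m public
  module C = Cosines u θ 0<u₀ c₀ 0<c eigen

  local-psd : ∀ x v → Supported (x ~_) v → 0ℚ ≤ bil e v v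
  local-psd x = Interlacing.local-psd u 0<u₀ 0<u₁-u₂ log-convex u₀-u₂ (C.positive-semidefinite x) x

-- Subsets of a finite set

size : ∀ {n} → (Fin n → Bool) → ℚ
size P = ∑ (λ z → [ P z ])

find : ∀ {n} (P : Fin n → Bool) → (∃ λ i → P i ≡ true) ⊎ (∀ i → P i ≡ false)
find P with FinP.any? (λ i → P i BoolP.≟ true)
... | yes found = inj₁ found
... | no none   = inj₂ λ i → BoolP.¬-not λ eq → none (i , eq)

∧-true : ∀ {a b} → a ∧ b ≡ true → a ≡ true × b ≡ true
∧-true {true} {true} refl = refl , refl

true≢false : ∀ {a : Bool} → a ≡ true → a ≡ false → ⊥
true≢false refl ()

module _ {n : ℕ} where

  infix 4 _⊆_

  _⊆_ : (Fin n → Bool) → (Fin n → Bool) → Set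
  P ⊆ Q = ∀ z → P z ≡ true → Q z ≡ true

  insert remove : Fin n → (Fin n → Bool) → Fin n → Bool
  insert u P z = P z ∨ (u == z)
  remove u P z = P z ∧ not (u == z)

  some : (Fin n → Bool) → Bool
  some P = does (FinP.any? (λ i → P i BoolP.≟ true))

  some-false : ∀ P → some P ≡ false → ∀ i → P i ≡ false
  some-false P h i with FinP.any? (λ i → P i BoolP.≟ true)
  ... | no none = BoolP.¬-not λ eq → none (i , eq)

  some-true : ∀ P → some P ≡ true → ∃ λ i → P i ≡ true
  some-true P h with FinP.any? (λ i → P i BoolP.≟ true)
  ... | yes found = found

  ∑-== : ∀ (u : Fin n) → ∑ (λ z → [ u == z ]) ≡ 1ℚ
  ∑-== u = trans (∑-cong (λ z → sym (*-identityʳ [ u == z ]))) (∑-δ u (λ _ → 1ℚ))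

  ==⇒≡ : ∀ {i j : Fin n} → (i == j) ≡ true → i ≡ j
  ==⇒≡ {i} {j} h with i FinP.≟ j
  ... | yes eq = eq

  ==-false⇒≢ : ∀ {i j : Fin n} → (i == j) ≡ false → i ≢ j
  ==-false⇒≢ {i} h refl = contradiction (trans (sym (==-refl i)) h) λ ()

  size-insert : ∀ u P → P u ≡ false → size (insert u P) ≡ size P + 1ℚ
  size-insert u P Pu = trans (∑-cong pointwise) (trans (∑-+ _ _) (cong (λ i → size P + i) (∑-== u)))
    where
    pointwise : ∀ z → [ P z ∨ (u == z) ] ≡ [ P z ] + [ u == z ]
    pointwise z with u FinP.≟ z
    ... | no _ with P z
    ...   | true  = refl
    ...   | false = refl
    pointwise z | yes refl rewrite Pu = refl

  size-remove : ∀ u P → P u ≡ true → size (remove u P) ≡ size P - 1ℚ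
  size-remove u P Pu = trans (∑-cong pointwise) (trans (∑-+ _ _) (cong (λ i → size P + i)
      (trans (∑-*ˡ (- 1ℚ) _) (cong (- 1ℚ *_) (∑-== u)))))
    where
    pointwise : ∀ z → [ P z ∧ not (u == z) ] ≡ [ P z ] + - 1ℚ * [ u == z ]
    pointwise z with u FinP.≟ z
    ... | no _ with P z
    ...   | true  = refl
    ...   | false = refl
    pointwise z | yes refl rewrite Pu = refl

  insert-elim : ∀ u P z → insert u P z ≡ true → P z ≡ true ⊎ u ≡ z
  insert-elim u P z h with P z
  ... | true  = inj₁ refl
  ... | false = inj₂ (==⇒≡ h)

  remove-elim : ∀ u P z → remove u P z ≡ true → P z ≡ true × u ≢ z
  remove-elim u P z h with P z | u FinP.≟ z
  ... | true | no u≢z = refl , u≢z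

  0≤size : ∀ (P : Fin n → Bool) → 0ℚ ≤ size P
  0≤size P = 0≤∑ (λ z → 0≤[] (P z))

indicator-mono : ∀ {n} {P R : Fin n → Bool} → P ⊆ R → ∀ v → [ P v ] ≤ [ R v ]
indicator-mono {P = P} {R} P⊆R v = indicator-≤ (P v) (0≤[] (R v)) λ Pv → ≤-reflexive (cong [_] (sym (P⊆R v Pv)))

-- Every element of `H` is counted at some `z` of `S` that equals it or is `R`-related to it;
-- exchanging the two sums counts the same pairs by `z`. The summand 1 stands for `z` itself.
covering-bound : ∀ {n} (H S : Fin n → Bool) (R : Fin n → Fin n → Bool) {M} →
  (∀ u → H u ≡ true → ∃ λ z → S z ≡ true × (z ≡ u ⊎ R z u ≡ true)) →
  (∀ z → S z ≡ true → 1ℚ + ∑ (λ u → [ H u ] * [ R z u ]) ≤ M) → size H ≤ size S * M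
covering-bound H S R {M} covered star = ≤-trans (∑-mono cover)
  (subst₂ _≤_ (sym (∑-comm (λ u z → term u z))) (∑-*ʳ M (λ z → [ S z ])) (∑-mono λ z →
    subst (_≤ [ S z ] * M) (sym (trans (∑-*ˡ [ S z ] _) (cong ([ S z ] *_)
      (trans (∑-+ _ _) (cong (_+ ∑ (λ u → [ H u ] * [ R z u ])) (∑-== z)))))) (guard-mono (S z) (star z))))
  where
  term : Fin _ → Fin _ → ℚ
  term u z = [ S z ] * ([ z == u ] + [ H u ] * [ R z u ])
  0≤term : ∀ u z → 0ℚ ≤ term u z
  0≤term u z = 0≤* (0≤[] (S z)) (0≤+ (0≤[] (z == u)) (0≤* (0≤[] (H u)) (0≤[] (R z u))))
  cover : ∀ u → [ H u ] ≤ ∑ (term u)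
  cover u = indicator-≤ (H u) (0≤∑ (0≤term u)) λ Hu → by Hu (covered u Hu)
    where
    by : H u ≡ true → (∃ λ z → S z ≡ true × (z ≡ u ⊎ R z u ≡ true)) → 1ℚ ≤ ∑ (term u)
    by Hu (z , Sz , h) = ≤-trans (subst (1ℚ ≤_) (sym (trans (cong (λ i → [ i ] * ([ z == u ] + [ H u ] * [ R z u ])) Sz)
      (*-identityˡ _))) (at h)) (∑-term z (0≤term u))
      where
      at : z ≡ u ⊎ R z u ≡ true → 1ℚ ≤ [ z == u ] + [ H u ] * [ R z u ]
      at (inj₁ z≡u) = subst (_≤ [ z == u ] + [ H u ] * [ R z u ]) (+-identityʳ 1ℚ)
        (+-mono-≤ (≤-reflexive (cong [_] (sym (subst (λ i → (z == i) ≡ true) z≡u (==-refl z)))))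
                  (0≤* (0≤[] (H u)) (0≤[] (R z u))))
      at (inj₂ zu) = subst (_≤ [ z == u ] + [ H u ] * [ R z u ]) (+-identityˡ 1ℚ)
        (+-mono-≤ (0≤[] (z == u)) (≤-reflexive (sym (cong₂ (λ i j → [ i ] * [ j ]) Hu zu))))

count : ∀ {n} → (Fin n → Bool) → ℕ
count {zero}  P = 0
count {suc n} P with P zero
... | true  = suc (count (P ∘ suc))
... | false = count (P ∘ suc)

size-suc : ∀ {n} (P : Fin (suc n) → Bool) → size P ≡ [ P zero ] + size (P ∘ suc)
size-suc P = ∑-suc (λ z → [ P z ])

size-count : ∀ {n} (P : Fin n → Bool) → size P ≡ ℕ→ℚ (count P)
size-count {zero}  P = ∑-zero {zero} {λ i → [ P i ]} (λ ())
size-count {suc n} P with P zero in eq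
... | true  = trans (size-suc P) (trans (cong₂ (λ i j → [ i ] + j) eq (size-count (P ∘ suc)))
                (sym (ι-suc (count (P ∘ suc)))))
... | false = trans (size-suc P) (trans (cong₂ (λ i j → [ i ] + j) eq (size-count (P ∘ suc))) (+-identityˡ _))

count≤n : ∀ {n} (P : Fin n → Bool) → count P ℕ.≤ n
count≤n {zero}  P = ℕ.z≤n
count≤n {suc n} P with P zero
... | true  = ℕ.s≤s (count≤n (P ∘ suc))
... | false = ℕP.m≤n⇒m≤1+n (count≤n (P ∘ suc))

shrink : ∀ {n} (P : Fin n → Bool) k → k ℕ.≤ count P → ∃ λ Q → Q ⊆ P × count Q ≡ k
shrink {zero}  P zero h = P , (λ _ p → p) , refl
shrink {suc n} P zero h with shrink (P ∘ suc) zero ℕ.z≤n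
... | Q , Q⊆P , eq = (λ { zero → false ; (suc i) → Q i }) , (λ { (suc i) p → Q⊆P i p }) , eq
shrink {suc n} P (suc k) h with P zero in eq₀
... | true with shrink (P ∘ suc) k (ℕP.≤-pred h)
...   | Q , Q⊆P , eq = (λ { zero → true ; (suc i) → Q i }) , (λ { zero _ → eq₀ ; (suc i) p → Q⊆P i p }) , cong suc eq
shrink {suc n} P (suc k) h | false with shrink (P ∘ suc) (suc k) h
...   | Q , Q⊆P , eq = (λ { zero → false ; (suc i) → Q i }) , (λ { (suc i) p → Q⊆P i p }) , eq

-- Without decidability of F a largest member cannot be exhibited, but it can be
-- assumed to exist in the proof of a contradiction.
largest : ∀ {n} (F : (Fin n → Bool) → Set) (P : Fin n → Bool) → F P →
  (∀ P → F P → (∀ Q → F Q → size Q ≤ size P) → ⊥) → ⊥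
largest {n} F P₀ FP₀ k = go n P₀ (ℕP.m≤n+m n (count P₀)) FP₀
  where
  go : ∀ fuel P → n ℕ.≤ count P ℕ.+ fuel → F P → ⊥
  go fuel P h FP = k P FP bound
    where
    bound : ∀ Q → F Q → size Q ≤ size P
    bound Q FQ with count Q ℕ.≤? count P
    ... | yes Q≤P = subst₂ _≤_ (sym (size-count Q)) (sym (size-count P)) (ι-mono Q≤P)
    ... | no Q≰P = ⊥-elim (next fuel h)
      where
      P<Q = ℕP.≰⇒> Q≰P
      next : ∀ fuel → n ℕ.≤ count P ℕ.+ fuel → ⊥
      next zero h = ℕP.<-irrefl refl (ℕP.<-≤-trans P<Q
        (ℕP.≤-trans (count≤n Q) (subst (n ℕ.≤_) (ℕP.+-identityʳ (count P)) h)))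
      next (suc fuel) h = go fuel Q (ℕP.≤-trans (subst (n ℕ.≤_) (ℕP.+-suc (count P) fuel) h)
        (ℕP.+-monoˡ-≤ fuel P<Q)) FQ

-- Cliques: the smallest eigenvalue, and counting around a maximal clique

module Cliques {D b α β c bb} (Γ : DistanceRegular D c bb) (cl : Classical D b α β c bb) where
  open DistanceRegular Γ
  open Spectral Γ
  open ClassicalProperties cl
  open Local Γ cl using (e; e-sym; e-value; ~-irrefl; local-psd)

  ~⇒≢ : ∀ {y z} → (y ~ z) ≡ true → y ≢ z
  ~⇒≢ {y} h refl = true≢false h (~-irrefl y)

  IsClique : (V → Bool) → Set
  IsClique C = ∀ y z → C y ≡ true → C z ≡ true → y ≢ z → (y ~ z) ≡ true

  clique-insert : ∀ C u → IsClique C → (∀ v → C v ≡ true → (u ~ v) ≡ true) → IsClique (insert u C)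
  clique-insert C u clique joined v w Cv Cw v≢w = by (insert-elim u C v Cv) (insert-elim u C w Cw)
    where
    by : C v ≡ true ⊎ u ≡ v → C w ≡ true ⊎ u ≡ w → (v ~ w) ≡ true
    by (inj₁ Cv)   (inj₁ Cw)   = clique v w Cv Cw v≢w
    by (inj₁ Cv)   (inj₂ u≡w)  = trans (~-sym v w) (subst (λ i → (i ~ v) ≡ true) u≡w (joined v Cv))
    by (inj₂ u≡v)  (inj₁ Cw)   = subst (λ i → (i ~ w) ≡ true) u≡v (joined w Cw)
    by (inj₂ u≡v)  (inj₂ u≡w)  = contradiction (trans (sym u≡v) u≡w) v≢w

  clique-singleton : ∀ u → IsClique (u ==_)
  clique-singleton u v w u≡v u≡w v≢w = contradiction (trans (sym (==⇒≡ {i = u} {v} u≡v)) (==⇒≡ {i = u} {w} u≡w)) v≢w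

  joined-fresh : ∀ (C : V → Bool) u → (∀ v → C v ≡ true → (u ~ v) ≡ true) → C u ≡ false
  joined-fresh C u joined = BoolP.¬-not λ Cu → true≢false (joined u Cu) (~-irrefl u)

  -- The cosines of the smallest eigenvalue -[D].
  v : ℕ → ℚ
  v zero    = 1ℚ
  v (suc i) = - (1ℚ + α * g i) * (β - α * g i) ⁻¹ * v i

  v-suc : ∀ i → i ℕ.< D → (β - α * g i) * v (suc i) ≡ - (1ℚ + α * g i) * v i
  v-suc i i<D = trans (regroup (β - α * g i) (1ℚ + α * g i) ((β - α * g i) ⁻¹) (v i))
    (trans (cong (λ t → t * (- (1ℚ + α * g i) * v i)) (⁻¹-inverse (0<β-αg i i<D))) (*-identityˡ _))
    where
    regroup : ∀ p q r v → p * (- q * r * v) ≡ (p * r) * (- q * v)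
    regroup = solve-∀ ℚ-ring

  -- By the recursion both outer terms are multiples of `v i`: c_i v_(i-1) = -[i](β - α[i-1])v_i and
  -- b_i v_(i+1) = -([D] - [i])(1 + α[i])v_i. At `i = D` the second coefficient is 0, so the value
  -- of `v` beyond the diameter is irrelevant.
  v-eigen : ∀ i → i ℕ.≤ D → recur v i ≡ - g D * v i
  v-eigen i i≤D = begin
    c i * v (ℕ.pred i) + (bb 0 - c i - bb i) * v i + bb i * v (suc i)
      ≡⟨ cong₂ (λ p r → p + (bb 0 - c i - bb i) * v i + r) (backward i i≤D) forward ⟩
    - (g i * (β - α * g (ℕ.pred i))) * v i + (bb 0 - c i - bb i) * v i + - ((g D - g i) * (1ℚ + α * g i)) * v i
      ≡⟨ cong₂ (λ p r → - (g i * (β - α * g (ℕ.pred i))) * v i + (p - c i - r) * v i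
           + - ((g D - g i) * (1ℚ + α * g i)) * v i) (trans (b-eq 0 ℕ.z≤n) refl) (b-eq i i≤D) ⟩
    - (g i * (β - α * g (ℕ.pred i))) * v i + ((g D - 0ℚ) * (β - α * 0ℚ) - c i - (g D - g i) * (β - α * g i)) * v i
      + - ((g D - g i) * (1ℚ + α * g i)) * v i
      ≡⟨ cong (λ p → - (g i * (β - α * g (ℕ.pred i))) * v i
           + ((g D - 0ℚ) * (β - α * 0ℚ) - p - (g D - g i) * (β - α * g i)) * v i
           + - ((g D - g i) * (1ℚ + α * g i)) * v i) (c-eq i i≤D) ⟩
    _ ≡⟨ collapse (g D) (g i) (g (ℕ.pred i)) α β (v i) ⟩
    - g D * v i ∎
    where
    open ≡-Reasoning
    collapse : ∀ d x x' α β v →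
      - (x * (β - α * x')) * v + ((d - 0ℚ) * (β - α * 0ℚ) - x * (1ℚ + α * x') - (d - x) * (β - α * x)) * v
        + - ((d - x) * (1ℚ + α * x)) * v ≡ - d * v
    collapse = solve-∀ ℚ-ring
    backward : ∀ i → i ℕ.≤ D → c i * v (ℕ.pred i) ≡ - (g i * (β - α * g (ℕ.pred i))) * v i
    backward zero _ = trans (cong (_* 1ℚ) c₀) (simplify (β - α * 0ℚ))
      where
      simplify : ∀ p → 0ℚ * 1ℚ ≡ - (0ℚ * p) * 1ℚ
      simplify = solve-∀ ℚ-ring
    backward (suc i) i<D = trans (cong (_* v i) (c-eq (suc i) i<D))
      (trans (left (g (suc i)) (1ℚ + α * g i) (v i))
        (trans (cong (λ t → - g (suc i) * t) (sym (v-suc i i<D)))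
          (right (g (suc i)) (β - α * g i) (v (suc i)))))
      where
      left : ∀ x p v → x * p * v ≡ - x * (- p * v)
      left = solve-∀ ℚ-ring
      right : ∀ x p v → - x * (p * v) ≡ - (x * p) * v
      right = solve-∀ ℚ-ring
    forward : bb i * v (suc i) ≡ - ((g D - g i) * (1ℚ + α * g i)) * v i
    forward = by (ℕP.m≤n⇒m<n∨m≡n i≤D)
      where
      move : ∀ x p v → x * (- p * v) ≡ - (x * p) * v
      move = solve-∀ ℚ-ring
      vanish : ∀ x p w p' v → (x - x) * p * w ≡ - ((x - x) * p') * v
      vanish = solve-∀ ℚ-ring
      by : i ℕ.< D ⊎ i ≡ D → bb i * v (suc i) ≡ - ((g D - g i) * (1ℚ + α * g i)) * v i
      by (inj₁ i<D) = trans (cong (_* v (suc i)) (b-eq i i≤D))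
          (trans (*-assoc (g D - g i) (β - α * g i) (v (suc i)))
            (trans (cong ((g D - g i) *_) (v-suc i i<D)) (move (g D - g i) (1ℚ + α * g i) (v i))))
      by (inj₂ i≡D) = trans (cong (_* v (suc i)) (trans (b-eq i i≤D) (cong (λ j → (g j - g i) * (β - α * g i)) (sym i≡D))))
        (trans (vanish (g i) (β - α * g i) (v (suc i)) (1ℚ + α * g i) (v i))
          (cong (λ j → - ((g j - g i) * (1ℚ + α * g i)) * v i) i≡D))

  v₁ : β * v 1 ≡ - 1ℚ
  v₁ = trans (cong (_* v 1) (unit α β)) (trans (v-suc 0 (ℕP.≤-trans (ℕ.s≤s ℕ.z≤n) 2≤D)) (unit' α))
    where
    unit : ∀ α β → β ≡ β - α * 0ℚ
    unit = solve-∀ ℚ-ring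
    unit' : ∀ α → - (1ℚ + α * 0ℚ) * 1ℚ ≡ - 1ℚ
    unit' = solve-∀ ℚ-ring

  -- On the indicator of a clique with M vertices the form takes the value M + v₁M(M - 1), and v₁ =
  -- -1/β.
  clique-bound : ∀ x C → C x ≡ true → IsClique C → size C ≤ 1ℚ + β
  clique-bound x C Cx clique = 0≤q-p⇒p≤q (0≤*-cancel 0<M (subst (0ℚ ≤_) final (0≤* (<⇒≤ 0<β) whole)))
    where
    module E = Cosines v (- g D) 0<1 c₀ 0<c v-eigen
    M = size C
    0<M : 0ℚ < M
    0<M = <-≤-trans 0<1 (subst (λ t → [ t ] ≤ M) Cx (∑-term x (λ z → 0≤[] (C z))))
    whole : 0ℚ ≤ v 1 * (M * M) + (1ℚ - v 1) * M
    whole = subst (0ℚ ≤_) (trans (sym (bil-def _ _ _)) (trans (bil-clique {p = v 1} {1ℚ} (indicator-supported C)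
        (λ y z _ _ y≡z → cong v (trans (cong (d y) (sym y≡z)) (d-refl y)))
        (λ y z Cy Cz y≢z → cong v (≡ᵇ-true (d y z) 1 (clique y z Cy Cz y≢z))))
      (cong (λ t → v 1 * (M * M) + (1ℚ - v 1) * t) (∑-cong (λ y → []² (C y))))))
      (E.positive-semidefinite x (λ z → [ C z ]))
    final : β * (v 1 * (M * M) + (1ℚ - v 1) * M) ≡ M * (1ℚ + β - M)
    final = trans (expand β (v 1) M) (trans (cong (λ t → t * (M * M) + (β - t) * M) v₁) (fold β M))
      where
      expand : ∀ β v M → β * (v * (M * M) + (1ℚ - v) * M) ≡ (β * v) * (M * M) + (β - β * v) * M
      expand = solve-∀ ℚ-ring
      fold : ∀ β M → - 1ℚ * (M * M) + (β - - 1ℚ) * M ≡ M * (1ℚ + β - M)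
      fold = solve-∀ ℚ-ring

  common : V → V → ℚ
  common x y = ∑ (λ z → [ x ~ z ] * [ y ~ z ])

  common-eq : ∀ x y → common x y ≡ recur (λ j → [ j ≡ᵇ 1 ]) (d x y)
  common-eq x y = trans (∑-cong (λ z → *-comm [ x ~ z ] [ y ~ z ])) (neighbour-sum (λ j → [ j ≡ᵇ 1 ]) x y)

  -- a₁ + 1
  A : ℚ
  A = β + α * B

  common-self : ∀ x → common x x ≡ bb 0
  common-self x = trans (∑-cong (λ z → []² (x ~ z))) (valency x)

  common-adjacent : ∀ x y → (x ~ y) ≡ true → common x y ≡ A - 1ℚ
  common-adjacent x y h = trans (common-eq x y) (trans (cong (recur (λ j → [ j ≡ᵇ 1 ])) (≡ᵇ-true (d x y) 1 h))
    (trans (simplify (c 1) (bb 0) (bb 1)) (cong₂ _-_ (Local.k-b₁ Γ cl) c₁-eq)))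
    where
    simplify : ∀ c k l → c * 0ℚ + (k - c - l) * 1ℚ + l * 0ℚ ≡ k - l - c
    simplify = solve-∀ ℚ-ring

  common-distance-two : ∀ x y → d x y ≡ 2 → common x y ≡ c 2
  common-distance-two x y h = trans (common-eq x y) (trans (cong (recur (λ j → [ j ≡ᵇ 1 ])) h) (simplify (c 2) (bb 0) (bb 2)))
    where
    simplify : ∀ c k l → c * 1ℚ + (k - c - l) * 0ℚ + l * 0ℚ ≡ c
    simplify = solve-∀ ℚ-ring

  distance-two : ∀ x y z → (x ~ y) ≡ true → (x ~ z) ≡ true → y ≢ z → (y ~ z) ≡ false → d y z ≡ 2
  distance-two x y z xy xz y≢z y≁z = by (d-step y x z (≡ᵇ-true (d x z) 1 xz))
    where
    yx : d y x ≡ 1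
    yx = trans (d-sym y x) (≡ᵇ-true (d x y) 1 xy)
    by : d y z ≡ d y x ⊎ d y z ≡ suc (d y x) ⊎ suc (d y z) ≡ d y x → d y z ≡ 2
    by (inj₁ h)        = ⊥-elim (true≢false (cong (_≡ᵇ 1) (trans h yx)) y≁z)
    by (inj₂ (inj₁ h)) = trans h (cong suc yx)
    by (inj₂ (inj₂ h)) = contradiction (d-zero (ℕP.suc-injective (trans h yx))) y≢z

  μ Q : ℚ
  μ = c 2 - 1ℚ
  Q = m * q

  0<m : 0ℚ < m
  0<m = 0<+ 0<q 0≤1

  0<Q : 0ℚ < Q
  0<Q = 0<* 0<m 0<q

  module MaximalClique (C : V → Bool) (clique : IsClique C)
                       (maximal : ∀ z → C z ≡ false → ∃ λ y → C y ≡ true × (z ~ y) ≡ false) where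

    M n : ℚ
    M = size C
    n = M - 1ℚ

    t : V → ℚ
    t z = ∑ (λ y → [ C y ] * [ z ~ y ])

    -- The local form is tested on a vector that is constant on {z}, on the neighbours of z
    -- in C, and on the non-neighbours of z in C, with total weight zero on C.
    module Outside (z x : V) (Cz : C z ≡ false) (Cx : C x ≡ true) (zx : (z ~ x) ≡ true) where

      τ n′ : ℚ
      τ  = t z - 1ℚ
      n′ = M - t z

      -- `f` and `h` are the indicators of the neighbours of `z` in `C` other than `x`, and of the
      -- non-neighbours of `z` in `C`. The vertex `x` is left out because the vector has to live on
      -- Γ(x). The sets have `τ` and `n′` elements, so the weights in `w` add up to zero.
      f h w : V → ℚ
      f y = [ C y ] * [ z ~ y ] + - 1ℚ * [ x == y ]
      h y = [ C y ] + - 1ℚ * ([ C y ] * [ z ~ y ])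
      w y = τ * h y + - n′ * f y

      ∑f : ∑ f ≡ τ
      ∑f = trans (∑-+ _ _) (cong (λ s → t z + s) (trans (∑-*ˡ (- 1ℚ) _) (cong (- 1ℚ *_) (∑-== x))))

      ∑h : ∑ h ≡ n′
      ∑h = trans (∑-+ _ _) (cong (λ i → M + i) (trans (∑-*ˡ (- 1ℚ) _) (negate (t z))))
        where
        negate : ∀ t → - 1ℚ * t ≡ - t
        negate = solve-∀ ℚ-ring

      ∑w : ∑ w ≡ 0ℚ
      ∑w = trans (∑-+ _ _) (trans (cong₂ _+_ (trans (∑-*ˡ τ h) (cong (τ *_) ∑h))
                                             (trans (∑-*ˡ (- n′) f) (cong (- n′ *_) ∑f))) (cancel τ n′))
        where
        cancel : ∀ τ n → τ * n + - n * τ ≡ 0ℚ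
        cancel = solve-∀ ℚ-ring

      module _ (y : V) where

        f-value : ∀ {i j k} → C y ≡ i → (z ~ y) ≡ j → (x == y) ≡ k → f y ≡ [ i ] * [ j ] + - 1ℚ * [ k ]
        f-value p r s = cong₂ _+_ (cong₂ (λ i j → [ i ] * [ j ]) p r) (cong (λ i → - 1ℚ * [ i ]) s)

        h-value : ∀ {i j} → C y ≡ i → (z ~ y) ≡ j → h y ≡ [ i ] + - 1ℚ * ([ i ] * [ j ])
        h-value p r = cong₂ (λ i j → [ i ] + - 1ℚ * ([ i ] * [ j ])) p r

        data Position : Set where
          off  : f y ≡ 0ℚ → h y ≡ 0ℚ → Position
          near : C y ≡ true → (x ~ y) ≡ true → (z ~ y) ≡ true → f y ≡ 1ℚ → h y ≡ 0ℚ → Position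
          far  : C y ≡ true → (x ~ y) ≡ true → (z ~ y) ≡ false → f y ≡ 0ℚ → h y ≡ 1ℚ → Position

        position : Position
        position = by (x == y) (C y) (z ~ y) refl refl refl
          where
          by : ∀ i j k → (x == y) ≡ i → C y ≡ j → (z ~ y) ≡ k → Position
          by true  j k p r s = off (f-value (trans (cong C (sym (==⇒≡ p))) Cx) (trans (cong (z ~_) (sym (==⇒≡ p))) zx) p)
                                   (h-value (trans (cong C (sym (==⇒≡ p))) Cx) (trans (cong (z ~_) (sym (==⇒≡ p))) zx))
          by false true  true  p r s = near r (clique x y Cx r (==-false⇒≢ p)) s (f-value r s p) (h-value r s)
          by false true  false p r s = far r (clique x y Cx r (==-false⇒≢ p)) s (f-value r s p) (h-value r s)
          by false false true  p r s = off (f-value r s p) (h-value r s)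
          by false false false p r s = off (f-value r s p) (h-value r s)

      P : V → Bool
      P y = C y ∧ (x ~ y)

      w-value : ∀ {y i j} → f y ≡ i → h y ≡ j → w y ≡ τ * j + - n′ * i
      w-value p r = cong₂ (λ i j → τ * j + - n′ * i) p r

      w-supported : Supported P w
      w-supported y = by (position y)
        where
        zeros : ∀ τ n → τ * 0ℚ + - n * 0ℚ ≡ 0ℚ
        zeros = solve-∀ ℚ-ring
        by : Position y → w y ≡ 0ℚ ⊎ P y ≡ true
        by (off p r)          = inj₁ (trans (w-value p r) (zeros τ n′))
        by (near Cy xy _ _ _) = inj₂ (cong₂ _∧_ Cy xy)
        by (far Cy xy _ _ _)  = inj₂ (cong₂ _∧_ Cy xy)

      w²  : ∀ y → w y * w y ≡ τ * τ * h y + n′ * n′ * f y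
      w² y = by (position y)
        where
        square : ∀ {i j} → f y ≡ i → h y ≡ j → i * j ≡ 0ℚ → i * i ≡ i → j * j ≡ j → w y * w y ≡ τ * τ * h y + n′ * n′ * f y
        square {i} {j} p r ij ii jj = trans (cong₂ _*_ (w-value p r) (w-value p r)) (trans (expand τ n′ i j)
          (trans (cong₂ _+_ (cong₂ (λ a b → τ * τ * a + n′ * n′ * b) jj ii) (cong (- (2ℚ * τ * n′) *_) ij))
            (trans (drop (τ * τ * j + n′ * n′ * i) (2ℚ * τ * n′)) (sym (cong₂ (λ i j → τ * τ * j + n′ * n′ * i) p r)))))
          where
          expand : ∀ τ n i j → (τ * j + - n * i) * (τ * j + - n * i) ≡
            τ * τ * (j * j) + n * n * (i * i) + - ((1ℚ + 1ℚ) * τ * n) * (i * j)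
          expand = solve-∀ ℚ-ring
          drop : ∀ p r → p + - r * 0ℚ ≡ p
          drop = solve-∀ ℚ-ring
        by : Position y → w y * w y ≡ τ * τ * h y + n′ * n′ * f y
        by (off p r)        = square p r refl refl refl
        by (near _ _ _ p r) = square p r refl refl refl
        by (far _ _ _ p r)  = square p r refl refl refl

      -- On a clique `e` is the all-ones matrix plus m - 1 times the identity, and the all-ones part
      -- vanishes at a vector of total weight zero. As τ + n′ = n, the value is qτn′n.
      ww : bil e w w ≡ (m - 1ℚ) * (τ * τ * n′ + n′ * n′ * τ)
      ww = trans (bil-clique {p = 1ℚ} {m} w-supported
          (λ y y′ _ _ y≡y′ → trans (e-value (subst (λ i → (y == i) ≡ true) y≡y′ (==-refl y))
            (subst (λ i → (y ~ i) ≡ false) y≡y′ (~-irrefl y))) (same m))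
          (λ y y′ Py Py′ y≢y′ → trans (e-value (≢⇒== y≢y′)
            (clique y y′ (proj₁ (∧-true {C y} Py)) (proj₁ (∧-true {C y′} Py′)) y≢y′)) (different m)))
        (trans (cong₂ (λ i j → 1ℚ * (i * i) + (m - 1ℚ) * j) ∑w
                  (trans (∑-cong w²) (trans (∑-+ _ _) (cong₂ _+_ (trans (∑-*ˡ (τ * τ) h) (cong (τ * τ *_) ∑h))
                                                               (trans (∑-*ˡ (n′ * n′) f) (cong (n′ * n′ *_) ∑f))))))
               (simplify ((m - 1ℚ) * (τ * τ * n′ + n′ * n′ * τ))))
        where
        same : ∀ m → m * 1ℚ + 0ℚ ≡ m
        same = solve-∀ ℚ-ring
        different : ∀ m → m * 0ℚ + 1ℚ ≡ 1ℚ
        different = solve-∀ ℚ-ring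
        simplify : ∀ p → 1ℚ * (0ℚ * 0ℚ) + p ≡ p
        simplify = solve-∀ ℚ-ring

      z≢ : ∀ {y} → C y ≡ true → z ≢ y
      z≢ Cy refl = true≢false Cy Cz

      zw : bil e (λ y → [ z == y ]) w ≡ - n′ * τ
      zw = trans (bil-δˡ z w) (trans (∑-cong pointwise) (trans (∑-*ˡ (- n′) f) (cong (- n′ *_) ∑f)))
        where
        product : ∀ {y i j k} → f y ≡ i → h y ≡ j → e z y ≡ k → (τ * j + - n′ * i) * k ≡ - n′ * i → w y * e z y ≡ - n′ * f y
        product p r s eq = trans (cong₂ _*_ (w-value p r) s) (trans eq (cong (- n′ *_) (sym p)))
        pointwise : ∀ y → w y * e z y ≡ - n′ * f y
        pointwise y = by (position y)
          where
          lemma₀ : ∀ τ n e → (τ * 0ℚ + - n * 0ℚ) * e ≡ - n * 0ℚ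
          lemma₀ = solve-∀ ℚ-ring
          lemma₁ : ∀ τ n m → (τ * 0ℚ + - n * 1ℚ) * (m * 0ℚ + 1ℚ) ≡ - n * 1ℚ
          lemma₁ = solve-∀ ℚ-ring
          lemma₂ : ∀ τ n m → (τ * 1ℚ + - n * 0ℚ) * (m * 0ℚ + 0ℚ) ≡ - n * 0ℚ
          lemma₂ = solve-∀ ℚ-ring
          by : Position y → w y * e z y ≡ - n′ * f y
          by (off p r)          = product p r refl (lemma₀ τ n′ (e z y))
          by (near Cy _ zy p r) = product p r (e-value (≢⇒== (z≢ Cy)) zy) (lemma₁ τ n′ m)
          by (far Cy _ zy p r)  = product p r (e-value (≢⇒== (z≢ Cy)) zy) (lemma₂ τ n′ m)

      zz : bil e (λ y → [ z == y ]) (λ y → [ z == y ]) ≡ m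
      zz = trans (bil-δˡ z _) (trans (∑-δ z (e z)) (trans (e-value (==-refl z) (~-irrefl z)) (simplify m)))
        where
        simplify : ∀ m → m * 1ℚ + 0ℚ ≡ m
        simplify = solve-∀ ℚ-ring

      -- The coefficients make this vector orthogonal to `z` for the form `e`; for a given multiple
      -- of `w` this minimises the form over the coefficient of `z`.
      test : V → ℚ
      test y = τ * n′ * [ z == y ] + m * w y

      test-supported : Supported (x ~_) test
      test-supported y = by (z == y) refl (w-supported y)
        where
        zeros : ∀ p m → p * 0ℚ + m * 0ℚ ≡ 0ℚ
        zeros = solve-∀ ℚ-ring
        by : ∀ i → (z == y) ≡ i → w y ≡ 0ℚ ⊎ P y ≡ true → test y ≡ 0ℚ ⊎ (x ~ y) ≡ true
        by true  p _        = inj₂ (subst (λ i → (x ~ i) ≡ true) (==⇒≡ p) (trans (~-sym x z) zx))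
        by false p (inj₁ r) = inj₁ (trans (cong₂ (λ i j → τ * n′ * [ i ] + m * j) p r) (zeros (τ * n′) m))
        by false p (inj₂ h) = inj₂ (proj₂ (∧-true {C y} h))

      product-bound : τ * n′ * (τ * n′) ≤ τ * n′ * (Q * n)
      product-bound = 0≤q-p⇒p≤q (0≤*-cancel 0<m (subst (0ℚ ≤_)
        (trans (bil-expand e-sym (τ * n′) m (λ y → [ z == y ]) w)
          (trans (cong₂ _+_ (cong₂ (λ i j → τ * n′ * (τ * n′) * i + 2ℚ * (τ * n′ * m) * j) zz zw) (cong (m * m *_) ww))
            (collect q (size C) (t z))))
        (local-psd x test test-supported)))
        where
        collect : ∀ q M t →
          (t - 1ℚ) * (M - t) * ((t - 1ℚ) * (M - t)) * (q + 1ℚ)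
            + (1ℚ + 1ℚ) * ((t - 1ℚ) * (M - t) * (q + 1ℚ)) * (- (M - t) * (t - 1ℚ))
            + (q + 1ℚ) * (q + 1ℚ) * ((q + 1ℚ - 1ℚ) * ((t - 1ℚ) * (t - 1ℚ) * (M - t) + (M - t) * (M - t) * (t - 1ℚ))) ≡
          (q + 1ℚ) * ((t - 1ℚ) * (M - t) * ((q + 1ℚ) * q * (M - 1ℚ)) - (t - 1ℚ) * (M - t) * ((t - 1ℚ) * (M - t)))
        collect = solve-∀ ℚ-ring

      1≤t : 1ℚ ≤ t z
      1≤t = subst (_≤ t z) (cong₂ (λ i j → [ i ] * [ j ]) Cx zx)
        (∑-term x (λ y → 0≤* (0≤[] (C y)) (0≤[] (z ~ y))))

      -- By maximality some `y` in `C` is not adjacent to `z`. It is at distance two from `z`,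
      -- through `x`, and every neighbour of `z` in `C` is a common neighbour of `y` and `z`.
      t≤c₂ : t z ≤ c 2
      t≤c₂ = by (maximal z Cz)
        where
        xz : (x ~ z) ≡ true
        xz = trans (~-sym x z) zx
        by : (∃ λ y → C y ≡ true × (z ~ y) ≡ false) → t z ≤ c 2
        by (y , Cy , zy) = subst (t z ≤_) (common-distance-two z y (distance-two x z y xz xy (z≢ Cy) zy))
            (∑-mono λ y′ → subst (_≤ [ z ~ y′ ] * [ y ~ y′ ]) (*-comm [ z ~ y′ ] [ C y′ ])
              (guard-mono (z ~ y′) λ zy′ → indicator-≤ (C y′) (0≤[] (y ~ y′)) λ Cy′ → ≤-reflexive (cong [_]
                (sym (clique y y′ Cy Cy′ λ y≡y′ → true≢false (trans (cong (z ~_) y≡y′) zy′) zy)))))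
          where
          xy : (x ~ y) ≡ true
          xy = clique x y Cx Cy λ x≡y → true≢false (trans (cong (z ~_) (sym x≡y)) zx) zy

      0≤n : 0ℚ ≤ n
      0≤n = 0≤q-p (subst (λ i → [ i ] ≤ M) Cx (∑-term x (λ y → 0≤[] (C y))))

      -- `product-bound` is divided by τn′ where that is positive; otherwise τn′ ≤ Qn is trivial.
      -- Then n′ ≥ n - μ, because t ≤ c₂.
      neighbour-bound : τ * (n - μ) ≤ Q * n
      neighbour-bound = ≤-trans (≤-by (shift τ M (t z) (c 2)) (0≤* (0≤q-p 1≤t) (0≤q-p t≤c₂))) Xbound
        where
        shift : ∀ τ M t c → τ * (M - t) - τ * (M - 1ℚ - (c - 1ℚ)) ≡ τ * (c - t)
        shift = solve-∀ ℚ-ring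
        Xbound : τ * n′ ≤ Q * n
        Xbound = by (0ℚ <? τ * n′)
          where
          by : Dec (0ℚ < τ * n′) → τ * n′ ≤ Q * n
          by (yes 0<X) = *-cancelˡ-≤-pos (τ * n′) {{positive 0<X}} product-bound
          by (no X≮0)  = ≤-trans (≮⇒≥ X≮0) (0≤* (<⇒≤ 0<Q) 0≤n)

    -- Multiplication by t extends the bound to the vertices without neighbours in `C`, so that it
    -- can be summed over everything outside `C`.
    outside-bound : ∀ z → C z ≡ false → t z * (t z - 1ℚ) * (n - μ) ≤ Q * n * t z
    outside-bound z Cz = by (find (λ y → C y ∧ (z ~ y)))
      where
      left : ∀ t p → t * ((t - 1ℚ) * p) ≡ t * (t - 1ℚ) * p
      left = solve-∀ ℚ-ring
      zeros : ∀ p r → 0ℚ * (0ℚ - 1ℚ) * p ≡ r * 0ℚ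
      zeros = solve-∀ ℚ-ring
      by : (∃ λ y → C y ∧ (z ~ y) ≡ true) ⊎ (∀ y → C y ∧ (z ~ y) ≡ false) →
           t z * (t z - 1ℚ) * (n - μ) ≤ Q * n * t z
      by (inj₁ (x , h)) = subst₂ _≤_ (left (t z) (n - μ)) (*-comm (t z) (Q * n))
          (*-monoˡ-≤-nonNeg (t z) {{nonNegative (≤-trans 0≤1 O.1≤t)}} O.neighbour-bound)
        where
        module O = Outside z x Cz (proj₁ (∧-true {C x} h)) (proj₂ (∧-true {C x} h))
      by (inj₂ none) = ≤-reflexive (trans (cong (λ i → i * (i - 1ℚ) * (n - μ)) t≡0)
          (trans (zeros (n - μ) (Q * n)) (cong (Q * n *_) (sym t≡0))))
        where
        t≡0 : t z ≡ 0ℚ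
        t≡0 = ∑-zero (λ y → trans (sym ([∧] (C y) (z ~ y))) (cong [_] (none y)))

    inside-value : ∀ z → C z ≡ true → t z ≡ n
    inside-value z Cz = trans (∑-cong pointwise) (size-remove z C Cz)
      where
      pointwise : ∀ y → [ C y ] * [ z ~ y ] ≡ [ remove z C y ]
      pointwise y = trans (guard-cong (C y) (λ Cy → by Cy (z == y) refl)) (sym ([∧] (C y) (not (z == y))))
        where
        by : C y ≡ true → ∀ i → (z == y) ≡ i → [ z ~ y ] ≡ [ not (z == y) ]
        by Cy true  p = cong [_] (trans (cong (z ~_) (sym (==⇒≡ p))) (trans (~-irrefl z) (cong not (sym p))))
        by Cy false p = cong [_] (trans (clique z y Cz Cy (==-false⇒≢ p)) (cong not (sym p)))

    ∑t : ∑ t ≡ M * bb 0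
    ∑t = trans (∑-comm _) (trans (∑-cong (λ y → trans (∑-*ˡ [ C y ] _)
      (cong ([ C y ] *_) (trans (∑-cong (λ z → cong [_] (~-sym z y))) (valency y))))) (∑-*ʳ (bb 0) _))

    -- The sum counts pairs in `C` together with a common neighbour: a₁ of these for two distinct
    -- members, k for a repeated one.
    ∑t² : ∑ (λ z → t z * t z) ≡ (A - 1ℚ) * (M * M) + (bb 0 - (A - 1ℚ)) * M
    ∑t² = begin
      ∑ (λ z → t z * t z)
        ≡⟨ ∑-cong (λ z → trans (sym (bil-1 _ _)) (bil-def _ _ _)) ⟩
      ∑ (λ z → ∑ (λ x → ∑ (λ y → [ C x ] * [ z ~ x ] * ([ C y ] * [ z ~ y ]) * 1ℚ)))
        ≡⟨ trans (∑-comm _) (∑-cong (λ x → ∑-comm _)) ⟩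
      ∑ (λ x → ∑ (λ y → ∑ (λ z → [ C x ] * [ z ~ x ] * ([ C y ] * [ z ~ y ]) * 1ℚ)))
        ≡⟨ ∑-cong (λ x → ∑-cong (λ y → trans (∑-cong (λ z → trans
             (cong₂ (λ i j → [ C x ] * [ i ] * ([ C y ] * [ j ]) * 1ℚ) (~-sym z x) (~-sym z y))
             (regroup [ C x ] [ x ~ z ] [ C y ] [ y ~ z ]))) (∑-*ˡ ([ C x ] * [ C y ]) _))) ⟩
      ∑ (λ x → ∑ (λ y → [ C x ] * [ C y ] * common x y)) ≡⟨ bil-def common _ _ ⟨
      bil common (λ y → [ C y ]) (λ y → [ C y ])
        ≡⟨ bil-clique {p = A - 1ℚ} {bb 0} (indicator-supported C)
             (λ x y _ _ x≡y → trans (cong (common x) (sym x≡y)) (common-self x))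
             (λ x y Cx Cy x≢y → common-adjacent x y (clique x y Cx Cy x≢y)) ⟩
      (A - 1ℚ) * (M * M) + (bb 0 - (A - 1ℚ)) * ∑ (λ y → [ C y ] * [ C y ])
        ≡⟨ cong (λ i → (A - 1ℚ) * (M * M) + (bb 0 - (A - 1ℚ)) * i) (∑-cong (λ y → []² (C y))) ⟩
      (A - 1ℚ) * (M * M) + (bb 0 - (A - 1ℚ)) * M ∎
      where
      open ≡-Reasoning
      regroup : ∀ p r s t → p * r * (s * t) * 1ℚ ≡ p * s * (r * t)
      regroup = solve-∀ ℚ-ring

    clique-inequality : 0ℚ < n → (A - n) * (n - μ) ≤ Q * (bb 0 - n)
    clique-inequality 0<n = 0≤q-p⇒p≤q (0≤*-cancel 0<n (0≤*-cancel 0<M (subst (0ℚ ≤_) final (0≤q-p summed))))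
      where
      0<M : 0ℚ < M
      0<M = <-trans 0<n (<-by (shift M) 0<1)
        where
        shift : ∀ M → M - (M - 1ℚ) ≡ 1ℚ
        shift = solve-∀ ℚ-ring
      -- The value of Qnt - (n - μ)t(t - 1) at t = n, which every vertex of `C` attains. Outside `C`
      -- this expression is non-negative, so its sum over all vertices is at least `M * E`.
      E : ℚ
      E = Q * n * n - n * (n - 1ℚ) * (n - μ)
      pointwise : ∀ z → [ C z ] * E ≤ Q * n * t z + - (n - μ) * (t z * t z) + (n - μ) * t z
      pointwise z = by (C z) refl
        where
        inside : ∀ n p Q → 1ℚ * (Q * n * n - n * (n - 1ℚ) * p) ≡ Q * n * n + - p * (n * n) + p * n
        inside = solve-∀ ℚ-ring
        outside : ∀ t p r E → r * t + - p * (t * t) + p * t - 0ℚ * E ≡ r * t - t * (t - 1ℚ) * p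
        outside = solve-∀ ℚ-ring
        by : ∀ i → C z ≡ i → [ C z ] * E ≤ Q * n * t z + - (n - μ) * (t z * t z) + (n - μ) * t z
        by true  Cz = ≤-reflexive (trans (cong (λ i → [ i ] * E) Cz) (trans (inside n (n - μ) Q)
          (cong (λ i → Q * n * i + - (n - μ) * (i * i) + (n - μ) * i) (sym (inside-value z Cz)))))
        by false Cz = subst (λ i → [ i ] * E ≤ Q * n * t z + - (n - μ) * (t z * t z) + (n - μ) * t z) (sym Cz)
          (≤-by (outside (t z) (n - μ) (Q * n) E) (0≤q-p (outside-bound z Cz)))
      summed : M * E ≤ Q * n * (M * bb 0) + - (n - μ) * ((A - 1ℚ) * (M * M) + (bb 0 - (A - 1ℚ)) * M)
                       + (n - μ) * (M * bb 0)
      summed = subst₂ _≤_ (∑-*ʳ E _)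
        (trans (∑-+ _ _) (cong₂ _+_ (trans (∑-+ _ _) (cong₂ _+_
           (trans (∑-*ˡ (Q * n) t) (cong (Q * n *_) ∑t))
           (trans (∑-*ˡ (- (n - μ)) _) (cong (- (n - μ) *_) ∑t²))))
           (trans (∑-*ˡ (n - μ) t) (cong ((n - μ) *_) ∑t))))
        (∑-mono pointwise)
      final : Q * n * (M * bb 0) + - (n - μ) * ((A - 1ℚ) * (M * M) + (bb 0 - (A - 1ℚ)) * M)
                + (n - μ) * (M * bb 0) - M * E ≡ M * (n * (Q * (bb 0 - n) - (A - n) * (n - μ)))
      final = collect Q M (bb 0) A μ
        where
        collect : ∀ Q M k A μ →
          Q * (M - 1ℚ) * (M * k) + - (M - 1ℚ - μ) * ((A - 1ℚ) * (M * M) + (k - (A - 1ℚ)) * M)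
            + (M - 1ℚ - μ) * (M * k)
            - M * (Q * (M - 1ℚ) * (M - 1ℚ) - (M - 1ℚ) * (M - 1ℚ - 1ℚ) * (M - 1ℚ - μ)) ≡
          M * ((M - 1ℚ) * (Q * (k - (M - 1ℚ)) - (A - (M - 1ℚ)) * (M - 1ℚ - μ)))
        collect = solve-∀ ℚ-ring

-- The common neighbourhood of an edge

bil-mono : ∀ {n} {K L : Fin n → Fin n → ℚ} {f g} → (∀ y → 0ℚ ≤ f y) → (∀ y → 0ℚ ≤ g y) →
           (∀ y z → K y z ≤ L y z) → bil K f g ≤ bil L f g
bil-mono {K = K} {L} {f} {g} 0≤f 0≤g h = subst₂ _≤_ (sym (bil-def K f g)) (sym (bil-def L f g))
  (∑-mono λ y → ∑-mono λ z → *-monoˡ-≤-nonNeg (f y * g z) {{nonNegative (0≤* (0≤f y) (0≤g z))}} (h y z))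

bil-row : ∀ {n} (K : Fin n → Fin n → ℚ) f g → bil K f g ≡ ∑ (λ y → f y * ∑ (λ z → g z * K y z))
bil-row K f g = trans (bil-def K f g) (∑-cong λ y →
  trans (∑-cong (λ z → *-assoc (f y) (g z) (K y z))) (∑-*ˡ (f y) (λ z → g z * K y z)))

bil-∑ : ∀ {n} (K : Fin n → Fin n → ℚ) (s : Fin n → ℚ) (f : Fin n → Fin n → ℚ) →
  bil K (λ v → ∑ (λ z → s z * f z v)) (λ v → ∑ (λ z → s z * f z v)) ≡
  bil (λ z z′ → bil K (f z) (f z′)) s s
bil-∑ K s f = begin
  bil K F F
    ≡⟨ bil-def K F F ⟩
  ∑ (λ v → ∑ (λ v′ → F v * F v′ * K v v′))
    ≡⟨ ∑-cong (λ v → ∑-cong (λ v′ → trans (cong (_* K v v′) (product v v′)) (expand v v′))) ⟩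
  ∑ (λ v → ∑ (λ v′ → ∑ (λ z → ∑ (λ z′ → s z * s z′ * (f z v * f z′ v′ * K v v′)))))
    ≡⟨ trans (∑-cong (λ v → trans (∑-comm _) (∑-cong (λ z → ∑-comm _)))) (∑-comm _) ⟩
  ∑ (λ z → ∑ (λ v → ∑ (λ z′ → ∑ (λ v′ → s z * s z′ * (f z v * f z′ v′ * K v v′)))))
    ≡⟨ ∑-cong (λ z → ∑-comm _) ⟩
  ∑ (λ z → ∑ (λ z′ → ∑ (λ v → ∑ (λ v′ → s z * s z′ * (f z v * f z′ v′ * K v v′)))))
    ≡⟨ ∑-cong (λ z → ∑-cong (λ z′ → trans (∑-cong (λ v → ∑-*ˡ (s z * s z′) _))
         (trans (∑-*ˡ (s z * s z′) _) (cong (s z * s z′ *_) (sym (bil-def K (f z) (f z′))))))) ⟩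
  ∑ (λ z → ∑ (λ z′ → s z * s z′ * bil K (f z) (f z′)))
    ≡⟨ bil-def _ s s ⟨
  bil (λ z z′ → bil K (f z) (f z′)) s s ∎
  where
  open ≡-Reasoning
  F : Fin _ → ℚ
  F v = ∑ (λ z → s z * f z v)
  product : ∀ v v′ → F v * F v′ ≡ ∑ (λ z → ∑ (λ z′ → s z * f z v * (s z′ * f z′ v′)))
  product v v′ = trans (sym (∑-*ʳ (F v′) _)) (∑-cong (λ z → sym (∑-*ˡ (s z * f z v) _)))
  expand : ∀ v v′ → ∑ (λ z → ∑ (λ z′ → s z * f z v * (s z′ * f z′ v′))) * K v v′ ≡
    ∑ (λ z → ∑ (λ z′ → s z * s z′ * (f z v * f z′ v′ * K v v′)))
  expand v v′ = trans (sym (∑-*ʳ (K v v′) _)) (∑-cong (λ z → trans (sym (∑-*ʳ (K v v′) _))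
    (∑-cong (λ z′ → regroup (s z) (f z v) (s z′) (f z′ v′) (K v v′)))))
    where
    regroup : ∀ s f s′ f′ k → s * f * (s′ * f′) * k ≡ s * s′ * (f * f′ * k)
    regroup = solve-∀ ℚ-ring

module Neighbourhood {D b α β c bb} (Γ : DistanceRegular D c bb) (cl : Classical D b α β c bb)
                     (μ₀ : ℕ) (c₂-μ₀ : c 2 ≡ 1ℚ + ℕ→ℚ μ₀) where
  open DistanceRegular Γ
  open Spectral Γ
  open ClassicalProperties cl using (q; m; 0<q)
  open Local Γ cl using (e; e-sym; e-value; ~-irrefl; local-psd)
  open Cliques Γ cl using (common; common-adjacent; common-distance-two; distance-two; A; μ; 0<m;
                           ~⇒≢; IsClique; clique-insert; clique-singleton; joined-fresh)

  ν : ℚ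
  ν = μ - 1ℚ

  Independent : (V → Bool) → Set
  Independent S = ∀ u v → S u ≡ true → S v ≡ true → (u ~ v) ≡ false

  module Edge (x y : V) (x~y : (x ~ y) ≡ true) where

    Λ : V → Bool
    Λ z = (x ~ z) ∧ (y ~ z)

    size-Λ : size Λ ≡ A - 1ℚ
    size-Λ = trans (∑-cong (λ z → [∧] (x ~ z) (y ~ z))) (common-adjacent x y x~y)

    x~ : ∀ {z} → Λ z ≡ true → (x ~ z) ≡ true
    x~ {z} h = proj₁ (∧-true {x ~ z} h)

    y~ : ∀ {z} → Λ z ≡ true → (y ~ z) ≡ true
    y~ {z} h = proj₂ (∧-true {x ~ z} h)

    -- Since `y` is adjacent to all of `Λ`, the form pairs `δ` and `w` to W. The vector -Wδ + mw is
    -- the combination orthogonal to `y`, and its form is m times the difference of the two sides.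
    Λ-psd : ∀ w → Supported Λ w → ∑ w * ∑ w ≤ m * bil e w w
    Λ-psd w supp = 0≤q-p⇒p≤q (0≤*-cancel 0<m (subst (0ℚ ≤_) rearrange (local-psd x test test-supported)))
      where
      W = ∑ w
      δ : V → ℚ
      δ z = [ y == z ]
      test : V → ℚ
      test z = - W * δ z + m * w z
      test-supported : Supported (x ~_) test
      test-supported z = by (y == z) refl (supp z)
        where
        zeros : ∀ p m → - p * 0ℚ + m * 0ℚ ≡ 0ℚ
        zeros = solve-∀ ℚ-ring
        by : ∀ i → (y == z) ≡ i → w z ≡ 0ℚ ⊎ Λ z ≡ true → test z ≡ 0ℚ ⊎ (x ~ z) ≡ true
        by true  p _         = inj₂ (subst (λ i → (x ~ i) ≡ true) (==⇒≡ p) x~y)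
        by false p (inj₂ h)  = inj₂ (x~ h)
        by false p (inj₁ wz) = inj₁ (trans (cong₂ (λ i j → - W * [ i ] + m * j) p wz) (zeros W m))
      δδ : bil e δ δ ≡ m
      δδ = trans (bil-δˡ y δ) (trans (∑-δ y (e y)) (trans (e-value (==-refl y) (~-irrefl y)) (simplify m)))
        where
        simplify : ∀ m → m * 1ℚ + 0ℚ ≡ m
        simplify = solve-∀ ℚ-ring
      δw : bil e δ w ≡ W
      δw = trans (bil-δˡ y w) (∑-cong pointwise)
        where
        one : ∀ m → m * 0ℚ + 1ℚ ≡ 1ℚ
        one = solve-∀ ℚ-ring
        pointwise : ∀ z → w z * e y z ≡ w z
        pointwise z = by (supp z)
          where
          by : w z ≡ 0ℚ ⊎ Λ z ≡ true → w z * e y z ≡ w z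
          by (inj₁ wz) = trans (cong (_* e y z) wz) (trans (*-zeroˡ (e y z)) (sym wz))
          by (inj₂ h)  = trans (cong (w z *_) (trans (e-value (≢⇒== (~⇒≢ (y~ h))) (y~ h)) (one m))) (*-identityʳ (w z))
      rearrange : bil e test test ≡ m * (m * bil e w w - W * W)
      rearrange = trans (bil-expand e-sym (- W) m δ w)
        (trans (cong₂ (λ i j → - W * - W * i + 2ℚ * (- W * m) * j + m * m * bil e w w) δδ δw)
          (collect W m (bil e w w)))
        where
        collect : ∀ W m F → - W * - W * m + (1ℚ + 1ℚ) * (- W * m) * W + m * m * F ≡ m * (m * F - W * W)
        collect = solve-∀ ℚ-ring

    -- Of the c₂ common neighbours of two vertices at distance two, `x` and `y` are two that lie
    -- outside `Λ`.
    common-Λ : ∀ z w → Λ z ≡ true → Λ w ≡ true → z ≢ w → (z ~ w) ≡ false →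
      ∑ (λ v → [ Λ v ] * ([ z ~ v ] * [ w ~ v ])) ≤ ν
    common-Λ z w Λz Λw z≢w z≁w = ≤-by (shift (c 2) _) (0≤q-p (subst₂ _≤_ left right (∑-mono pointwise)))
      where
      shift : ∀ c s → c - 1ℚ - 1ℚ - s ≡ c - (s + 1ℚ + 1ℚ)
      shift = solve-∀ ℚ-ring
      S = ∑ (λ v → [ Λ v ] * ([ z ~ v ] * [ w ~ v ]))
      left : ∑ (λ v → [ Λ v ] * ([ z ~ v ] * [ w ~ v ]) + [ x == v ] + [ y == v ]) ≡
             S + 1ℚ + 1ℚ
      left = trans (∑-+ _ _) (cong₂ _+_ (trans (∑-+ _ _) (cong (λ i → S + i) (∑-== x))) (∑-== y))
      right : common z w ≡ c 2
      right = common-distance-two z w (distance-two x z w (x~ Λz) (x~ Λw) z≢w z≁w)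
      at : ∀ v {i j k} → (x == v) ≡ i → (y == v) ≡ j → Λ v ≡ k → [ Λ v ] * ([ z ~ v ] * [ w ~ v ]) + [ x == v ] + [ y == v ]
           ≡ [ k ] * ([ z ~ v ] * [ w ~ v ]) + [ i ] + [ j ]
      at v p r s = cong₂ _+_ (cong₂ (λ i k → [ k ] * ([ z ~ v ] * [ w ~ v ]) + [ i ]) p s) (cong [_] r)
      adjacent : ∀ {u v} → (u ~ z) ≡ true → (u ~ w) ≡ true → u ≡ v → [ z ~ v ] * [ w ~ v ] ≡ 1ℚ
      adjacent {u} p r refl = cong₂ (λ i j → [ i ] * [ j ]) (trans (~-sym z u) p) (trans (~-sym w u) r)
      endpoint : ∀ k → 0ℚ * k + 1ℚ + 0ℚ ≡ 1ℚ
      endpoint = solve-∀ ℚ-ring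
      endpoint′ : ∀ k → 0ℚ * k + 0ℚ + 1ℚ ≡ 1ℚ
      endpoint′ = solve-∀ ℚ-ring
      inner : ∀ k → 1ℚ * k + 0ℚ + 0ℚ ≡ k
      inner = solve-∀ ℚ-ring
      outer : ∀ k → 0ℚ * k + 0ℚ + 0ℚ ≡ 0ℚ
      outer = solve-∀ ℚ-ring
      Λx : Λ x ≡ false
      Λx = cong (_∧ (y ~ x)) (~-irrefl x)
      Λy : Λ y ≡ false
      Λy = trans (cong ((x ~ y) ∧_) (~-irrefl y)) (BoolP.∧-zeroʳ (x ~ y))
      pointwise : ∀ v → [ Λ v ] * ([ z ~ v ] * [ w ~ v ]) + [ x == v ] + [ y == v ] ≤ [ z ~ v ] * [ w ~ v ]
      pointwise v = by (x == v) (y == v) (Λ v) refl refl refl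
        where
        K = [ z ~ v ] * [ w ~ v ]
        by : ∀ i j k → (x == v) ≡ i → (y == v) ≡ j → Λ v ≡ k → [ Λ v ] * K + [ x == v ] + [ y == v ] ≤ K
        by false false true  p r s = ≤-reflexive (trans (at v p r s) (inner K))
        by false false false p r s = subst (_≤ K) (sym (trans (at v p r s) (outer K))) (0≤* (0≤[] (z ~ v)) (0≤[] (w ~ v)))
        by true  false false p r s = ≤-reflexive (trans (at v p r s) (trans (endpoint K)
          (sym (adjacent (x~ Λz) (x~ Λw) (==⇒≡ p)))))
        by false true  false p r s = ≤-reflexive (trans (at v p r s) (trans (endpoint′ K)
          (sym (adjacent (y~ Λz) (y~ Λw) (==⇒≡ r)))))
        by true  true  _     p r s = contradiction (trans (==⇒≡ p) (sym (==⇒≡ r))) (~⇒≢ x~y)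
        by true  false true  p r s = ⊥-elim (true≢false s (trans (cong Λ (sym (==⇒≡ p))) Λx))
        by false true  true  p r s = ⊥-elim (true≢false s (trans (cong Λ (sym (==⇒≡ r))) Λy))

    degree : (V → Bool) → V → ℚ
    degree P z = ∑ (λ v → [ P v ] * [ z ~ v ])

    indicator-supported-⊆ : ∀ {P} → P ⊆ Λ → Supported Λ (λ z → [ P z ])
    indicator-supported-⊆ {P} P⊆Λ z = map₂ (P⊆Λ z) (indicator-supported P z)

    -- At the indicator of `P`, each row of `e` contributes at most m + M, so `Λ-psd` reads |P|² ≤
    -- m|P|(m + M).
    sparse-bound : ∀ P M → 0ℚ ≤ M → P ⊆ Λ → (∀ z → P z ≡ true → degree P z ≤ M) → size P ≤ m * (m + M)
    sparse-bound P M 0≤M P⊆Λ sparse = by-size (0ℚ <? size P)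
      where
      row : ∀ z → ∑ (λ v → [ P v ] * e z v) ≡ m * [ P z ] + degree P z
      row z = trans (∑-cong (λ v → spread [ P v ] m [ z == v ] [ z ~ v ]))
        (trans (∑-+ _ _) (cong (_+ degree P z) (trans (∑-*ˡ m _) (cong (m *_) (∑-δ z (λ v → [ P v ]))))))
        where
        spread : ∀ p m i j → p * (m * i + j) ≡ m * (i * p) + p * j
        spread = solve-∀ ℚ-ring
      pointwise : ∀ z → [ P z ] * ∑ (λ v → [ P v ] * e z v) ≤ [ P z ] * (m + M)
      pointwise z = guard-mono (P z) λ Pz → subst (_≤ m + M) (sym (trans (row z) (cong (λ i → m * [ i ] + degree P z) Pz)))
        (subst (λ i → i + degree P z ≤ m + M) (sym (*-identityʳ m)) (+-monoʳ-≤ m (sparse z Pz)))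
      form : bil e (λ z → [ P z ]) (λ z → [ P z ]) ≤ size P * (m + M)
      form = subst₂ _≤_ (sym (bil-row e _ _)) (∑-*ʳ (m + M) _) (∑-mono pointwise)
      squared : size P * size P ≤ size P * (m * (m + M))
      squared = ≤-trans (Λ-psd _ (indicator-supported-⊆ P⊆Λ))
        (≤-trans (*-monoˡ-≤-nonNeg m {{nonNegative (<⇒≤ 0<m)}} form) (≤-reflexive (swap m (size P) (m + M))))
        where
        swap : ∀ m s p → m * (s * p) ≡ s * (m * p)
        swap = solve-∀ ℚ-ring
      by-size : Dec (0ℚ < size P) → size P ≤ m * (m + M)
      by-size (yes 0<s) = *-cancelˡ-≤-pos (size P) {{positive 0<s}} squared
      by-size (no s≮0) = ≤-trans (≮⇒≥ s≮0) (0≤* (<⇒≤ 0<m) (0≤+ (<⇒≤ 0<m) 0≤M))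

    private-neighbours : (V → Bool) → (V → Bool) → V → V → Bool
    private-neighbours X S z v = X v ∧ ((z ~ v) ∧ not (some (λ z′ → remove z S z′ ∧ (z′ ~ v))))

    module _ {X S : V → Bool} {z v : V} (h : private-neighbours X S z v ≡ true) where

      private-X : X v ≡ true
      private-X = proj₁ (∧-true {X v} h)

      private-~ : (z ~ v) ≡ true
      private-~ = proj₁ (∧-true {z ~ v} (proj₂ (∧-true {X v} h)))

      private-≁ : ∀ z′ → S z′ ≡ true → z ≢ z′ → (z′ ~ v) ≡ false
      private-≁ z′ Sz′ z≢z′ = subst (λ i → i ∧ (z′ ~ v) ≡ false) (cong₂ (λ i j → i ∧ not j) Sz′ (≢⇒== z≢z′))
        (some-false (λ z′ → remove z S z′ ∧ (z′ ~ v))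
          (not-true (proj₂ (∧-true {z ~ v} (proj₂ (∧-true {X v} h))))) z′)
        where
        not-true : ∀ {i} → not i ≡ true → i ≡ false
        not-true {false} _ = refl

    -- A neighbour of `z` in `X` that is not private is shared with one of the |S| - 1 other members
    -- of `S`, and by `common-Λ` each of these shares at most ν.
    private-bound : ∀ X S z → X ⊆ Λ → S ⊆ Λ → Independent S → S z ≡ true →
      degree X z ≤ size (private-neighbours X S z) + ν * (size S - 1ℚ)
    private-bound X S z X⊆Λ S⊆Λ indep Sz = ≤-trans (∑-mono pointwise)
      (subst (_≤ size P + ν * (size S - 1ℚ)) (sym (∑-+ _ T)) (+-monoʳ-≤ (size P) shared))
      where
      P = private-neighbours X S z
      R = remove z S
      T : V → ℚ
      T v = ∑ (λ z′ → [ R z′ ] * ([ X v ] * ([ z ~ v ] * [ z′ ~ v ])))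
      0≤term : ∀ v z′ → 0ℚ ≤ [ R z′ ] * ([ X v ] * ([ z ~ v ] * [ z′ ~ v ]))
      0≤term v z′ = 0≤* (0≤[] (R z′)) (0≤* (0≤[] (X v)) (0≤* (0≤[] (z ~ v)) (0≤[] (z′ ~ v))))
      shared : ∑ T ≤ ν * (size S - 1ℚ)
      shared = subst₂ _≤_ (sym (∑-comm _)) (trans (∑-*ʳ ν _) (trans (cong (_* ν) (size-remove z S Sz)) (*-comm (size S - 1ℚ) ν)))
        (∑-mono λ z′ → subst (_≤ [ R z′ ] * ν) (sym (∑-*ˡ [ R z′ ] _)) (guard-mono (R z′) (λ h → pair z′ (remove-elim z S z′ h))))
        where
        pair : ∀ z′ → S z′ ≡ true × z ≢ z′ → ∑ (λ v → [ X v ] * ([ z ~ v ] * [ z′ ~ v ])) ≤ ν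
        pair z′ (Sz′ , z≢z′) = ≤-trans (∑-mono λ v → *-monoʳ-≤-nonNeg ([ z ~ v ] * [ z′ ~ v ])
            {{nonNegative (0≤* (0≤[] (z ~ v)) (0≤[] (z′ ~ v)))}} (indicator-mono X⊆Λ v))
          (common-Λ z z′ (S⊆Λ z Sz) (S⊆Λ z′ Sz′) z≢z′ (indep z z′ Sz Sz′))
      pointwise : ∀ v → [ X v ] * [ z ~ v ] ≤ [ P v ] + T v
      pointwise v = by (X v) (z ~ v) (some (λ z′ → R z′ ∧ (z′ ~ v))) refl refl refl
        where
        0≤T : 0ℚ ≤ T v
        0≤T = 0≤∑ (0≤term v)
        trivial : [ X v ] * [ z ~ v ] ≡ 0ℚ → [ X v ] * [ z ~ v ] ≤ [ P v ] + T v
        trivial h = subst (_≤ [ P v ] + T v) (sym h) (0≤+ (0≤[] (P v)) 0≤T)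
        by : ∀ i j k → X v ≡ i → (z ~ v) ≡ j → some (λ z′ → R z′ ∧ (z′ ~ v)) ≡ k →
             [ X v ] * [ z ~ v ] ≤ [ P v ] + T v
        by false j _ p r _ = trivial (trans (cong (λ i → [ i ] * [ z ~ v ]) p) (*-zeroˡ [ z ~ v ]))
        by true false _ p r _ = trivial (cong₂ (λ i j → [ i ] * [ j ]) p r)
        by true true false p r s = ≤-by (shift (T v)) 0≤T
          where
          one : [ P v ] ≡ 1ℚ
          one = cong [_] (cong₂ _∧_ p (cong₂ (λ i j → i ∧ not j) r s))
          product : [ X v ] * [ z ~ v ] ≡ 1ℚ
          product = cong₂ (λ i j → [ i ] * [ j ]) p r
          shift′ : ∀ t → 1ℚ + t - 1ℚ ≡ t
          shift′ = solve-∀ ℚ-ring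
          shift : ∀ t → [ P v ] + t - [ X v ] * [ z ~ v ] ≡ t
          shift t = trans (cong₂ (λ i j → i + t - j) one product) (shift′ t)
        by true true true p r s = witness (some-true (λ z′ → R z′ ∧ (z′ ~ v)) s)
          where
          witness : (∃ λ z′ → R z′ ∧ (z′ ~ v) ≡ true) → [ X v ] * [ z ~ v ] ≤ [ P v ] + T v
          witness (z′ , h) = ≤-trans (≤-reflexive equal) (≤-trans (∑-term z′ (0≤term v))
              (subst (_≤ [ P v ] + T v) (+-identityˡ (T v)) (+-monoˡ-≤ (T v) (0≤[] (P v)))))
           where
           equal : [ X v ] * [ z ~ v ] ≡ [ R z′ ] * ([ X v ] * ([ z ~ v ] * [ z′ ~ v ]))
           equal = trans (cong₂ (λ i j → [ i ] * [ j ]) p r) (sym (cong₂ _*_ (cong [_] (proj₁ (∧-true {R z′} h)))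
            (cong₂ _*_ (cong [_] p) (cong₂ (λ i j → [ i ] * [ j ]) r (proj₂ (∧-true {R z′} h))))))

    -- The threshold for a large degree. Among m + 1 independent vertices at most mν neighbours of
    -- each are shared, so at least m²μ private ones remain.
    q′ : ℚ
    q′ = m * m * μ + m * ν

    -- m + 1 pairwise non-adjacent vertices of large degree have m + 1 almost disjoint
    -- private neighbourhoods, and the sum of their indicators violates Λ-psd.
    module Crowded (S : V → Bool) (S⊆Λ : S ⊆ Λ) (indep : Independent S) (size-S : size S ≡ m + 1ℚ)
                   (heavy : ∀ z → S z ≡ true → q′ ≤ degree Λ z) where

      -- The private neighbourhoods are cut down to the same size R = m²μ. That size must be a
      -- natural number, which is why c₂ - 1 is given as the natural number `μ₀`.
      k : ℕ
      k = suc b ℕ.* suc b ℕ.* μ₀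

      R : ℚ
      R = m * m * μ

      ι-m : ℕ→ℚ (suc b) ≡ m
      ι-m = trans (ι-suc b) (+-comm 1ℚ q)

      μ-μ₀ : μ ≡ ℕ→ℚ μ₀
      μ-μ₀ = trans (cong (_- 1ℚ) c₂-μ₀) (cancel (ℕ→ℚ μ₀))
        where
        cancel : ∀ p → 1ℚ + p - 1ℚ ≡ p
        cancel = solve-∀ ℚ-ring

      R-k : R ≡ ℕ→ℚ k
      R-k = sym (trans (ι-* (suc b ℕ.* suc b) μ₀)
        (cong₂ _*_ (trans (ι-* (suc b) (suc b)) (cong₂ _*_ ι-m ι-m)) (sym μ-μ₀)))

      large : ∀ z → S z ≡ true → k ℕ.≤ count (private-neighbours Λ S z)
      large z Sz = ι-cancel-≤ (subst₂ _≤_ R-k (size-count (private-neighbours Λ S z))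
        (≤-by (shift (size (private-neighbours Λ S z)) (m * m * μ) m ν (degree Λ z))
          (0≤+ (0≤q-p (subst (λ i → degree Λ z ≤ size (private-neighbours Λ S z) + ν * (i - 1ℚ)) size-S
                        (private-bound Λ S z (λ _ p → p) S⊆Λ indep Sz)))
               (0≤q-p (heavy z Sz)))))
        where
        shift : ∀ p r m ν d → p - r ≡ (p + ν * (m + 1ℚ - 1ℚ) - d) + (d - (r + m * ν))
        shift = solve-∀ ℚ-ring

      choice : ∀ z → ∃ λ Q → Q ⊆ private-neighbours Λ S z × (S z ≡ true → size Q ≡ R)
      choice z = by (S z) refl
        where
        exact : (∃ λ Q → Q ⊆ private-neighbours Λ S z × count Q ≡ k) →
                ∃ λ Q → Q ⊆ private-neighbours Λ S z × (S z ≡ true → size Q ≡ R)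
        exact (Q , Q⊆ , eq) = Q , Q⊆ , λ _ → trans (size-count Q) (trans (cong ℕ→ℚ eq) (sym R-k))
        by : ∀ i → S z ≡ i → ∃ λ Q → Q ⊆ private-neighbours Λ S z × (S z ≡ true → size Q ≡ R)
        -- Any subset will do for a centre outside `S`, as the sum `w` weights it by zero.
        by false h = (λ _ → false) , (λ _ ()) , (λ h′ → ⊥-elim (true≢false h′ h))
        by true h = exact (shrink (private-neighbours Λ S z) k (large z h))

      P : V → V → Bool
      P z = proj₁ (choice z)

      P⊆ : ∀ z → P z ⊆ private-neighbours Λ S z
      P⊆ z = proj₁ (proj₂ (choice z))

      size-P : ∀ z → S z ≡ true → size (P z) ≡ R
      size-P z = proj₂ (proj₂ (choice z))

      P⊆Λ : ∀ z → P z ⊆ Λ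
      P⊆Λ z v h = private-X {Λ} {S} {z} {v} (P⊆ z v h)

      f : V → V → ℚ
      f z v = [ P z v ]

      G : V → V → ℚ
      G z z′ = bil e (f z) (f z′)

      -- The form is largest when the set is a clique, where it equals mR + R(R - 1).
      G-diagonal : ∀ z → S z ≡ true → G z z ≤ R * (R + q)
      G-diagonal z Sz = subst (G z z ≤_) (trans (bil-two-valued 1ℚ m (f z))
        (trans (cong₂ (λ i j → 1ℚ * (i * i) + (m - 1ℚ) * j) (size-P z Sz)
                  (trans (∑-cong (λ v → []² (P z v))) (size-P z Sz))) (collect R q)))
        (bil-mono (λ v → 0≤[] (P z v)) (λ v → 0≤[] (P z v)) λ v v′ → two-valued-≤ {K = e} {1ℚ} {m} v v′
          (λ v≡v′ → ≤-reflexive (trans (e-value (subst (λ i → (v == i) ≡ true) v≡v′ (==-refl v))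
            (subst (λ i → (v ~ i) ≡ false) v≡v′ (~-irrefl v))) (same m)))
          (λ v≢v′ → ≤-trans (≤-reflexive (trans (e-value (≢⇒== v≢v′) refl) (different m [ v ~ v′ ]))) ([]≤1 (v ~ v′))))
        where
        collect : ∀ R q → 1ℚ * (R * R) + (q + 1ℚ - 1ℚ) * R ≡ R * (R + q)
        collect = solve-∀ ℚ-ring
        same : ∀ m → m * 1ℚ + 0ℚ ≡ m
        same = solve-∀ ℚ-ring
        different : ∀ m i → m * 0ℚ + i ≡ i
        different = solve-∀ ℚ-ring

      -- A vertex v of the first set is private to `z`, hence not adjacent to `z′`. Its neighbours
      -- in the second set are common neighbours of v and `z′` in `Λ`, at most ν in number.
      G-cross : ∀ z z′ → S z ≡ true → S z′ ≡ true → z ≢ z′ → G z z′ ≤ R * ν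
      G-cross z z′ Sz Sz′ z≢z′ = subst₂ _≤_ (sym (bil-row e (f z) (f z′)))
        (trans (∑-*ʳ ν (f z)) (cong (_* ν) (size-P z Sz))) (∑-mono λ v → guard-mono (P z v) (row v))
        where
        row : ∀ v → P z v ≡ true → ∑ (λ v′ → f z′ v′ * e v v′) ≤ ν
        row v Pzv = ≤-trans (∑-mono entry) (common-Λ v z′ (P⊆Λ z v Pzv) (S⊆Λ z′ Sz′) v≢z′ (trans (~-sym v z′) z′≁v))
          where
          z′≁v : (z′ ~ v) ≡ false
          z′≁v = private-≁ {Λ} {S} {z} {v} (P⊆ z v Pzv) z′ Sz′ z≢z′
          v≢z′ : v ≢ z′
          v≢z′ v≡z′ = true≢false (subst (λ i → (z ~ i) ≡ true) v≡z′ (private-~ {Λ} {S} {z} {v} (P⊆ z v Pzv)))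
            (indep z z′ Sz Sz′)
          simplify : ∀ m i → m * 0ℚ + i ≡ i * 1ℚ
          simplify = solve-∀ ℚ-ring
          entry : ∀ v′ → f z′ v′ * e v v′ ≤ [ Λ v′ ] * ([ v ~ v′ ] * [ z′ ~ v′ ])
          entry v′ = ≤-trans (≤-reflexive (guard-cong (P z′ v′) adjacency))
            (*-monoʳ-≤-nonNeg ([ v ~ v′ ] * [ z′ ~ v′ ]) {{nonNegative (0≤* (0≤[] (v ~ v′)) (0≤[] (z′ ~ v′)))}}
              (indicator-mono (P⊆Λ z′) v′))
            where
            adjacency : P z′ v′ ≡ true → e v v′ ≡ [ v ~ v′ ] * [ z′ ~ v′ ]
            adjacency h = trans (e-value (≢⇒== v≢v′) refl)
              (trans (simplify m [ v ~ v′ ]) (cong (λ i → [ v ~ v′ ] * [ i ]) (sym z′~v′)))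
              where
              z′~v′ : (z′ ~ v′) ≡ true
              z′~v′ = private-~ {Λ} {S} {z′} {v′} (P⊆ z′ v′ h)
              v≢v′ : v ≢ v′
              v≢v′ v≡v′ = true≢false (subst (λ i → (z′ ~ i) ≡ true) (sym v≡v′) z′~v′) z′≁v

      s : V → ℚ
      s z = [ S z ]

      w : V → ℚ
      w v = ∑ (λ z → s z * f z v)

      w-supported : Supported Λ w
      w-supported v = by (Λ v) refl
        where
        by : ∀ i → Λ v ≡ i → w v ≡ 0ℚ ⊎ Λ v ≡ true
        by true  h = inj₂ h
        by false h = inj₁ (∑-zero λ z → trans (cong (λ i → s z * [ i ]) (BoolP.¬-not λ p → true≢false (P⊆Λ z v p) h))
                             (*-zeroʳ (s z)))

      ∑w : ∑ w ≡ (m + 1ℚ) * R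
      ∑w = trans (∑-comm _) (trans (∑-cong λ z → trans (∑-*ˡ (s z) (f z)) (guard-cong (S z) (size-P z)))
             (trans (∑-*ʳ R s) (cong (_* R) size-S)))

      form : bil e w w ≤ R * ν * ((m + 1ℚ) * (m + 1ℚ)) + (R * (R + q) - R * ν) * (m + 1ℚ)
      form = subst₂ _≤_ (trans (sym (bil-def G s s)) (sym (bil-∑ e s f)))
        (trans (sym (bil-def _ s s)) (trans (bil-two-valued (R * ν) (R * (R + q)) s)
          (cong₂ (λ i j → R * ν * i + (R * (R + q) - R * ν) * j) (cong₂ _*_ size-S size-S)
            (trans (∑-cong (λ z → []² (S z))) size-S))))
        (∑-mono λ z → ∑-mono λ z′ → entry z z′)
        where
        L : V → V → ℚ
        L z z′ = R * ν * 1ℚ + (R * (R + q) - R * ν) * [ z == z′ ]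
        entry : ∀ z z′ → s z * s z′ * G z z′ ≤ s z * s z′ * L z z′
        entry z z′ = subst₂ _≤_ (sym (*-assoc (s z) (s z′) (G z z′))) (sym (*-assoc (s z) (s z′) (L z z′)))
          (guard-mono (S z) λ Sz → guard-mono (S z′) λ Sz′ → two-valued-≤ {K = G} {R * ν} {R * (R + q)} z z′
            (λ z≡z′ → subst (λ i → G z i ≤ R * (R + q)) z≡z′ (G-diagonal z Sz))
            (G-cross z z′ Sz Sz′))

      -- Divided by R(m + 1), the inequality from `Λ-psd` becomes R ≤ m²ν + mq. For R = m²μ the
      -- right side is R - m.
      absurd : 0ℚ < μ → ⊥
      absurd 0<μ = <-irrefl refl (<-≤-trans gain (≤-by (negate (R * (m + 1ℚ) * m))
          (subst (0ℚ ≤_) (trans (collect m q R μ) (simplify q μ (R * (m + 1ℚ)))) squared)))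
        where
        squared : 0ℚ ≤ m * (R * ν * ((m + 1ℚ) * (m + 1ℚ)) + (R * (R + q) - R * ν) * (m + 1ℚ))
                       - (m + 1ℚ) * R * ((m + 1ℚ) * R)
        squared = 0≤q-p (≤-trans (subst (λ i → i * i ≤ m * bil e w w) ∑w (Λ-psd w w-supported))
                    (*-monoˡ-≤-nonNeg m {{nonNegative (<⇒≤ 0<m)}} form))
        gain : 0ℚ < R * (m + 1ℚ) * m
        gain = 0<* (0<* (0<* (0<* 0<m 0<m) 0<μ) (0<+ 0<m 0≤1)) 0<m
        collect : ∀ m q R μ → m * (R * (μ - 1ℚ) * ((m + 1ℚ) * (m + 1ℚ)) + (R * (R + q) - R * (μ - 1ℚ)) * (m + 1ℚ))
            - (m + 1ℚ) * R * ((m + 1ℚ) * R) ≡ R * (m + 1ℚ) * (m * m * (μ - 1ℚ) + m * q - R)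
        collect = solve-∀ ℚ-ring
        simplify : ∀ q μ x → x * ((q + 1ℚ) * (q + 1ℚ) * (μ - 1ℚ) + (q + 1ℚ) * q - (q + 1ℚ) * (q + 1ℚ) * μ) ≡
          - (x * (q + 1ℚ))
        simplify = solve-∀ ℚ-ring
        negate : ∀ x → 0ℚ - x ≡ - x
        negate = solve-∀ ℚ-ring

    module Extremal (0<μ : 0ℚ < μ) (0≤ν : 0ℚ ≤ ν) (M : ℚ) (clique≤M : ∀ C → IsClique C → size C ≤ M)
                    (heavy : V → Bool) (heavy-degree : ∀ z → heavy z ≡ true → q′ ≤ degree Λ z)
                    (light-degree : ∀ z → heavy z ≡ false → degree Λ z ≤ q′) where

      H light : V → Bool
      H z     = Λ z ∧ heavy z
      light z = Λ z ∧ not (heavy z)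

      H⊆Λ : H ⊆ Λ
      H⊆Λ z h = proj₁ (∧-true {Λ z} h)

      size-split : size Λ ≡ size H + size light
      size-split = trans (∑-cong λ z → split (Λ z) (heavy z)) (∑-+ _ _)
        where
        split : ∀ i j → [ i ] ≡ [ i ∧ j ] + [ i ∧ not j ]
        split false _     = refl
        split true  true  = refl
        split true  false = refl

      0≤q′ : 0ℚ ≤ q′
      0≤q′ = 0≤+ (0≤* (0≤* (<⇒≤ 0<m) (<⇒≤ 0<m)) (<⇒≤ 0<μ)) (0≤* (<⇒≤ 0<m) 0≤ν)

      light⊆Λ : light ⊆ Λ
      light⊆Λ z h = proj₁ (∧-true {Λ z} h)

      light-size : size light ≤ m * (m + q′)
      light-size = sparse-bound light q′ 0≤q′ light⊆Λ λ z h →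
        ≤-trans (∑-mono λ v → *-monoʳ-≤-nonNeg [ z ~ v ] {{nonNegative (0≤[] (z ~ v))}} (indicator-mono light⊆Λ v))
                (light-degree z (BoolP.not-injective (proj₂ (∧-true {Λ z} h))))

      Family : (V → Bool) → Set
      Family S = S ⊆ H × Independent S

      family-size : ∀ S → Family S → size S ≤ m
      family-size S (S⊆H , indep) = by (count S ℕ.≤? suc b)
        where
        crowded : (∃ λ S′ → S′ ⊆ S × count S′ ≡ suc (suc b)) → ⊥
        crowded (S′ , S′⊆S , eq) = Crowded.absurd S′ (λ z p → H⊆Λ z (S⊆H z (S′⊆S z p)))
              (λ u v p r → indep u v (S′⊆S u p) (S′⊆S v r))
              (trans (size-count S′) (trans (cong ℕ→ℚ eq) (trans (ι-suc (suc b))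
                (trans (cong (λ i → 1ℚ + i) (trans (ι-suc b) (+-comm 1ℚ q))) (+-comm 1ℚ m)))))
              (λ z p → heavy-degree z (proj₂ (∧-true {Λ z} (S⊆H z (S′⊆S z p))))) 0<μ
        by : Dec (count S ℕ.≤ suc b) → size S ≤ m
        by (yes h) = subst₂ _≤_ (sym (size-count S)) (trans (ι-suc b) (+-comm 1ℚ q)) (ι-mono h)
        by (no h)  = ⊥-elim (crowded (shrink S (suc (suc b)) (ℕP.≰⇒> h)))

      -- By maximality of S a private neighbourhood is a clique: otherwise two of its
      -- vertices could replace their centre.
      module Largest (S : V → Bool) (S⊆H : S ⊆ H) (indep : Independent S)
                     (maximum : ∀ T → Family T → size T ≤ size S) where

        grow : ∀ {T} → Family T → size T ≡ size S + 1ℚ → ⊥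
        grow {T} FT eq = <-irrefl refl (<-≤-trans (<-by (cancel (size S)) 0<1) (subst (_≤ size S) eq (maximum T FT)))
          where
          cancel : ∀ p → p + 1ℚ - p ≡ 1ℚ
          cancel = solve-∀ ℚ-ring

        insert-family : ∀ {T u} → Family T → H u ≡ true → (∀ v → T v ≡ true → (v ~ u) ≡ false) → Family (insert u T)
        insert-family {T} {u} (T⊆H , T-indep) Hu apart =
          (λ z h → sub (insert-elim u T z h)) ,
          (λ v w p r → ind (insert-elim u T v p) (insert-elim u T w r))
          where
          sub : ∀ {z} → T z ≡ true ⊎ u ≡ z → H z ≡ true
          sub {z} (inj₁ Tz) = T⊆H z Tz
          sub (inj₂ u≡z)    = subst (λ i → H i ≡ true) u≡z Hu
          ind : ∀ {v w} → T v ≡ true ⊎ u ≡ v → T w ≡ true ⊎ u ≡ w → (v ~ w) ≡ false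
          ind {v} {w} (inj₁ Tv)  (inj₁ Tw)  = T-indep v w Tv Tw
          ind {v}     (inj₁ Tv)  (inj₂ u≡w) = subst (λ i → (v ~ i) ≡ false) u≡w (apart v Tv)
          ind {v} {w} (inj₂ u≡v) (inj₁ Tw)  = trans (~-sym v w) (subst (λ i → (w ~ i) ≡ false) u≡v (apart w Tw))
          ind {v} {w} (inj₂ u≡v) (inj₂ u≡w) = trans (cong₂ _~_ (sym u≡v) (sym u≡w)) (~-irrefl u)

        -- Otherwise `u` could be added to the largest family `S`.
        dominated : ∀ u → H u ≡ true → ∃ λ z → S z ≡ true × (z ≡ u ⊎ (z ~ u) ≡ true)
        dominated u Hu = by (S u) refl (find (λ z → S z ∧ (z ~ u)))
          where
          apart : (∀ z → S z ∧ (z ~ u) ≡ false) → ∀ z → S z ≡ true → (z ~ u) ≡ false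
          apart none z Sz = trans (cong (_∧ (z ~ u)) (sym Sz)) (none z)
          by : ∀ i → S u ≡ i → (∃ λ z → S z ∧ (z ~ u) ≡ true) ⊎ (∀ z → S z ∧ (z ~ u) ≡ false) →
               ∃ λ z → S z ≡ true × (z ≡ u ⊎ (z ~ u) ≡ true)
          by true  Su _              = u , Su , inj₁ refl
          by false _  (inj₁ (z , h)) = z , proj₁ (∧-true {S z} h) , inj₂ (proj₂ (∧-true {S z} h))
          by false Su (inj₂ none)    = ⊥-elim (grow (insert-family (S⊆H , indep) Hu (apart none)) (size-insert u S Su))

        K : V → V → Bool
        K = private-neighbours H S

        module _ {z : V} (Sz : S z ≡ true) where

          K-clique : IsClique (K z)
          K-clique v w Kv Kw v≢w = BoolP.¬-not λ v≁w → grow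
            (insert-family (insert-family removed (private-X {H} {S} {z} {v} Kv) (apart v Kv))
              (private-X {H} {S} {z} {w} Kw) (apart₂ v≁w))
            (trans (size-insert w (insert v (remove z S)) w∉) (trans (cong (_+ 1ℚ) (trans (size-insert v (remove z S) (outside v Kv))
              (cong (_+ 1ℚ) (size-remove z S Sz)))) (recount (size S))))
            where
            recount : ∀ p → p - 1ℚ + 1ℚ + 1ℚ ≡ p + 1ℚ
            recount = solve-∀ ℚ-ring
            removed : Family (remove z S)
            removed = (λ u h → S⊆H u (proj₁ (remove-elim z S u h))) ,
                      (λ u u′ h h′ → indep u u′ (proj₁ (remove-elim z S u h)) (proj₁ (remove-elim z S u′ h′)))
            apart : ∀ v → K z v ≡ true → ∀ u → remove z S u ≡ true → (u ~ v) ≡ false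
            apart v Kv u h = private-≁ {H} {S} {z} {v} Kv u (proj₁ (remove-elim z S u h)) (proj₂ (remove-elim z S u h))
            outside : ∀ v → K z v ≡ true → remove z S v ≡ false
            outside v Kv = BoolP.¬-not λ h → true≢false (private-~ {H} {S} {z} {v} Kv)
              (indep z v Sz (proj₁ (remove-elim z S v h)))
            apart₂ : (v ~ w) ≡ false → ∀ u → insert v (remove z S) u ≡ true → (u ~ w) ≡ false
            apart₂ v≁w u h = by (insert-elim v (remove z S) u h)
              where
              by : remove z S u ≡ true ⊎ v ≡ u → (u ~ w) ≡ false
              by (inj₁ h′)  = apart w Kw u h′
              by (inj₂ v≡u) = subst (λ i → (i ~ w) ≡ false) v≡u v≁w
            w∉ : insert v (remove z S) w ≡ false
            w∉ = BoolP.¬-not λ h → clash (insert-elim v (remove z S) w h)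
              where
              clash : remove z S w ≡ true ⊎ v ≡ w → ⊥
              clash (inj₁ h)   = true≢false h (outside w Kw)
              clash (inj₂ v≡w) = v≢w v≡w

          Λz : Λ z ≡ true
          Λz = H⊆Λ z (S⊆H z Sz)

          -- The clique `K z` remains a clique when `z` and the ends `y` and `x` of the edge are
          -- added, and these three vertices are new.
          K-size : size (K z) + 1ℚ ≤ M - 1ℚ - 1ℚ
          K-size = ≤-by (shift M (size (K z))) (0≤q-p (subst (_≤ M) enlarged-size (clique≤M enlarged enlarged-clique)))
            where
            shift : ∀ M p → M - 1ℚ - 1ℚ - (p + 1ℚ) ≡ M - (p + 1ℚ + 1ℚ + 1ℚ)
            shift = solve-∀ ℚ-ring
            K⊆Λ : K z ⊆ Λ
            K⊆Λ v h = H⊆Λ v (private-X {H} {S} {z} {v} h)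
            C₁ C₂ enlarged : V → Bool
            C₁ = insert z (K z)
            C₂ = insert y C₁
            enlarged = insert x C₂
            j₁ : ∀ v → K z v ≡ true → (z ~ v) ≡ true
            j₁ v = private-~ {H} {S} {z} {v}
            j₂ : ∀ v → C₁ v ≡ true → (y ~ v) ≡ true
            j₂ v h = by (insert-elim z (K z) v h)
              where
              by : K z v ≡ true ⊎ z ≡ v → (y ~ v) ≡ true
              by (inj₁ Kv)  = y~ (K⊆Λ v Kv)
              by (inj₂ z≡v) = subst (λ i → (y ~ i) ≡ true) z≡v (y~ Λz)
            j₃ : ∀ v → C₂ v ≡ true → (x ~ v) ≡ true
            j₃ v h = by (insert-elim y C₁ v h)
              where
              by′ : K z v ≡ true ⊎ z ≡ v → (x ~ v) ≡ true
              by′ (inj₁ Kv)  = x~ (K⊆Λ v Kv)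
              by′ (inj₂ z≡v) = subst (λ i → (x ~ i) ≡ true) z≡v (x~ Λz)
              by : C₁ v ≡ true ⊎ y ≡ v → (x ~ v) ≡ true
              by (inj₁ h′)  = by′ (insert-elim z (K z) v h′)
              by (inj₂ y≡v) = subst (λ i → (x ~ i) ≡ true) y≡v x~y
            enlarged-clique : IsClique enlarged
            enlarged-clique = clique-insert C₂ x (clique-insert C₁ y (clique-insert (K z) z K-clique j₁) j₂) j₃
            enlarged-size : size enlarged ≡ size (K z) + 1ℚ + 1ℚ + 1ℚ
            enlarged-size = trans (size-insert x C₂ (joined-fresh C₂ x j₃)) (cong (_+ 1ℚ)
              (trans (size-insert y C₁ (joined-fresh C₁ y j₂)) (cong (_+ 1ℚ) (size-insert z (K z) (joined-fresh (K z) z j₁)))))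

        -- The closed neighbourhoods of `S` cover `H`. Each consists of its centre, the private part
        -- bounded by `K-size`, and at most ν(|S| - 1) shared vertices.
        H-size : size H ≤ size S * (M - 1ℚ - 1ℚ + ν * (size S - 1ℚ))
        H-size = covering-bound H S _~_ dominated λ z Sz →
          ≤-by (shift (M - 1ℚ - 1ℚ) (ν * (size S - 1ℚ)) (degree H z) (size (K z)))
            (0≤+ (0≤q-p (K-size Sz)) (0≤q-p (private-bound H S z H⊆Λ (λ u p → H⊆Λ u (S⊆H u p)) indep Sz)))
          where
          shift : ∀ p r d k → p + r - (1ℚ + d) ≡ (p - (k + 1ℚ)) + (k + r - d)
          shift = solve-∀ ℚ-ring

      2≤M : 0ℚ ≤ M - 1ℚ - 1ℚ
      2≤M = ≤-trans (0≤q-p (subst (_≤ M) pair-size (clique≤M pair pair-clique))) (≤-reflexive (shift M))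
        where
        shift : ∀ M → M - (1ℚ + 1ℚ) ≡ M - 1ℚ - 1ℚ
        shift = solve-∀ ℚ-ring
        pair : V → Bool
        pair = insert y (x ==_)
        pair-size : size pair ≡ 1ℚ + 1ℚ
        pair-size = trans (size-insert y (x ==_) (≢⇒== (~⇒≢ x~y))) (cong (_+ 1ℚ) (∑-== x))
        pair-clique : IsClique pair
        pair-clique = clique-insert (x ==_) y (clique-singleton x)
          (λ v x≡v → trans (~-sym y v) (subst (λ i → (i ~ y) ≡ true) (==⇒≡ {i = x} {v} x≡v) x~y))

      -- Up to one, `A` is the size of `Λ`, which is split into `H` and `light`. The bound of
      -- `H-size` is replaced by its value at |S| = m, using m(m - 1) - s(s - 1) = (m - s)(q + s),
      -- and `light` contributes m(m + q′).
      a₁-bound : A ≤ m * (M - 1ℚ) + μ * (m * m * m + 2ℚ * m * m - m)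
      a₁-bound = decide (A ≤? m * (M - 1ℚ) + μ * (m * m * m + 2ℚ * m * m - m))
        where
        conclude : ∀ S → Family S → size H ≤ size S * (M - 1ℚ - 1ℚ + ν * (size S - 1ℚ)) →
                   A ≤ m * (M - 1ℚ) + μ * (m * m * m + 2ℚ * m * m - m)
        conclude S FS H≤ = ≤-by (collect A (size S) q M μ (size H) (size light))
          (0≤+ (0≤+ (0≤+ (0≤+ (0≤+ (≤-reflexive (sym total)) (0≤q-p H≤)) (0≤q-p light-size))
            (0≤* slack 2≤M)) (0≤* (0≤* 0≤ν slack) (0≤+ (<⇒≤ 0<q) (0≤size S))))
            (0≤+ (0≤* (<⇒≤ 0<m) (<⇒≤ 0<q)) (<⇒≤ 0<q)))
          where
          slack : 0ℚ ≤ m - size S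
          slack = 0≤q-p (family-size S FS)
          total : size H + size light - (A - 1ℚ) ≡ 0ℚ
          total = trans (cong₂ _-_ (sym size-split) (sym size-Λ)) (+-inverseʳ (size Λ))
          collect : ∀ A s q M μ h l →
            (q + 1ℚ) * (M - 1ℚ) + μ * ((q + 1ℚ) * (q + 1ℚ) * (q + 1ℚ) + (1ℚ + 1ℚ) * (q + 1ℚ) * (q + 1ℚ) - (q + 1ℚ)) - A ≡
            (h + l - (A - 1ℚ)) + (s * (M - 1ℚ - 1ℚ + (μ - 1ℚ) * (s - 1ℚ)) - h)
              + ((q + 1ℚ) * (q + 1ℚ + ((q + 1ℚ) * (q + 1ℚ) * μ + (q + 1ℚ) * (μ - 1ℚ))) - l)
              + (q + 1ℚ - s) * (M - 1ℚ - 1ℚ) + (μ - 1ℚ) * (q + 1ℚ - s) * (q + s) + ((q + 1ℚ) * q + q)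
          collect = solve-∀ ℚ-ring
        decide : Dec (A ≤ m * (M - 1ℚ) + μ * (m * m * m + 2ℚ * m * m - m)) → A ≤ m * (M - 1ℚ) + μ * (m * m * m + 2ℚ * m * m - m)
        decide (yes h) = h
        decide (no ¬h) = ⊥-elim (largest Family (λ _ → false) ((λ _ ()) , (λ _ _ ())) λ S FS maximum →
              ¬h (conclude S FS (Largest.H-size S (proj₁ FS) (proj₂ FS) maximum)))

-- Numerical estimates

polynomial : ℚ → List ℕ → ℚ
polynomial c []       = 0ℚ
polynomial c (a ∷ as) = ℕ→ℚ a + c * polynomial c as

0≤polynomial : ∀ {c} → 0ℚ ≤ c → ∀ as → 0ℚ ≤ polynomial c as
0≤polynomial 0≤c []       = ≤-refl
0≤polynomial 0≤c (a ∷ as) = 0≤+ (0≤ι a) (0≤* 0≤c (0≤polynomial 0≤c as))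

-- [8] in Horner form, the least value of [D - 1] in terms of q when D ≥ 9.
repunit₈ : ℚ → ℚ
repunit₈ q = 1ℚ + q * (1ℚ + q * (1ℚ + q * (1ℚ + q * (1ℚ + q * (1ℚ + q * (1ℚ + q * 1ℚ))))))

-- Expanded in powers of q - 2, each of the differences has non-negative coefficients.
module _ {q : ℚ} (2≤q : 2ℚ ≤ q) where

  private
    0≤q-2 : 0ℚ ≤ q - 2ℚ
    0≤q-2 = 0≤q-p 2≤q

  repunit-bound₁ : 0ℚ ≤ (q - 1ℚ) * repunit₈ q - 2ℚ * q * (q + 2ℚ) * (q * q + ℕ→ℚ 4 * q + 2ℚ)
  repunit-bound₁ = subst (0ℚ ≤_) (sym (expand q))
    (0≤polynomial 0≤q-2 (31 ∷ 728 ∷ 1652 ∷ 1764 ∷ 1118 ∷ 448 ∷ 112 ∷ 16 ∷ 1 ∷ []))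
    where
    expand : ∀ q →
      (q - 1ℚ) * (1ℚ + q * (1ℚ + q * (1ℚ + q * (1ℚ + q * (1ℚ + q * (1ℚ + q * (1ℚ + q * 1ℚ)))))))
        - (1ℚ + 1ℚ) * q * (q + (1ℚ + 1ℚ)) * (q * q + ℕ→ℚ 4 * q + (1ℚ + 1ℚ)) ≡
      ℕ→ℚ 31 + (q - (1ℚ + 1ℚ)) * (ℕ→ℚ 728 + (q - (1ℚ + 1ℚ)) * (ℕ→ℚ 1652 + (q - (1ℚ + 1ℚ)) * (ℕ→ℚ 1764 +
        (q - (1ℚ + 1ℚ)) * (ℕ→ℚ 1118 + (q - (1ℚ + 1ℚ)) * (ℕ→ℚ 448 + (q - (1ℚ + 1ℚ)) * (ℕ→ℚ 112 +
        (q - (1ℚ + 1ℚ)) * (ℕ→ℚ 16 + (q - (1ℚ + 1ℚ)) * (ℕ→ℚ 1 + (q - (1ℚ + 1ℚ)) * 0ℚ))))))))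
    expand = solve-∀ ℚ-ring

  repunit-bound₂ : 0ℚ < repunit₈ q - ℕ→ℚ 4 * (q + 2ℚ)
  repunit-bound₂ = subst (0ℚ <_) (sym (expand q))
    (0<+ 0<1 (0≤polynomial 0≤q-2 (238 ∷ 765 ∷ 1023 ∷ 769 ∷ 351 ∷ 97 ∷ 15 ∷ 1 ∷ [])))
    where
    expand : ∀ q →
      1ℚ + q * (1ℚ + q * (1ℚ + q * (1ℚ + q * (1ℚ + q * (1ℚ + q * (1ℚ + q * 1ℚ))))))
        - ℕ→ℚ 4 * (q + (1ℚ + 1ℚ)) ≡
      1ℚ + (ℕ→ℚ 238 + (q - (1ℚ + 1ℚ)) * (ℕ→ℚ 765 + (q - (1ℚ + 1ℚ)) * (ℕ→ℚ 1023 + (q - (1ℚ + 1ℚ)) * (ℕ→ℚ 769 +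
        (q - (1ℚ + 1ℚ)) * (ℕ→ℚ 351 + (q - (1ℚ + 1ℚ)) * (ℕ→ℚ 97 + (q - (1ℚ + 1ℚ)) * (ℕ→ℚ 15 +
        (q - (1ℚ + 1ℚ)) * (ℕ→ℚ 1 + (q - (1ℚ + 1ℚ)) * 0ℚ))))))))
    expand = solve-∀ ℚ-ring

  repunit-bound₃ : 0ℚ ≤ repunit₈ q - 2ℚ * q * (q + 2ℚ)
  repunit-bound₃ = subst (0ℚ ≤_) (sym (expand q))
    (0≤polynomial 0≤q-2 (239 ∷ 757 ∷ 1021 ∷ 769 ∷ 351 ∷ 97 ∷ 15 ∷ 1 ∷ []))
    where
    expand : ∀ q →
      1ℚ + q * (1ℚ + q * (1ℚ + q * (1ℚ + q * (1ℚ + q * (1ℚ + q * (1ℚ + q * 1ℚ))))))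
        - (1ℚ + 1ℚ) * q * (q + (1ℚ + 1ℚ)) ≡
      ℕ→ℚ 239 + (q - (1ℚ + 1ℚ)) * (ℕ→ℚ 757 + (q - (1ℚ + 1ℚ)) * (ℕ→ℚ 1021 + (q - (1ℚ + 1ℚ)) * (ℕ→ℚ 769 +
        (q - (1ℚ + 1ℚ)) * (ℕ→ℚ 351 + (q - (1ℚ + 1ℚ)) * (ℕ→ℚ 97 + (q - (1ℚ + 1ℚ)) * (ℕ→ℚ 15 +
        (q - (1ℚ + 1ℚ)) * (ℕ→ℚ 1 + (q - (1ℚ + 1ℚ)) * 0ℚ)))))))
    expand = solve-∀ ℚ-ring

  repunit-bound₄ : 0ℚ < (q - 1ℚ) * (q * repunit₈ q) - 2ℚ * ((2ℚ * q - 1ℚ) * (2ℚ * q - 1ℚ)) * (q + 2ℚ)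
  repunit-bound₄ = subst (0ℚ <_) (sym (expand q))
    (0<+ 0<1 (0≤polynomial 0≤q-2 (437 ∷ 2189 ∷ 4552 ∷ 5368 ∷ 4032 ∷ 2016 ∷ 672 ∷ 144 ∷ 18 ∷ 1 ∷ [])))
    where
    expand : ∀ q →
      (q - 1ℚ) * (q * (1ℚ + q * (1ℚ + q * (1ℚ + q * (1ℚ + q * (1ℚ + q * (1ℚ + q * (1ℚ + q * 1ℚ))))))))
        - (1ℚ + 1ℚ) * (((1ℚ + 1ℚ) * q - 1ℚ) * ((1ℚ + 1ℚ) * q - 1ℚ)) * (q + (1ℚ + 1ℚ)) ≡
      1ℚ + (ℕ→ℚ 437 + (q - (1ℚ + 1ℚ)) * (ℕ→ℚ 2189 + (q - (1ℚ + 1ℚ)) * (ℕ→ℚ 4552 + (q - (1ℚ + 1ℚ)) * (ℕ→ℚ 5368 +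
        (q - (1ℚ + 1ℚ)) * (ℕ→ℚ 4032 + (q - (1ℚ + 1ℚ)) * (ℕ→ℚ 2016 + (q - (1ℚ + 1ℚ)) * (ℕ→ℚ 672 +
        (q - (1ℚ + 1ℚ)) * (ℕ→ℚ 144 + (q - (1ℚ + 1ℚ)) * (ℕ→ℚ 18 + (q - (1ℚ + 1ℚ)) * (ℕ→ℚ 1 +
        (q - (1ℚ + 1ℚ)) * 0ℚ))))))))))
    expand = solve-∀ ℚ-ring

-- The variables are q = b, s = [D - 1], n = |C| - 1 for a largest clique C, and μ = c₂ - 1.
module Incompatible (q s α β n μ : ℚ) (2≤q : 2ℚ ≤ q) (s-large : repunit₈ q ≤ s)
  (α-large : q * q * (q + 1ℚ) + 1ℚ ≤ α) (αs≤β : α * s ≤ β) (μ-eq : μ ≡ q + α * (q + 1ℚ))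
  (a₁-bound : β + α * (q * s) ≤ (q + 1ℚ) * n
     + μ * ((q + 1ℚ) * (q + 1ℚ) * (q + 1ℚ) + 2ℚ * (q + 1ℚ) * (q + 1ℚ) - (q + 1ℚ)))
  (n≤β : n ≤ β)
  (count-bound : (β + α * (q * s) - n) * (n - μ) ≤ (q + 1ℚ) * q * ((1ℚ + q * s) * β - n)) where

  -- The coefficient of μ in `a₁-bound` is mG. `Y - n` is the coefficient of β in the difference of
  -- the two sides of `count-bound`. The factor m₁ serves in the estimates μ ≤ w ≤ αm₁.
  m m₁ B A Q G w Y : ℚ
  m  = q + 1ℚ
  m₁ = q + 2ℚ
  B  = q * s
  A  = β + α * B
  Q  = m * q
  G  = q * q + ℕ→ℚ 4 * q + 2ℚ
  w  = μ + Q
  Y  = Q * B + w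

  0≤q-2 : 0ℚ ≤ q - 2ℚ
  0≤q-2 = 0≤q-p 2≤q

  0<2 : 0ℚ < 2ℚ
  0<2 = 0<+ 0<1 0≤1

  0<q : 0ℚ < q
  0<q = <-≤-trans 0<2 2≤q

  0<q-1 : 0ℚ < q - 1ℚ
  0<q-1 = subst (0ℚ <_) (shift q) (0<+ 0<1 0≤q-2)
    where
    shift : ∀ q → 1ℚ + (q - (1ℚ + 1ℚ)) ≡ q - 1ℚ
    shift = solve-∀ ℚ-ring

  0<m : 0ℚ < m
  0<m = 0<+ 0<q 0≤1

  0<m₁ : 0ℚ < m₁
  0<m₁ = 0<+ 0<q (<⇒≤ 0<2)

  0<Q : 0ℚ < Q
  0<Q = 0<* 0<m 0<q

  0≤G : 0ℚ ≤ G
  0≤G = 0≤+ (0≤+ (0≤p² q) (0≤* (0≤ι 4) (<⇒≤ 0<q))) (<⇒≤ 0<2)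

  0≤s-rep : 0ℚ ≤ s - repunit₈ q
  0≤s-rep = 0≤q-p s-large

  s₁ : 0ℚ ≤ (q - 1ℚ) * s - 2ℚ * q * m₁ * G
  s₁ = subst (0ℚ ≤_) (join (q - 1ℚ) s (repunit₈ q) (2ℚ * q * m₁ * G)) (0≤+ (repunit-bound₁ 2≤q) (0≤* (<⇒≤ 0<q-1) 0≤s-rep))
    where
    join : ∀ p s r t → p * r - t + p * (s - r) ≡ p * s - t
    join = solve-∀ ℚ-ring

  join₁ : ∀ s r t → r - t + (s - r) ≡ s - t
  join₁ = solve-∀ ℚ-ring

  s₂ : 0ℚ < s - ℕ→ℚ 4 * m₁
  s₂ = subst (0ℚ <_) (join₁ s (repunit₈ q) (ℕ→ℚ 4 * m₁)) (0<+ (repunit-bound₂ 2≤q) 0≤s-rep)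

  s₃ : 0ℚ ≤ s - 2ℚ * q * m₁
  s₃ = subst (0ℚ ≤_) (join₁ s (repunit₈ q) (2ℚ * q * m₁)) (0≤+ (repunit-bound₃ 2≤q) 0≤s-rep)

  s₄ : 0ℚ < (q - 1ℚ) * B - 2ℚ * ((2ℚ * q - 1ℚ) * (2ℚ * q - 1ℚ)) * m₁
  s₄ = subst (0ℚ <_) (join (q - 1ℚ) q s (repunit₈ q) (2ℚ * ((2ℚ * q - 1ℚ) * (2ℚ * q - 1ℚ)) * m₁))
    (0<+ (repunit-bound₄ 2≤q) (0≤* (0≤* (<⇒≤ 0<q-1) (<⇒≤ 0<q)) 0≤s-rep))
    where
    join : ∀ p q s r t → p * (q * r) - t + p * q * (s - r) ≡ p * (q * s) - t
    join = solve-∀ ℚ-ring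

  0<s : 0ℚ < s
  0<s = subst (0ℚ <_) (join s (ℕ→ℚ 4 * m₁)) (0<+ s₂ (0≤* (0≤ι 4) (<⇒≤ 0<m₁)))
    where
    join : ∀ s t → s - t + t ≡ s
    join = solve-∀ ℚ-ring

  0<B : 0ℚ < B
  0<B = 0<* 0<q 0<s

  0≤α-qQ : 0ℚ ≤ α - q * Q - 1ℚ
  0≤α-qQ = subst (0ℚ ≤_) (regroup α q) (0≤q-p α-large)
    where
    regroup : ∀ α q → α - (q * q * (q + 1ℚ) + 1ℚ) ≡ α - q * ((q + 1ℚ) * q) - 1ℚ
    regroup = solve-∀ ℚ-ring

  0<α-2Q : 0ℚ < α - 2ℚ * Q
  0<α-2Q = subst (0ℚ <_) (regroup α q Q) (0<+ 0<1 (0≤+ 0≤α-qQ (0≤* 0≤q-2 (<⇒≤ 0<Q))))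
    where
    regroup : ∀ α q Q → 1ℚ + (α - q * Q - 1ℚ + (q - (1ℚ + 1ℚ)) * Q) ≡ α - (1ℚ + 1ℚ) * Q
    regroup = solve-∀ ℚ-ring

  0<α : 0ℚ < α
  0<α = subst (0ℚ <_) (join α (2ℚ * Q)) (0<+ 0<α-2Q (0≤* (<⇒≤ 0<2) (<⇒≤ 0<Q)))
    where
    join : ∀ s t → s - t + t ≡ s
    join = solve-∀ ℚ-ring

  0≤w-gap : 0ℚ ≤ α * m₁ - w
  0≤w-gap = subst (0ℚ ≤_) (trans (regroup α q) (cong (λ i → α * m₁ - (i + Q)) (sym μ-eq)))
    (0≤+ (<⇒≤ 0<α-2Q) (0≤p² q))
    where
    regroup : ∀ α q → α - (1ℚ + 1ℚ) * ((q + 1ℚ) * q) + q * q ≡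
      α * (q + (1ℚ + 1ℚ)) - (q + α * (q + 1ℚ) + (q + 1ℚ) * q)
    regroup = solve-∀ ℚ-ring

  0≤μ-gap : 0ℚ ≤ α * m₁ - μ
  0≤μ-gap = subst (0ℚ ≤_) (regroup (α * m₁) μ Q) (0≤+ 0≤w-gap (<⇒≤ 0<Q))
    where
    regroup : ∀ p μ Q → p - (μ + Q) + Q ≡ p - μ
    regroup = solve-∀ ℚ-ring

  0≤w : 0ℚ ≤ w
  0≤w = 0≤+ (subst (0ℚ ≤_) (sym μ-eq) (0≤+ (<⇒≤ 0<q) (0≤* (<⇒≤ 0<α) (<⇒≤ 0<m)))) (<⇒≤ 0<Q)

  0≤β-αs : 0ℚ ≤ β - α * s
  0≤β-αs = 0≤q-p αs≤β

  -- The error term is μmG ≤ αm₁mG, whereas A is at least αms because β ≥ αs. Passing from mn to 2qn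
  -- costs a factor of at least 2q/m, and by `s₁` this gain exceeds the error.
  A≤2qn : 0ℚ ≤ 2ℚ * q * n - A
  A≤2qn = 0≤*-cancel 0<m (subst (0ℚ ≤_) (sym (split q s α β n μ))
    (0≤+ (0≤+ (0≤+ (0≤* (0≤* (<⇒≤ 0<2) (<⇒≤ 0<q)) (0≤q-p a₁-bound)) (0≤* (<⇒≤ 0<q-1) 0≤β-αs))
              (0≤* (0≤* (<⇒≤ 0<α) (<⇒≤ 0<m)) s₁))
         (0≤* (0≤* (0≤* (<⇒≤ 0<2) (<⇒≤ 0<q)) (0≤* (<⇒≤ 0<m) 0≤G)) 0≤μ-gap)))
    where
    split : ∀ q s α β n μ → (q + 1ℚ) * ((1ℚ + 1ℚ) * q * n - (β + α * (q * s))) ≡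
      (1ℚ + 1ℚ) * q * ((q + 1ℚ) * n
          + μ * ((q + 1ℚ) * (q + 1ℚ) * (q + 1ℚ) + (1ℚ + 1ℚ) * (q + 1ℚ) * (q + 1ℚ) - (q + 1ℚ))
          - (β + α * (q * s)))
        + (q - 1ℚ) * (β - α * s)
        + α * (q + 1ℚ) * ((q - 1ℚ) * s - (1ℚ + 1ℚ) * q * (q + (1ℚ + 1ℚ)) * (q * q + ℕ→ℚ 4 * q + (1ℚ + 1ℚ)))
        + (1ℚ + 1ℚ) * q * ((q + 1ℚ) * (q * q + ℕ→ℚ 4 * q + (1ℚ + 1ℚ))) * (α * (q + (1ℚ + 1ℚ)) - μ)
    split = solve-∀ ℚ-ring

  0≤2n-αs : 0ℚ ≤ 2ℚ * n - α * s
  0≤2n-αs = 0≤*-cancel 0<q (subst (0ℚ ≤_) (regroup q s α β n)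
    (0≤+ (0≤+ A≤2qn 0≤β-αs) (0≤* (<⇒≤ 0<α) (<⇒≤ 0<s))))
    where
    regroup : ∀ q s α β n → (1ℚ + 1ℚ) * q * n - (β + α * (q * s)) + (β - α * s) + α * s ≡ q * ((1ℚ + 1ℚ) * n - α * s)
    regroup = solve-∀ ℚ-ring

  0≤2n : 0ℚ ≤ 2ℚ * n
  0≤2n = subst (0ℚ ≤_) (regroup (2ℚ * n) (α * s)) (0≤+ 0≤2n-αs (0≤* (<⇒≤ 0<α) (<⇒≤ 0<s)))
    where
    regroup : ∀ p r → p - r + r ≡ p
    regroup = solve-∀ ℚ-ring

  -- As α > 2Q, the left part is at least αn/2, and n ≥ αs/2 with s > 4m₁ makes this exceed α²m₁ ≥
  -- αμ.
  0<main : 0ℚ < (α - Q) * n - α * μ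
  0<main = 0<*-cancel {p = ℕ→ℚ 4} (positive⁻¹ (ℕ→ℚ 4)) (subst (0ℚ <_) (regroup α Q n s m₁ μ)
    (0<+ (0<* (0<* 0<α 0<α) s₂) (0≤+ (0≤+ (0≤* (<⇒≤ 0<α-2Q) 0≤2n) (0≤* (<⇒≤ 0<α) 0≤2n-αs))
      (0≤* (0≤* (0≤ι 4) (<⇒≤ 0<α)) 0≤μ-gap))))
    where
    regroup : ∀ α Q n s m₁ μ →
      α * α * (s - ℕ→ℚ 4 * m₁) + ((α - (1ℚ + 1ℚ) * Q) * ((1ℚ + 1ℚ) * n) + α * ((1ℚ + 1ℚ) * n - α * s)
        + ℕ→ℚ 4 * α * (α * m₁ - μ)) ≡ ℕ→ℚ 4 * ((α - Q) * n - α * μ)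
    regroup = solve-∀ ℚ-ring

  0≤deficit : 0ℚ ≤ Q * ((1ℚ + B) * β - n) - (A - n) * (n - μ)
  0≤deficit = 0≤q-p count-bound

  -- If Y ≤ n, the slack of the counting bound does not increase with β, so β may be lowered to n.
  -- There the slack equals -B((α - Q)n - αμ), which is negative by `0<main`.
  n<Y : ¬ (Y ≤ n)
  n<Y Y≤n = <-irrefl refl (subst (0ℚ <_) (cancel α β B Q n μ)
    (0<+ (0<* 0<B 0<main) (0≤+ (0≤* (0≤q-p n≤β) (0≤q-p Y≤n)) 0≤deficit)))
    where
    cancel : ∀ α β B Q n μ →
      B * ((α - Q) * n - α * μ) + ((β - n) * (n - (Q * B + (μ + Q)))
        + (Q * ((1ℚ + B) * β - n) - (β + α * B - n) * (n - μ))) ≡ 0ℚ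
    cancel = solve-∀ ℚ-ring

  0≤Y-n : 0ℚ ≤ Y - n
  0≤Y-n = 0≤q-p (<⇒≤ (≰⇒> n<Y))

  -- Here 2qQB + 2qw ≥ 2qn ≥ A ≥ αB + αs, and 2qw ≤ 2qαm₁ ≤ αs.
  α≤2qQ : 0ℚ ≤ 2ℚ * q * Q - α
  α≤2qQ = 0≤*-cancel 0<B (subst (0ℚ ≤_) (regroup q s α β n Q w m₁)
    (0≤+ (0≤+ (0≤+ (0≤+ (0≤* (0≤* (<⇒≤ 0<2) (<⇒≤ 0<q)) 0≤Y-n) A≤2qn) 0≤β-αs) (0≤* (<⇒≤ 0<α) s₃))
      (0≤* (0≤* (<⇒≤ 0<2) (<⇒≤ 0<q)) 0≤w-gap)))
    where
    regroup : ∀ q s α β n Q w m₁ →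
      (1ℚ + 1ℚ) * q * (Q * (q * s) + w - n) + ((1ℚ + 1ℚ) * q * n - (β + α * (q * s))) + (β - α * s)
        + α * (s - (1ℚ + 1ℚ) * q * m₁) + (1ℚ + 1ℚ) * q * (α * m₁ - w) ≡ (q * s) * ((1ℚ + 1ℚ) * q * Q - α)
    regroup = solve-∀ ℚ-ring

  -- The chain is w ≤ αm₁ ≤ 2qQm₁ ≤ Qs ≤ QB.
  w≤QB : 0ℚ ≤ Q * B - w
  w≤QB = subst (0ℚ ≤_) (regroup q s α Q w m₁)
    (0≤+ (0≤+ (0≤+ 0≤w-gap (0≤* (<⇒≤ 0<m₁) α≤2qQ)) (0≤* (<⇒≤ 0<Q) s₃)) (0≤* (<⇒≤ 0<Q) (0≤* (<⇒≤ 0<q-1) (<⇒≤ 0<s))))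
    where
    regroup : ∀ q s α Q w m₁ →
      α * m₁ - w + m₁ * ((1ℚ + 1ℚ) * q * Q - α) + Q * (s - (1ℚ + 1ℚ) * q * m₁) + Q * ((q - 1ℚ) * s) ≡ Q * (q * s) - w
    regroup = solve-∀ ℚ-ring

  n≤2QB : 0ℚ ≤ 2ℚ * (Q * B) - n
  n≤2QB = subst (0ℚ ≤_) (regroup (Q * B) w n) (0≤+ 0≤Y-n w≤QB)
    where
    regroup : ∀ p w n → p + w - n + (p - w) ≡ (1ℚ + 1ℚ) * p - n
    regroup = solve-∀ ℚ-ring

  -- Now Y - n ≥ 0, so β may be raised to 2qn - αB in the counting bound. This leaves a quadratic in
  -- n with leading coefficient -(2q - 1); multiplied by 2q - 1 it is completed to the square of (2q
  -- - 1)n - qQB. What remains of the main term is a positive multiple of q - 1, from α ≥ qQ, and by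
  -- `s₄` it outweighs the terms containing w.
  absurd : ⊥
  absurd = <-irrefl refl (subst (0ℚ <_) (cancel q Q B α β n μ m₁)
    (0<+ (0<* (0<* (0<* 0<Q 0<B) 0<α) s₄)
      (0≤+ (0≤+ (0≤+ (0≤+ (0≤* (0≤* (<⇒≤ 0<q) (0≤* (<⇒≤ 0<Q) (0≤p² B))) 0≤α-qQ′)
                          (0≤* (0≤p² (2ℚ * q - 1ℚ)) (0≤+ (0≤* (0≤* (<⇒≤ 0<2) 0≤QB) 0≤w-gap) (0≤* n≤2QB 0≤w))))
                    (0≤* 0≤2q-1 (0≤* (<⇒≤ 0<α) 0≤QB)))
              (0≤p² ((2ℚ * q - 1ℚ) * n - q * (Q * B))))
        (0≤* 0≤2q-1 (0≤+ (0≤* A≤2qn 0≤Y-n) 0≤deficit)))))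
    where
    0≤QB : 0ℚ ≤ Q * B
    0≤QB = 0≤* (<⇒≤ 0<Q) (<⇒≤ 0<B)
    0≤2q-1 : 0ℚ ≤ 2ℚ * q - 1ℚ
    0≤2q-1 = subst (0ℚ ≤_) (regroup q) (0≤+ (<⇒≤ 0<q) (<⇒≤ 0<q-1))
      where
      regroup : ∀ q → q + (q - 1ℚ) ≡ (1ℚ + 1ℚ) * q - 1ℚ
      regroup = solve-∀ ℚ-ring
    0≤α-qQ′ : 0ℚ ≤ α - q * Q
    0≤α-qQ′ = subst (0ℚ ≤_) (regroup α (q * Q)) (0≤+ 0≤α-qQ 0≤1)
      where
      regroup : ∀ α p → α - p - 1ℚ + 1ℚ ≡ α - p
      regroup = solve-∀ ℚ-ring
    cancel : ∀ q Q B α β n μ m₁ →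
      Q * B * α * ((q - 1ℚ) * B - (1ℚ + 1ℚ) * (((1ℚ + 1ℚ) * q - 1ℚ) * ((1ℚ + 1ℚ) * q - 1ℚ)) * m₁)
        + (q * (Q * (B * B)) * (α - q * Q)
          + ((1ℚ + 1ℚ) * q - 1ℚ) * ((1ℚ + 1ℚ) * q - 1ℚ)
              * ((1ℚ + 1ℚ) * (Q * B) * (α * m₁ - (μ + Q)) + ((1ℚ + 1ℚ) * (Q * B) - n) * (μ + Q))
          + ((1ℚ + 1ℚ) * q - 1ℚ) * (α * (Q * B))
          + (((1ℚ + 1ℚ) * q - 1ℚ) * n - q * (Q * B)) * (((1ℚ + 1ℚ) * q - 1ℚ) * n - q * (Q * B))
          + ((1ℚ + 1ℚ) * q - 1ℚ) * (((1ℚ + 1ℚ) * q * n - (β + α * B)) * (Q * B + (μ + Q) - n)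
              + (Q * ((1ℚ + B) * β - n) - (β + α * B - n) * (n - μ)))) ≡ 0ℚ
    cancel = solve-∀ ℚ-ring

-- The contradiction drawn from a largest clique

module Contradiction {D b α β c bb} (Γ : DistanceRegular D c bb) (cl : Classical D b α β c bb)
    (9≤D : 9 ℕ.≤ D) (α-large : ℕ→ℚ b * ℕ→ℚ b * (ℕ→ℚ b + 1ℚ) + 1ℚ ≤ α)
    (μ₀ : ℕ) (c₂-μ₀ : c 2 ≡ 1ℚ + ℕ→ℚ μ₀) where
  open DistanceRegular Γ
  open Spectral Γ
  open ClassicalProperties cl
  open Cliques Γ cl using (IsClique; clique-insert; clique-singleton; clique-bound; μ; A; Q)
  open Neighbourhood Γ cl μ₀ c₂-μ₀ using (ν; module Edge)

  μ-eq : μ ≡ q + α * (q + 1ℚ)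
  μ-eq = trans (cong (_- 1ℚ) c₂-eq) (expand q α)
    where
    expand : ∀ q α → (q + 1ℚ) * (1ℚ + α) - 1ℚ ≡ q + α * (q + 1ℚ)
    expand = solve-∀ ℚ-ring

  0≤αm : 0ℚ ≤ α * (q + 1ℚ)
  0≤αm = 0≤* 0≤α (0≤+ (<⇒≤ 0<q) 0≤1)

  0<μ : 0ℚ < μ
  0<μ = subst (0ℚ <_) (sym μ-eq) (0<+ 0<q 0≤αm)

  0≤ν : 0ℚ ≤ ν
  0≤ν = subst (0ℚ ≤_) (trans (shift q (α * (q + 1ℚ))) (cong (_- 1ℚ) (sym μ-eq))) (0≤+ (<⇒≤ 0<q-1) 0≤αm)
    where
    shift : ∀ q p → q - 1ℚ + p ≡ q + p - 1ℚ
    shift = solve-∀ ℚ-ring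

  s-large : repunit₈ q ≤ s
  s-large = subst (_≤ s) (g-repunit) (g-mono {8} {ℕ.pred D} (ℕP.≤-pred (subst (9 ℕ.≤_) (sym D≡) 9≤D)))
    where
    next : ∀ i {p} → g i ≡ p → g (suc i) ≡ 1ℚ + q * p
    next i eq = trans (g-suc i) (cong (λ t → 1ℚ + q * t) eq)
    g-repunit : g 8 ≡ repunit₈ q
    g-repunit = next 7 (next 6 (next 5 (next 4 (next 3 (next 2 (next 1 refl))))))

  neighbour : ∀ x → ∃ λ y → (x ~ y) ≡ true
  neighbour x = pick (find (x ~_))
    where
    pick : (∃ λ y → (x ~ y) ≡ true) ⊎ (∀ y → (x ~ y) ≡ false) → ∃ λ y → (x ~ y) ≡ true
    pick (inj₁ found) = found
    pick (inj₂ none)  = ⊥-elim (<-irrefl refl (subst (0ℚ <_)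
      (trans (sym (valency x)) (∑-zero (λ y → cong [_] (none y)))) 0<k))

  module _ (x : V) (C : V → Bool) (clique : IsClique C) (maximum : ∀ C′ → IsClique C′ → size C′ ≤ size C) where

    member : ∃ λ y → C y ≡ true
    member = pick (find C)
      where
      pick : (∃ λ y → C y ≡ true) ⊎ (∀ y → C y ≡ false) → ∃ λ y → C y ≡ true
      pick (inj₁ found) = found
      pick (inj₂ none)  = ⊥-elim (<-irrefl refl (<-≤-trans 0<1 (subst₂ _≤_ (∑-== x)
        (∑-zero (λ y → cong [_] (none y)))
        (maximum (x ==_) (clique-singleton x)))))

    maximal : ∀ z → C z ≡ false → ∃ λ y → C y ≡ true × (z ~ y) ≡ false
    maximal z Cz = pick (find (λ y → C y ∧ not (z ~ y)))
      where
      joined : (∀ y → C y ∧ not (z ~ y) ≡ false) → ∀ y → C y ≡ true → (z ~ y) ≡ true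
      joined none y Cy = BoolP.not-injective (subst (λ i → i ∧ not (z ~ y) ≡ false) Cy (none y))
      extended : (∀ y → C y ≡ true → (z ~ y) ≡ true) → IsClique (insert z C)
      extended join = clique-insert C z clique join
      pick : (∃ λ y → C y ∧ not (z ~ y) ≡ true) ⊎ (∀ y → C y ∧ not (z ~ y) ≡ false) →
             ∃ λ y → C y ≡ true × (z ~ y) ≡ false
      pick (inj₁ (y , h)) = y , proj₁ (∧-true {C y} h) , BoolP.not-injective (proj₂ (∧-true {C y} h))
      pick (inj₂ none) = ⊥-elim (<-irrefl refl (<-≤-trans (<-by (cancel (size C)) 0<1)
        (subst (_≤ size C) (size-insert z C Cz) (maximum (insert z C) (extended (joined none))))))
        where
        cancel : ∀ p → p + 1ℚ - p ≡ 1ℚ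
        cancel = solve-∀ ℚ-ring

    module MC = Cliques.MaximalClique Γ cl C clique maximal

    y : V
    y = proj₁ (neighbour x)

    module E = Edge x y (proj₂ (neighbour x))

    decided : ∀ {P : Set} (P? : Dec P) → does P? ≡ true → P
    decided (yes p) _ = p

    refuted : ∀ {P : Set} (P? : Dec P) → does P? ≡ false → ¬ P
    refuted (no ¬p) _ = ¬p

    module X = E.Extremal 0<μ 0≤ν (size C) maximum (λ z → does (E.q′ ≤? E.degree E.Λ z))
      (λ z h → decided (E.q′ ≤? E.degree E.Λ z) h)
      (λ z h → <⇒≤ (≰⇒> (refuted (E.q′ ≤? E.degree E.Λ z) h)))

    0<n : 0ℚ < size C - 1ℚ
    0<n = subst (0ℚ <_) (shift (size C)) (0<+ 0<1 X.2≤M)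
      where
      shift : ∀ M → 1ℚ + (M - 1ℚ - 1ℚ) ≡ M - 1ℚ
      shift = solve-∀ ℚ-ring

    n≤β : size C - 1ℚ ≤ β
    n≤β = ≤-by (shift (size C) β) (0≤q-p (clique-bound (proj₁ member) C (proj₂ member) clique))
      where
      shift : ∀ M β → β - (M - 1ℚ) ≡ 1ℚ + β - M
      shift = solve-∀ ℚ-ring

    largest-clique-absurd : ⊥
    largest-clique-absurd = Incompatible.absurd q s α β (size C - 1ℚ) μ 2≤q s-large α-large (<⇒≤ αs<β) μ-eq
      X.a₁-bound n≤β
      (subst (λ k → (A - (size C - 1ℚ)) * (size C - 1ℚ - μ) ≤ Q * (k - (size C - 1ℚ))) k-eq (MC.clique-inequality 0<n))

  absurd : V → ⊥
  absurd x = largest IsClique (λ _ → false) (λ _ _ ()) (largest-clique-absurd x)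

-- From walks and lists in a graph to distances and sums

module GraphDistance (G : Graph) (D : ℕ) (c bb : ℕ → ℕ) (drg : IsDistanceRegular G D c bb) where

  private
    V : Set
    V = Fin (Graph.n G)

    diameter : ∀ x y → ∃ λ i → i ℕ.≤ D × Dist G x y i
    diameter = proj₁ (proj₁ (proj₂ drg))

    far : ∃ λ x → ∃ λ y → Dist G x y D
    far = proj₂ (proj₁ (proj₂ drg))

    counts = proj₂ (proj₂ drg)

  -- The diameter hypothesis supplies a distance for every pair. This makes adjacency decidable as
  -- distance one, although `Adj` is an arbitrary relation.
  dist : V → V → ℕ
  dist x y = proj₁ (diameter x y)

  dist≤D : ∀ x y → dist x y ℕ.≤ D
  dist≤D x y = proj₁ (proj₂ (diameter x y))

  dist-Dist : ∀ x y → Dist G x y (dist x y)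
  dist-Dist x y = proj₂ (proj₂ (diameter x y))

  walk : ∀ x y → Walk G x y (dist x y)
  walk x y = proj₁ (dist-Dist x y)

  dist≤ : ∀ {x y k} → Walk G x y k → dist x y ℕ.≤ k
  dist≤ {x} {y} {k} w = ℕP.≮⇒≥ λ k<d → proj₂ (dist-Dist x y) k k<d w

  Dist⇒≡ : ∀ {x y i} → Dist G x y i → dist x y ≡ i
  Dist⇒≡ {x} {y} {i} (w , minimal) = ℕP.≤-antisym (dist≤ w) (ℕP.≮⇒≥ λ d<i → minimal (dist x y) d<i (walk x y))

  ≡⇒Dist : ∀ {x y i} → dist x y ≡ i → Dist G x y i
  ≡⇒Dist {x} {y} refl = dist-Dist x y

  extend : ∀ {x y z k} → Walk G x y k → Graph.Adj G y z → Walk G x z (suc k)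
  extend here       yz = step yz here
  extend (step a w) yz = step a (extend w yz)

  reverse : ∀ {x y k} → Walk G x y k → Walk G y x k
  reverse here       = here
  reverse (step a w) = extend (reverse w) (Graph.sym G a)

  dist-sym : ∀ x y → dist x y ≡ dist y x
  dist-sym x y = ℕP.≤-antisym (dist≤ (reverse (walk y x))) (dist≤ (reverse (walk x y)))

  dist-refl : ∀ x → dist x x ≡ 0
  dist-refl x = ℕP.n≤0⇒n≡0 (dist≤ here)

  walk-zero : ∀ {x y k} → k ≡ 0 → Walk G x y k → x ≡ y
  walk-zero _  here = refl
  walk-zero () (step _ _)

  dist-zero : ∀ {x y} → dist x y ≡ 0 → x ≡ y
  dist-zero {x} {y} eq = walk-zero eq (walk x y)

  walk-one : ∀ {x y k} → k ≡ 1 → Walk G x y k → Graph.Adj G x y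
  walk-one refl (step a here) = a

  dist-one : ∀ {x y} → dist x y ≡ 1 → Graph.Adj G x y
  dist-one {x} {y} eq = walk-one eq (walk x y)

  adjacent : ∀ {x y} → Graph.Adj G x y → dist x y ≡ 1
  adjacent {x} {y} a = ℕP.≤-antisym (dist≤ (step a here)) (ℕP.n≢0⇒n>0 λ eq → loop (dist-zero eq) a)
    where
    loop : ∀ {x y} → x ≡ y → ¬ Graph.Adj G x y
    loop refl = Graph.irrefl G

  dist-lipschitz : ∀ x {y z} → Graph.Adj G y z → dist x z ℕ.≤ suc (dist x y)
  dist-lipschitz x {y} a = dist≤ (extend (walk x y) a)

  dist-step : ∀ x y z → dist y z ≡ 1 →
              dist x z ≡ dist x y ⊎ dist x z ≡ suc (dist x y) ⊎ suc (dist x z) ≡ dist x y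
  dist-step x y z eq = compare (ℕP.<-cmp (dist x z) (dist x y))
    where
    a : Graph.Adj G y z
    a = dist-one eq
    compare : Tri (dist x z ℕ.< dist x y) (dist x z ≡ dist x y) (dist x y ℕ.< dist x z) →
              dist x z ≡ dist x y ⊎ dist x z ≡ suc (dist x y) ⊎ suc (dist x z) ≡ dist x y
    compare (tri≈ _ e _) = inj₁ e
    compare (tri> _ _ y<z) = inj₂ (inj₁ (ℕP.≤-antisym (dist-lipschitz x a) y<z))
    compare (tri< z<y _ _) = inj₂ (inj₂ (ℕP.≤-antisym z<y (dist-lipschitz x (Graph.sym G a))))

  size-list : ∀ {n} (P : Fin n → Bool) l → Unique l → (∀ z → z ∈ l → P z ≡ true) →
              (∀ z → P z ≡ true → z ∈ l) → size P ≡ ℕ→ℚ (length l)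
  size-list P [] _ _ from = ∑-zero λ z → cong [_] (BoolP.¬-not λ Pz → absent (from z Pz))
    where
    absent : ∀ {z} → ¬ (z ∈ [])
    absent ()
  size-list P (w ∷ l) (w∉l ∷ unique) to from = begin
    size P                       ≡⟨ shift (size P) ⟩
    1ℚ + (size P - 1ℚ)           ≡⟨ cong (λ i → 1ℚ + i) (size-remove w P (to w (here refl))) ⟨
    1ℚ + size (remove w P)       ≡⟨ cong (λ i → 1ℚ + i) (size-list (remove w P) l unique to′ from′) ⟩
    1ℚ + ℕ→ℚ (length l)          ≡⟨ ι-suc (length l) ⟨
    ℕ→ℚ (suc (length l)) ∎
    where
    open ≡-Reasoning
    shift : ∀ p → p ≡ 1ℚ + (p - 1ℚ)
    shift = solve-∀ ℚ-ring
    to′ : ∀ z → z ∈ l → remove w P z ≡ true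
    to′ z z∈l = cong₂ _∧_ (to z (there z∈l)) (cong not (≢⇒== (All.lookup w∉l z∈l)))
    from′ : ∀ z → remove w P z ≡ true → z ∈ l
    from′ z h with remove-elim w P z h
    ... | Pz , w≢z with from z Pz
    ...   | here refl = contradiction refl w≢z
    ...   | there z∈l = z∈l

  count-size : ∀ {P : V → Set} {k} → HasSize G P k → (p : V → Bool) →
    (∀ z → P z → p z ≡ true) → (∀ z → p z ≡ true → P z) → size p ≡ ℕ→ℚ k
  count-size (l , unique , refl , mem) p to from =
    size-list p l unique (λ z z∈l → to z (Equivalence.to (mem z) z∈l)) (λ z h → Equivalence.from (mem z) (from z h))

  ≡ᵇ-≡ : ∀ {i j} → i ≡ j → (i ≡ᵇ j) ≡ true
  ≡ᵇ-≡ {i} refl = ≡ᵇ-refl i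

  distance-regular : DistanceRegular D (λ i → ℕ→ℚ (c i)) (λ i → ℕ→ℚ (bb i))
  distance-regular = record
    { N = Graph.n G ; d = dist ; d-refl = dist-refl ; d-zero = dist-zero ; d-sym = dist-sym
    ; d≤D = dist≤D ; d-step = dist-step
    ; count-c = λ x y → trans (∑-cong (λ z → sym ([∧] (dist y z ≡ᵇ 1) (suc (dist x z) ≡ᵇ dist x y))))
        (count-size (proj₁ (counts (dist x y) x y (dist≤D x y) (dist-Dist x y))) _
          (λ z h → cong₂ _∧_ (≡ᵇ-≡ (adjacent (proj₁ h))) (≡ᵇ-≡ (closer x y z (proj₂ h))))
          (λ z h → dist-one (≡ᵇ-true (dist y z) 1 (proj₁ (∧-true {dist y z ≡ᵇ 1} h))) ,
                   dist x z , ≡ᵇ-true _ _ (proj₂ (∧-true {dist y z ≡ᵇ 1} h)) , dist-Dist x z))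
    ; count-b = λ x y → trans (∑-cong (λ z → sym ([∧] (dist y z ≡ᵇ 1) (dist x z ≡ᵇ suc (dist x y)))))
        (count-size (proj₂ (counts (dist x y) x y (dist≤D x y) (dist-Dist x y))) _
          (λ z h → cong₂ _∧_ (≡ᵇ-≡ (adjacent (proj₁ h))) (≡ᵇ-≡ (Dist⇒≡ (proj₂ h))))
          (λ z h → dist-one (≡ᵇ-true (dist y z) 1 (proj₁ (∧-true {dist y z ≡ᵇ 1} h))) ,
                   ≡⇒Dist (≡ᵇ-true _ _ (proj₂ (∧-true {dist y z ≡ᵇ 1} h)))))
    }
    where
    closer : ∀ x y z → (∃ λ j → suc j ≡ dist x y × Dist G x z j) → suc (dist x z) ≡ dist x y
    closer x y z (j , eq , xz) = trans (cong suc (Dist⇒≡ xz)) eq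

  vertex : V
  vertex = proj₁ far

  -- On a shortest walk between two vertices `x` and `y` at distance `D`, the vertex `z` after `x`
  -- is at distance D - 1 from `y`. Then `x` is one of the neighbours of `z` that b_(D-1) counts for
  -- the pair `y`, `z`.
  0<b : 1 ℕ.≤ D → 0ℚ < ℕ→ℚ (bb (ℕ.pred D))
  0<b 1≤D = last (walk x y) xy
    where
    x = proj₁ far
    y = proj₁ (proj₂ far)
    xy : dist x y ≡ D
    xy = Dist⇒≡ (proj₂ (proj₂ far))
    last : ∀ {k} → Walk G x y k → k ≡ D → 0ℚ < ℕ→ℚ (bb (ℕ.pred D))
    last here D≡0 = contradiction (subst (1 ℕ.≤_) (sym D≡0) 1≤D) λ ()
    last {suc k} (step {y = z} a w) D≡ = subst (λ i → 0ℚ < ℕ→ℚ (bb i)) (trans yz (cong ℕ.pred D≡))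
      (<-≤-trans 0<1 (subst₂ _≤_ term (DistanceRegular.count-b distance-regular y z)
        (∑-term x (λ v → 0≤* (0≤[] (dist z v ≡ᵇ 1)) (0≤[] (dist y v ≡ᵇ suc (dist y z)))))))
      where
      yx : dist y x ≡ suc k
      yx = trans (dist-sym y x) (trans xy (sym D≡))
      yz : dist y z ≡ k
      yz = ℕP.≤-antisym (dist≤ (reverse w))
        (ℕP.≤-pred (subst (ℕ._≤ suc (dist y z)) yx (dist-lipschitz y (Graph.sym G a))))
      term : [ dist z x ≡ᵇ 1 ] * [ dist y x ≡ᵇ suc (dist y z) ] ≡ 1ℚ
      term = cong₂ (λ i j → [ i ] * [ j ]) (≡ᵇ-≡ (adjacent (Graph.sym G a))) (≡ᵇ-≡ (trans yx (cong suc (sym yz))))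

theorem1p1 : (D b : ℕ) → (G : Graph) → (α β : ℚ) →
    DRGClassical G D b α β → 9 ℕ.≤ D → 2 ℕ.≤ b →
    α < ℕ→ℚ (b ℕ.* b ℕ.* (b ℕ.+ 1) ℕ.+ 1)
theorem1p1 D b G α β (c , bb , drg , params) 9≤D 2≤b = decide (α <? bound)
  where
  bound : ℚ
  bound = ℕ→ℚ (b ℕ.* b ℕ.* (b ℕ.+ 1) ℕ.+ 1)
  bound-eq : bound ≡ ℕ→ℚ b * ℕ→ℚ b * (ℕ→ℚ b + 1ℚ) + 1ℚ
  bound-eq = trans (ι-+ (b ℕ.* b ℕ.* (b ℕ.+ 1)) 1) (cong (_+ 1ℚ) (trans (ι-* (b ℕ.* b) (b ℕ.+ 1))
    (cong₂ _*_ (ι-* b b) (ι-+ b 1))))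
  module GD = GraphDistance G D c bb drg
  module _ (bound≤α : bound ≤ α) where
    classical : Classical D b α β (λ i → ℕ→ℚ (c i)) (λ i → ℕ→ℚ (bb i))
    classical = record
      { 2≤b = 2≤b
      ; 2≤D = ℕP.≤-trans (ℕ.s≤s (ℕ.s≤s ℕ.z≤n)) 9≤D
      ; 0≤α = ≤-trans (0≤ι (b ℕ.* b ℕ.* (b ℕ.+ 1) ℕ.+ 1)) bound≤α
      ; 0<b = GD.0<b (ℕP.≤-trans (ℕ.s≤s ℕ.z≤n) 9≤D)
      ; c-eq = λ i i≤D → proj₁ (params i i≤D)
      ; b-eq = λ i i≤D → proj₂ (params i i≤D)
      }
    -- As c₂ is a positive natural number, its predecessor is the `μ₀` required by the counting in
    -- the common neighbourhood.
    by-c₂ : ∀ k → c 2 ≡ k → ⊥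
    by-c₂ zero eq = <-irrefl refl (subst (λ k → 0ℚ < ℕ→ℚ k) eq
      (ClassicalProperties.0<c classical 1 (ℕP.≤-trans (ℕ.s≤s (ℕ.s≤s ℕ.z≤n)) 9≤D)))
    by-c₂ (suc k) eq = Contradiction.absurd GD.distance-regular classical 9≤D
      (subst (_≤ α) bound-eq bound≤α) k (trans (cong ℕ→ℚ eq) (ι-suc k)) GD.vertex
  decide : Dec (α < bound) → α < bound
  decide (yes h) = h
  decide (no ≮)  = ⊥-elim (by-c₂ (≮⇒≥ ≮) (c 2) refl)
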